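{- There is an FPT algorithm for the (decoupled) \textsc{Spanner} problem w.r.t. $(\mu,h)$, where $\mu$ is the maximum number of nontrivial edges in the spanner and $h$ is the local neighborhood size of the instance, with running time $$\mathcal{O}\big(h^{2\mu}\cdot\mathrm{APSP}(n,m)+m^3+m^2n\log n\big).$$ That is, given a connected undirected graph $G=(V,E)$ with $n=|V|$, $m=|E|$, edge weights $w\colon E\to\mathbb{N}_{\ge0}$, edge lengths $\ell\colon E\to\mathbb{N}_{\ge1}$, a stretch factor $\alpha\ge1$, a weight bound $W\in\mathbb{N}$ and a number $\mu$, the algorithm decides within this time whether $G$ has an $\alpha$-spanner $H=(V,F)$ with $w(H)\le W$ and $|F\cap N|\le\mu$, where $N$ is the set of nontrivial edges.
   Context: For a subgraph $G'\subseteq G$ and $u,v\in V$, $\ell_{G'}[u,v]$ is the length of a shortest $u$-$v$-path in $G'$ w.r.t. $\ell$. A subgraph $H=(V,F)$, $F\subseteq E$, is an $\alpha$-spanner of $G$ if $\ell_H[u,v]\le\alpha\,\ell_G[u,v]$ for all $u,v\in V$; equivalently, for all $\{u,v\}\in E$. Its weight is $w(H)=\sum_{e\in F}w(e)$. The set of terminal pairs is $K=E$. For $\{u,v\}\in E$, a simple $u$-$v$-path $P$ is settling if $\ell(P)\le\alpha\,\ell_G[u,v]$; it is alternative if it does not contain the edge $\{u,v\}$. $\mathcal{P}_{uv}$ is the set of all settling $u$-$v$-paths. As a preprocessing convention, edges that do not settle themselves (i.e., $\ell(\{u,v\})>\alpha\,\ell_G[u,v]$) are assumed to have been removed from the instance.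 An edge $\{u,v\}$ is mandatory if $\mathcal{P}_{uv}$ contains no alternative path. The trivial edges $T\subseteq E$ are the mandatory edges and the edges of weight $0$; the nontrivial edges are $N=E\setminus T$. A terminal pair $\{u,v\}\in E$ is critical if no settling $u$-$v$-path consists only of trivial edges; $C$ denotes the set of critical terminal pairs. The local neighborhood size is $h=\max_{\{u,v\}\in C}\big|\bigcup_{P\in\mathcal{P}_{uv}}V(P)\big|$, the maximum number of nodes visited by settling paths, over all critical terminal pairs. $\mathrm{APSP}(n,m)$ denotes the running time of a suitable algorithm for the all-pairs shortest paths problem on a graph with $n$ nodes and $m$ edges. An algorithm is FPT w.r.t. a (possibly combined) parameter $k$ if on instance $I$ it runs in $\mathcal{O}(f(k)\cdot p(\langle I\rangle))$ time for a computable function $f$ and a polynomial $p$ in the encoding length $\langle I\rangle$. -}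

module Defs where

open import Data.Bool using (if_then_else_)
open import Data.Fin using (Fin; toℕ)
open import Data.Fin.Subset using (Subset; _∈_; ∣_∣; ⊤)
open import Data.Integer as ℤ using (+_)
open import Data.List using (List; []; _∷_; map; sum; tabulate; foldr)
import Data.List.Membership.Propositional as List
open import Data.List.Relation.Unary.All using (All)
open import Data.List.Relation.Unary.Unique.Propositional using (Unique)
open import Data.Nat using (ℕ; zero; suc; _+_; _*_; _∸_; _/_; _^_; _≤_; _≟_)
open import Data.Nat.Logarithm using (⌊log₂_⌋)
open import Data.Product using (∃; ∃₂; _×_; _,_)
open import Data.Rational.Unnormalised as ℚᵘ using (ℚᵘ; 1ℚᵘ; ↥_; ↧ₙ_)
open import Data.Sum using (_⊎_)
open import Data.Vec using (lookup)
open import Function.Bundles using (_⇔_)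
open import Relation.Binary.PropositionalEquality using (_≡_; _≢_)
open import Relation.Nullary using (¬_; does)

------------------------------------------------------------------------
-- Graphs, paths, distances

-- Edges are named by Fin m, so that edge sets are elements of Subset m.
-- An edge is undirected although its two ends are stored in some order.
record Graph : Set where
  field
    n m     : ℕ
    src tgt : Fin m → Fin n

  Joins : Fin m → Fin n → Fin n → Set
  Joins e u v = (src e ≡ u × tgt e ≡ v) ⊎ (src e ≡ v × tgt e ≡ u)

  field
    loopless : ∀ e → src e ≢ tgt e
    simple   : ∀ e f → Joins f (src e) (tgt e) → e ≡ f

  data Walk : Fin n → Fin n → Set where
    stop : ∀ {u} → Walk u u
    step : ∀ {u v x} (e : Fin m) → Joins e u v → Walk v x → Walk u x

  edges : ∀ {u v} → Walk u v → List (Fin m)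
  edges stop         = []
  edges (step e _ p) = e ∷ edges p

  vertices : ∀ {u v} → Walk u v → List (Fin n)
  vertices (stop {u})           = u ∷ []
  vertices (step {u = u} _ _ p) = u ∷ vertices p

  -- Paths are simple.
  record Path (u v : Fin n) : Set where
    constructor path
    field
      walk     : Walk u v
      distinct : Unique (vertices walk)

  open Path public

  Connected : Set
  Connected = ∀ u v → Path u v

-- A connected graph with positive integral edge lengths.
record Network : Set where
  field
    graph : Graph

  open Graph graph public

  field
    connected  : Connected
    ℓ          : Fin m → ℕ
    ℓ-positive : ∀ e → 1 ≤ ℓ e

  length : ∀ {u v} → Path u v → ℕ
  length P = sum (map ℓ (edges (walk P)))

  Within : Subset m → ∀ {u v} → Path u v → Set
  Within F P = All (_∈ F) (edges (walk P))

  -- ℓ_{(V,F)}[u,v] = d.  No d satisfies this when F does not connect u and v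
  -- (infinite distance).
  Distance : Subset m → Fin n → Fin n → ℕ → Set
  Distance F u v d =
      (∃ λ (P : Path u v) → Within F P × length P ≡ d)
    × (∀ (P : Path u v) → Within F P → d ≤ length P)

------------------------------------------------------------------------
-- The (decoupled) Spanner problem

_≤[_]·_ : ℕ → ℚᵘ → ℕ → Set
d ≤[ α ]· d₀ = (+ d ℚᵘ./ 1) ℚᵘ.≤ (α ℚᵘ.* (+ d₀ ℚᵘ./ 1))

HasCardinality : ∀ {k} → (Fin k → Set) → ℕ → Set
HasCardinality {k} X c = ∃ λ (S : Subset k) → (∀ x → x ∈ S ⇔ X x) × ∣ S ∣ ≡ c

record SpannerInstance : Set where
  field
    network : Network

  open Network network public

  field
    w   : Fin m → ℕ
    α   : ℚᵘ
    α≥1 : 1ℚᵘ ℚᵘ.≤ α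
    W μ : ℕ
    -- The preprocessing convention: edges that do not settle themselves
    -- have been removed.
    settles-itself : ∀ e → ∃ λ d → Distance ⊤ (src e) (tgt e) d × ℓ e ≤[ α ]· d

  weight : Subset m → ℕ
  weight F = sum (tabulate λ e → if lookup F e then w e else 0)

  IsSpanner : Subset m → Set
  IsSpanner F = ∀ u v d → Distance ⊤ u v d → ∃ λ d′ → Distance F u v d′ × d′ ≤[ α ]· d

  Settling : ∀ {u v} → Path u v → Set
  Settling {u} {v} P = ∃ λ d → Distance ⊤ u v d × length P ≤[ α ]· d

  Alternative : ∀ e → Path (src e) (tgt e) → Set
  Alternative e P = ¬ (e List.∈ edges (walk P))

  Mandatory : Fin m → Set
  Mandatory e = ¬ ∃ λ (P : Path (src e) (tgt e)) → Settling P × Alternative e P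

  Trivial : Fin m → Set
  Trivial e = Mandatory e ⊎ w e ≡ 0

  Nontrivial : Fin m → Set
  Nontrivial e = ¬ Trivial e

  -- The terminal pairs are the edges, so a terminal pair is given by an edge.
  Critical : Fin m → Set
  Critical e = ¬ ∃ λ (P : Path (src e) (tgt e)) → Settling P × All Trivial (edges (walk P))

  Visited : Fin m → Fin n → Set
  Visited e x = ∃ λ (P : Path (src e) (tgt e)) → Settling P × x List.∈ vertices (walk P)

  -- The maximum over the empty set of critical pairs is 0.
  LocalNeighborhoodSize : ℕ → Set
  LocalNeighborhoodSize h =
      (∀ e k → Critical e → HasCardinality (Visited e) k → k ≤ h)
    × ((∃ λ e → Critical e × HasCardinality (Visited e) h) ⊎ ((∀ e → ¬ Critical e) × h ≡ 0))

  Solvable : Set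
  Solvable = ∃ λ (F : Subset m) →
    IsSpanner F × weight F ≤ W ×
    (∃ λ k → HasCardinality (λ e → e ∈ F × Nontrivial e) k × k ≤ μ)

------------------------------------------------------------------------
-- Algorithms: programs for a word RAM whose memory consists of finitely many
-- scalar registers and finitely many arrays (those occurring in the program),
-- both named by natural numbers

data Op : Set where
  plus monus times div : Op

data Exp : Set where
  lit : ℕ → Exp
  var : ℕ → Exp
  get : ℕ → Exp → Exp
  bin : Op → Exp → Exp → Exp

infixr 4 _⨾_

data Cmd : Set where
  skip  : Cmd
  _≔_   : ℕ → Exp → Cmd
  put   : ℕ → Exp → Exp → Cmd   -- put a i e  is  a[i] ≔ e
  _⨾_   : Cmd → Cmd → Cmd
  cond  : Exp → Cmd → Cmd → Cmd
  while : Exp → Cmd → Cmd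

record State : Set where
  constructor state
  field
    reg : ℕ → ℕ
    arr : ℕ → ℕ → ℕ

open State public

_[_↦_] : {A : Set} → (ℕ → A) → ℕ → A → (ℕ → A)
(f [ i ↦ a ]) j = if does (i ≟ j) then a else f j

applyOp : Op → ℕ → ℕ → ℕ
applyOp plus  x y       = x + y
applyOp monus x y       = x ∸ y
applyOp times x y       = x * y
applyOp div   x zero    = 0
applyOp div   x (suc y) = x / suc y

eval : Exp → State → ℕ
eval (lit k)     s = k
eval (var x)     s = reg s x
eval (get a e)   s = arr s a (eval e s)
eval (bin o e f) s = applyOp o (eval e s) (eval f s)

size : Exp → ℕ
size (lit _)     = 1
size (var _)     = 1
size (get _ e)   = suc (size e)
size (bin _ e f) = suc (size e + size f)

-- Every value computed while evaluating the expression is at most B.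
Fits : ℕ → Exp → State → Set
Fits B e@(lit _)     s = eval e s ≤ B
Fits B e@(var _)     s = eval e s ≤ B
Fits B e@(get _ i)   s = Fits B i s × eval e s ≤ B
Fits B e@(bin _ f g) s = Fits B f s × Fits B g s × eval e s ≤ B

Bounded : ℕ → State → Set
Bounded B s = (∀ x → reg s x ≤ B) × (∀ a i → arr s a i ≤ B)

-- B ⊢ c , s ⇓[ t ] s′ : with words 0, …, B, running c from s takes t unit-cost
-- operations and ends in s′.  A run that overflows a word gets stuck; without
-- this restriction unit-cost multiplication would be unrealistically powerful.
data _⊢_,_⇓[_]_ (B : ℕ) : Cmd → State → ℕ → State → Set where
  skip   : ∀ {s} → B ⊢ skip , s ⇓[ 1 ] s
  assign : ∀ {x e s} → Fits B e s →
           B ⊢ x ≔ e , s ⇓[ suc (size e) ] state (reg s [ x ↦ eval e s ]) (arr s)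
  put    : ∀ {a i e s} → Fits B i s → Fits B e s →
           B ⊢ put a i e , s ⇓[ suc (size i + size e) ]
             state (reg s) (arr s [ a ↦ arr s a [ eval i s ↦ eval e s ] ])
  seq    : ∀ {c d s s′ s″ t t′} →
           B ⊢ c , s ⇓[ t ] s′ → B ⊢ d , s′ ⇓[ t′ ] s″ → B ⊢ c ⨾ d , s ⇓[ t + t′ ] s″
  then′  : ∀ {b c d s s′ t} → Fits B b s → eval b s ≢ 0 →
           B ⊢ c , s ⇓[ t ] s′ → B ⊢ cond b c d , s ⇓[ suc (size b + t) ] s′
  else′  : ∀ {b c d s s′ t} → Fits B b s → eval b s ≡ 0 →
           B ⊢ d , s ⇓[ t ] s′ → B ⊢ cond b c d , s ⇓[ suc (size b + t) ] s′
  loop   : ∀ {b c s s′ s″ t t′} → Fits B b s → eval b s ≢ 0 →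
           B ⊢ c , s ⇓[ t ] s′ → B ⊢ while b c , s′ ⇓[ t′ ] s″ →
           B ⊢ while b c , s ⇓[ suc (size b + (t + t′)) ] s″
  done   : ∀ {b c s} → Fits B b s → eval b s ≡ 0 →
           B ⊢ while b c , s ⇓[ suc (size b) ] s

record Problem : Set₁ where
  field
    Instance  : Set
    magnitude : Instance → ℕ
    Input     : Instance → State → Set
    Output    : Instance → State → Set

open Problem

-- The program solves the problem, with running times as permitted by Time, on
-- every machine with words of at least d · log₂ (2 + magnitude) bits, for some
-- constant d.  Memory not holding the input initially contains arbitrary words.
SolvesIn : (Q : Problem) → (Instance Q → ℕ → Set) → Cmd → Set
SolvesIn Q Time c = ∃ λ d → ∀ I B s →
  (2 + magnitude Q I) ^ d ≤ B → Bounded B s → Input Q I s →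
  ∃₂ λ t s′ → B ⊢ c , s ⇓[ t ] s′ × Output Q I s′ × Time I t

------------------------------------------------------------------------
-- Fixed-parameter tractability, for a combined parameter (k₁ , k₂)

Polynomial : Set
Polynomial = List ℕ

⟦_⟧ : Polynomial → ℕ → ℕ
⟦ p ⟧ x = foldr (λ a r → a + x * r) 0 p

Computable₂ : (ℕ → ℕ → ℕ) → Set
Computable₂ f = ∃ λ c → ∀ a b → ∃ λ B₀ → ∀ B s →
  B₀ ≤ B → Bounded B s → reg s 0 ≡ a → reg s 1 ≡ b →
  ∃₂ λ t s′ → B ⊢ c , s ⇓[ t ] s′ × reg s′ 0 ≡ f a b

-- t ∈ 𝒪(g) with constant C.  The summand 1 only matters where g vanishes, as
-- for the Spanner bound on a single node without edges, where no positive
-- running time would be at most C * g.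
_≤𝒪[_]_ : ℕ → ℕ → ℕ → Set
t ≤𝒪[ C ] g = t ≤ C * (1 + g)

IsFPT : (Q : Problem) → (encodingLength : Instance Q → ℕ) →
        (Parameter : Instance Q → ℕ → ℕ → Set) → Cmd → Set
IsFPT Q encodingLength Parameter c =
  ∃ λ f → Computable₂ f × ∃ λ p → ∃ λ C →
  SolvesIn Q (λ I t → ∀ k₁ k₂ → Parameter I k₁ k₂ →
                      t ≤𝒪[ C ] (f k₁ k₂ * ⟦ p ⟧ (encodingLength I))) c

------------------------------------------------------------------------
-- All-pairs shortest paths

module _ (N : Network) where
  open Network N

  -- Registers: 0 n, 1 m.  Arrays: 0 and 1 edge ends, 2 lengths.
  NetworkInput : State → Set
  NetworkInput s =
      reg s 0 ≡ n × reg s 1 ≡ m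
    × (∀ e → arr s 0 (toℕ e) ≡ toℕ (src e))
    × (∀ e → arr s 1 (toℕ e) ≡ toℕ (tgt e))
    × (∀ e → arr s 2 (toℕ e) ≡ ℓ e)

  -- Array 3 holds the distance matrix, row by row.
  DistanceMatrix : State → Set
  DistanceMatrix s = ∀ u v → Distance ⊤ u v (arr s 3 (toℕ u * n + toℕ v))

  networkMagnitude : ℕ
  networkMagnitude = n + m + sum (tabulate ℓ)

APSP : Problem
APSP = record
  { Instance  = Network
  ; magnitude = networkMagnitude
  ; Input     = NetworkInput
  ; Output    = DistanceMatrix
  }

record APSPAlgorithm : Set where
  field
    program : Cmd
    time    : ℕ → ℕ → ℕ
    solves  : SolvesIn APSP (λ N t → t ≤ time (Network.n N) (Network.m N)) program
    polynomial-time : ∃ λ p → ∀ n m → time n m ≤ ⟦ p ⟧ (n + m)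

------------------------------------------------------------------------
-- Spanner as an algorithmic problem

bits : ℕ → ℕ
bits k = suc ⌊log₂ k ⌋

module _ (I : SpannerInstance) where
  open SpannerInstance I

  -- Registers: 2 and 3 numerator and denominator of α, 4 W, 5 μ.
  -- Array: 3 weights.
  SpannerInput : State → Set
  SpannerInput s =
      NetworkInput network s
    × reg s 2 ≡ ℤ.∣ ↥ α ∣ × reg s 3 ≡ ↧ₙ α
    × reg s 4 ≡ W × reg s 5 ≡ μ
    × (∀ e → arr s 3 (toℕ e) ≡ w e)

  SpannerAnswer : State → Set
  SpannerAnswer s = (reg s 0 ≡ 1 × Solvable) ⊎ (reg s 0 ≡ 0 × ¬ Solvable)

  spannerMagnitude : ℕ
  spannerMagnitude =
    networkMagnitude network + sum (tabulate w) + ℤ.∣ ↥ α ∣ + ↧ₙ α + W + μ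

  spannerEncodingLength : ℕ
  spannerEncodingLength =
      bits n + bits m + bits ℤ.∣ ↥ α ∣ + bits (↧ₙ α) + bits W + bits μ
    + sum (tabulate λ e → bits (toℕ (src e)) + bits (toℕ (tgt e)) + bits (ℓ e) + bits (w e))

  SpannerParameter : ℕ → ℕ → Set
  SpannerParameter k h = k ≡ μ × LocalNeighborhoodSize h

Spanner : Problem
Spanner = record
  { Instance  = SpannerInstance
  ; magnitude = spannerMagnitude
  ; Input     = SpannerInput
  ; Output    = SpannerAnswer
  }

{-# OPTIONS --safe #-}
module Submission where

-- Trivial edges can be added to every solution, so one searches for the nontrivial ones,
-- starting from H = T.  Let {u,v} be a pair that H does not settle, and let D z be the
-- distance from u to z in H, found by APSP with all edges outside H made very long.  Call
-- xy a candidate if leaving u along a shortest path of H to x and then taking xy, one can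
-- reach v within the length bound while passing every later vertex z before time D z.
-- Following a settling u-v-path of a solution backwards from v up to the first violated
-- deadline, one finds on it a candidate outside H: branching on the candidates is
-- complete.  On the other hand a walk that meets the deadlines avoids the shortest path
-- from u to x, so every candidate lies on a simple settling path.  Hence {u,v} is critical
-- and there are at most h² candidates, and the search tree of depth μ has O(h^(2μ)) nodes.
--
-- All candidates of a node are found by one run of Dijkstra's algorithm from v, for the
-- latest departure times.  Its O(n²) steps are dominated by APSP(n,m), since an APSP
-- program has to write n² distances.  The preprocessing runs Dijkstra's algorithm O(m)
-- times to find the trivial edges and to see whether they form a spanner; in that case
-- the search, for which h may be 0, is not entered.

-- The obstacle is that the union of the settling paths, which `h` measures, is not at hand: that a
-- vertex lies between `u` and `v` on a walk within the length bound does not put it on a simple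
-- settling path, because shortcutting the walk may lose the vertex. The deadlines replace this
-- union by a set of edges that one shortest-path computation finds and whose members all lie on
-- simple settling paths.
--
-- The program never learns `h`. The cost of the search is measured by a potential whose branching
-- degree is left open: degree `m` proves termination, degree `h * h` gives the running time, for
-- every `h` that satisfies the definition. The potential counts pushes as well as nodes, since
-- copying an edge set to the stack takes time linear in `m`.
--
-- Edges outside H are lengthened and not deleted, because an APSP instance has to be connected
-- whereas H may fall apart.
--
-- Whether a vertex is visited by a settling path is never decided. The counting bounds are
-- inequalities of naturals, hence stable under double negation, and may be proved as if it had been
-- decided.

open import Defs
open import Data.Bool using (Bool; true; false; _∨_; if_then_else_; T)
open import Data.Fin as Fin using (Fin; toℕ; fromℕ<; combine)
import Data.Fin.Properties as FinP
open import Data.Fin.Properties using (toℕ-injective; toℕ<n; toℕ-fromℕ<; fromℕ<-toℕ; toℕ-combine; combine-injective)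
open import Data.Fin.Subset as Subset using (Subset; ∣_∣; inside; outside)
import Data.Fin.Subset.Properties as SubsetP
open import Data.Integer as ℤ using (-[1+_]) renaming (+_ to int)
import Data.Integer.Properties as ℤP
open import Data.List as List using (List; []; _∷_; _++_)
open import Data.List.Properties using (length-++; length-map; length-tabulate)
open import Data.List.Membership.Propositional using (_∈_)
open import Data.List.Membership.Propositional.Properties using (∈-∃++; ∈-++⁻; ∈-++⁺ˡ; ∈-++⁺ʳ; ∈-map⁺; ∈-map⁻; ∈-allFin; ∈-tabulate⁻; ∈-cartesianProduct⁺)
import Data.List.Membership.DecPropositional as DecMembership
open import Data.List.Relation.Unary.All as All using (All; []; _∷_)
import Data.List.Relation.Unary.All.Properties as AllP
open import Data.List.Relation.Unary.Any using (here; there)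
open import Data.List.Relation.Unary.AllPairs using ([]; _∷_)
open import Data.List.Relation.Unary.Unique.Propositional using (Unique)
import Data.List.Relation.Unary.Unique.Propositional.Properties as Unique
open import Data.Nat
open import Data.Nat.DivMod using (m/n≤m; m/n*n≤m; /-monoˡ-≤; m*n/n≡m)
open import Data.Nat.Logarithm using (⌈log₂_⌉)
open import Data.Nat.Properties
open import Data.Nat.Solver using (module +-*-Solver)
open import Data.Product using (∃; ∃₂; _×_; _,_; proj₁; proj₂)
open import Data.Rational.Unnormalised as ℚᵘ using (ℚᵘ; mkℚᵘ; 1ℚᵘ; ↥_; ↧ₙ_)
open import Data.Sum as Sum using (_⊎_; inj₁; inj₂; [_,_]′)
open import Data.Unit using (tt) renaming (⊤ to Unit)
open import Data.Vec as Vec using ([]; _∷_; lookup)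
import Data.Vec.Properties as VecP
open import Function using (_∘_; id; Equivalence; mk⇔; _⇔_)
open import Relation.Binary.PropositionalEquality
open import Relation.Nullary
open import Relation.Nullary.Decidable using (_×-dec_; _⊎-dec_; map′; dec-false; decidable-stable)
open +-*-Solver using (solve; _:=_; _:+_; _:*_; _:^_; con)

-- Finite sums and counting

unique-⊆-length : ∀ {A : Set} {xs ys : List A} → Unique xs → (∀ {x} → x ∈ xs → x ∈ ys) →
                  List.length xs ≤ List.length ys
unique-⊆-length {xs = []} _ _ = z≤n
unique-⊆-length {xs = x ∷ xs} (x∉ ∷ u) sub with ∈-∃++ (sub (here refl))
... | as , bs , refl = begin
  suc (List.length xs)                     ≤⟨ s≤s (unique-⊆-length u sub′) ⟩
  suc (List.length (as ++ bs))             ≡⟨ cong suc (length-++ as) ⟩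
  suc (List.length as + List.length bs)    ≡⟨ +-suc (List.length as) _ ⟨
  List.length as + suc (List.length bs)    ≡⟨ length-++ as ⟨
  List.length (as ++ x ∷ bs)               ∎
  where
  open ≤-Reasoning
  sub′ : ∀ {y} → y ∈ xs → y ∈ as ++ bs
  sub′ y∈ with ∈-++⁻ as (sub (there y∈))
  ... | inj₁ p            = ∈-++⁺ˡ p
  ... | inj₂ (here refl)  = contradiction refl (All.lookup x∉ y∈)
  ... | inj₂ (there p)    = ∈-++⁺ʳ as p

elements : ∀ {k} → Subset k → List (Fin k)
elements []            = []
elements (inside  ∷ S) = Fin.zero ∷ List.map Fin.suc (elements S)
elements (outside ∷ S) = List.map Fin.suc (elements S)

length-elements : ∀ {k} (S : Subset k) → List.length (elements S) ≡ ∣ S ∣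
length-elements []            = refl
length-elements (inside  ∷ S) = cong suc (trans (length-map _ (elements S)) (length-elements S))
length-elements (outside ∷ S) = trans (length-map _ (elements S)) (length-elements S)

∈-elements : ∀ {k} (S : Subset k) {x} → x Subset.∈ S → x ∈ elements S
∈-elements (inside  ∷ S) {Fin.zero}  _             = here refl
∈-elements (inside  ∷ S) {Fin.suc x} (Vec.there p) = there (∈-map⁺ Fin.suc (∈-elements S p))
∈-elements (outside ∷ S) {Fin.suc x} (Vec.there p) = ∈-map⁺ Fin.suc (∈-elements S p)

-- Edge sets are arrays of naturals in which any nonzero entry means membership; `ind` normalises an
-- entry to a summand of a count.
ind : ℕ → ℕ
ind zero    = 0
ind (suc _) = 1

ind≤1 : ∀ n → ind n ≤ 1
ind≤1 zero    = z≤n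
ind≤1 (suc _) = ≤-refl

ind-≢0 : ∀ {n} → n ≢ 0 → ind n ≡ 1
ind-≢0 {zero}  n≢0 = contradiction refl n≢0
ind-≢0 {suc _} _   = refl

≤1⇒ind : ∀ {x} → x ≤ 1 → ind x ≡ x
≤1⇒ind z≤n       = refl
≤1⇒ind (s≤s z≤n) = refl

-- Truncated subtraction thus normalises a flag inside a machine expression; `weigh` relies on it.
1∸[1∸n]≡ind : ∀ n → 1 ∸ (1 ∸ n) ≡ ind n
1∸[1∸n]≡ind zero          = refl
1∸[1∸n]≡ind (suc zero)    = refl
1∸[1∸n]≡ind (suc (suc _)) = refl

∑ : ∀ {k} → (Fin k → ℕ) → ℕ
∑ f = List.sum (List.tabulate f)

∑-cong : ∀ {k} {f g : Fin k → ℕ} → (∀ i → f i ≡ g i) → ∑ f ≡ ∑ g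
∑-cong {zero}  h = refl
∑-cong {suc k} h = cong₂ _+_ (h Fin.zero) (∑-cong (h ∘ Fin.suc))

∑-mono : ∀ {k} {f g : Fin k → ℕ} → (∀ i → f i ≤ g i) → ∑ f ≤ ∑ g
∑-mono {zero}  h = z≤n
∑-mono {suc k} h = +-mono-≤ (h Fin.zero) (∑-mono (h ∘ Fin.suc))

∑-const : ∀ {k} c → ∑ {k} (λ _ → c) ≡ k * c
∑-const {zero}  c = refl
∑-const {suc k} c = cong (c +_) (∑-const {k} c)

∑-affine : ∀ {k} c d (f : Fin k → ℕ) → ∑ (λ i → c + f i * d) ≡ k * c + ∑ f * d
∑-affine {zero}  c d f = refl
∑-affine {suc k} c d f = trans (cong (c + f Fin.zero * d +_) (∑-affine c d (f ∘ Fin.suc)))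
  (solve 5 (λ c d x k r → (c :+ x :* d) :+ (k :* c :+ r :* d) := (c :+ k :* c) :+ (x :+ r) :* d)
    refl c d (f Fin.zero) k (∑ (f ∘ Fin.suc)))

∑-≤ : ∀ {k} (f : Fin k → ℕ) i → f i ≤ ∑ f
∑-≤ f Fin.zero    = m≤m+n _ _
∑-≤ f (Fin.suc i) = ≤-trans (∑-≤ (f ∘ Fin.suc) i) (m≤n+m _ _)

∑≡0 : ∀ {k} (f : Fin k → ℕ) → ∑ f ≡ 0 → ∀ i → f i ≡ 0
∑≡0 f eq i = n≤0⇒n≡0 (subst (f i ≤_) eq (∑-≤ f i))

-- The values at `b` are crossed over to avoid subtraction. It is applied whenever a single flag
-- changes: an edge is added, or a vertex is settled.
∑-exchange : ∀ {k} (f g : Fin k → ℕ) b → (∀ i → i ≢ b → f i ≡ g i) → ∑ f + g b ≡ ∑ g + f b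
∑-exchange {suc k} f g Fin.zero h =
  trans (cong (λ r → f Fin.zero + r + g Fin.zero) (∑-cong (λ i → h (Fin.suc i) λ ())))
    (solve 3 (λ a b r → (a :+ r) :+ b := (b :+ r) :+ a) refl (f Fin.zero) (g Fin.zero) (∑ (g ∘ Fin.suc)))
∑-exchange {suc k} f g (Fin.suc b) h =
  trans (cong (λ x → x + ∑ (f ∘ Fin.suc) + g (Fin.suc b)) (h Fin.zero λ ()))
  (trans (+-assoc (g Fin.zero) _ _)
  (trans (cong (g Fin.zero +_) (∑-exchange (f ∘ Fin.suc) (g ∘ Fin.suc) b
            (λ i i≢b → h (Fin.suc i) (λ { refl → i≢b refl }))))
  (sym (+-assoc (g Fin.zero) _ _))))

∑≢0 : ∀ {k} (f : Fin k → ℕ) → ∑ f ≢ 0 → ∃ λ i → f i ≢ 0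
∑≢0 {zero}  f p = contradiction refl p
∑≢0 {suc k} f p with f Fin.zero in eq
... | suc _ = Fin.zero , (λ q → contradiction (trans (sym eq) q) λ ())
... | zero  with ∑≢0 (f ∘ Fin.suc) p
...   | i , q = Fin.suc i , q

-- Partial sums after `j` rounds of a loop. They measure the time spent when rounds differ in cost,
-- and the stack height while candidates are pushed.
prefix : ∀ {k} → (Fin k → ℕ) → ℕ → ℕ
prefix {zero}  f _       = 0
prefix {suc k} f zero    = 0
prefix {suc k} f (suc j) = f Fin.zero + prefix (f ∘ Fin.suc) j

prefix-zero : ∀ {k} (f : Fin k → ℕ) → prefix f 0 ≡ 0
prefix-zero {zero}  f = refl
prefix-zero {suc k} f = refl

prefix-suc : ∀ {k} (f : Fin k → ℕ) j → prefix f (suc (toℕ j)) ≡ prefix f (toℕ j) + f j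
prefix-suc {suc k} f Fin.zero    = trans (cong (f Fin.zero +_) (prefix-zero (f ∘ Fin.suc))) (+-identityʳ _)
prefix-suc {suc k} f (Fin.suc j) = trans (cong (f Fin.zero +_) (prefix-suc (f ∘ Fin.suc) j)) (sym (+-assoc (f Fin.zero) _ _))

prefix-all : ∀ {k} (f : Fin k → ℕ) → prefix f k ≡ ∑ f
prefix-all {zero}  f = refl
prefix-all {suc k} f = cong (f Fin.zero +_) (prefix-all (f ∘ Fin.suc))

prefix≤∑ : ∀ {k} (f : Fin k → ℕ) j → prefix f j ≤ ∑ f
prefix≤∑ {zero}  f j       = z≤n
prefix≤∑ {suc k} f zero    = z≤n
prefix≤∑ {suc k} f (suc j) = +-monoʳ-≤ (f Fin.zero) (prefix≤∑ (f ∘ Fin.suc) j)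

support : ∀ {k} → (Fin k → ℕ) → List (Fin k)
support {zero}  f = []
support {suc k} f with f Fin.zero
... | zero  = List.map Fin.suc (support (f ∘ Fin.suc))
... | suc _ = Fin.zero ∷ List.map Fin.suc (support (f ∘ Fin.suc))

private
  zero∉map-suc : ∀ {k} (xs : List (Fin k)) → All (Fin.zero ≢_) (List.map Fin.suc xs)
  zero∉map-suc []       = []
  zero∉map-suc (x ∷ xs) = (λ ()) ∷ zero∉map-suc xs

  suc-injective-Fin : ∀ {k} {i j : Fin k} → Fin.suc i ≡ Fin.suc j → i ≡ j
  suc-injective-Fin refl = refl

support-unique : ∀ {k} (f : Fin k → ℕ) → Unique (support f)
support-unique {zero}  f = []
support-unique {suc k} f with f Fin.zero
... | zero  = Unique.map⁺ suc-injective-Fin (support-unique (f ∘ Fin.suc))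
... | suc _ = zero∉map-suc (support (f ∘ Fin.suc)) ∷ Unique.map⁺ suc-injective-Fin (support-unique (f ∘ Fin.suc))

length-support : ∀ {k} (f : Fin k → ℕ) → List.length (support f) ≡ ∑ (ind ∘ f)
length-support {zero}  f = refl
length-support {suc k} f with f Fin.zero
... | zero  = trans (length-map Fin.suc (support (f ∘ Fin.suc))) (length-support (f ∘ Fin.suc))
... | suc _ = cong suc (trans (length-map Fin.suc (support (f ∘ Fin.suc))) (length-support (f ∘ Fin.suc)))

∈-support⁻ : ∀ {k} (f : Fin k → ℕ) {i} → i ∈ support f → f i ≢ 0
∈-support⁻ {suc k} f i∈ with f Fin.zero in eq
∈-support⁻ {suc k} f i∈ | zero with ∈-map⁻ Fin.suc i∈
... | j , j∈ , refl = ∈-support⁻ (f ∘ Fin.suc) j∈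
∈-support⁻ {suc k} f (here refl) | suc _ = λ p → contradiction (trans (sym eq) p) λ ()
∈-support⁻ {suc k} f (there i∈)  | suc _ with ∈-map⁻ Fin.suc i∈
... | j , j∈ , refl = ∈-support⁻ (f ∘ Fin.suc) j∈

cell : ∀ {n} → Fin n → Fin n → ℕ
cell {n} u v = toℕ u * n + toℕ v

private
  cell≡combine : ∀ {n} (u v : Fin n) → cell u v ≡ toℕ (combine u v)
  cell≡combine {n} u v = trans (cong (_+ toℕ v) (*-comm (toℕ u) n)) (sym (toℕ-combine u v))

cell-injective : ∀ {n} (u v u′ v′ : Fin n) → cell u v ≡ cell u′ v′ → u ≡ u′ × v ≡ v′
cell-injective u v u′ v′ eq = combine-injective u v u′ v′
  (toℕ-injective (trans (sym (cell≡combine u v)) (trans eq (cell≡combine u′ v′))))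

cell<n*n : ∀ {n} (u v : Fin n) → cell u v < n * n
cell<n*n {n} u v = subst (_< n * n) (sym (cell≡combine u v)) (toℕ<n (combine u v))

-- Runs of programs

update-elim : ∀ {A : Set} (P : A → Set) (f : ℕ → A) i a j →
              (i ≡ j → P a) → (i ≢ j → P (f j)) → P ((f [ i ↦ a ]) j)
update-elim P f i a j hit miss with i ≡ᵇ j | ≡ᵇ⇒≡ i j | ≡⇒≡ᵇ i j
... | true  | eq | _  = hit (eq tt)
... | false | _  | ne = miss ne

update-hit : ∀ {A : Set} (f : ℕ → A) i a → (f [ i ↦ a ]) i ≡ a
update-hit f i a = update-elim (_≡ a) f i a i (λ _ → refl) (λ i≢i → contradiction refl i≢i)

update-miss : ∀ {A : Set} (f : ℕ → A) {i j} a → i ≢ j → (f [ i ↦ a ]) j ≡ f j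
update-miss f {i} {j} a i≢j = update-elim (_≡ f j) f i a j (λ i≡j → contradiction i≡j i≢j) (λ _ → refl)

update-miss-does : ∀ {A : Set} (f : ℕ → A) i j a → does (i ≟ j) ≡ false → (f [ i ↦ a ]) j ≡ f j
update-miss-does f i j a eq = cong (if_then a else f j) eq

update-ext : ∀ {A : Set} {f : ℕ → A} k {h : ℕ → A} i {a b} → (∀ x → f (k + x) ≡ h x) → a ≡ b →
             ∀ x → (f [ k + i ↦ a ]) (k + x) ≡ (h [ i ↦ b ]) x
update-ext {f = f} k {h} i {a} eq refl x = update-elim (_ ≡_) h i a x
  (λ { refl → update-hit f (k + i) _ })
  (λ i≢x → trans (update-miss f _ (i≢x ∘ +-cancelˡ-≡ k i x)) (eq x))

fits-eval : ∀ {B} e {s} → Fits B e s → eval e s ≤ B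
fits-eval (lit _)     p           = p
fits-eval (var _)     p           = p
fits-eval (get _ _)   (_ , p)     = p
fits-eval (bin _ _ _) (_ , _ , p) = p

private
  update-≤ : ∀ {B f i a} → (∀ x → f x ≤ B) → a ≤ B → ∀ x → (f [ i ↦ a ]) x ≤ B
  update-≤ {B} {f} {i} {a} b a≤ x = update-elim (_≤ B) f i a x (λ _ → a≤) (λ _ → b x)

  update₂-≤ : ∀ {B} {f : ℕ → ℕ → ℕ} {a i v} → (∀ x j → f x j ≤ B) → v ≤ B →
              ∀ x j → (f [ a ↦ f a [ i ↦ v ] ]) x j ≤ B
  update₂-≤ {B} {f} {a} {i} b v≤ x j = update-elim (λ g → g j ≤ B) f a _ x
    (λ { refl → update-≤ {i = i} (b a) v≤ j }) (λ _ → b x j)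

run-bounded : ∀ {B c s t s′} → B ⊢ c , s ⇓[ t ] s′ → Bounded B s → Bounded B s′
run-bounded skip b = b
run-bounded (assign {x = x} {e} f) (br , ba) = update-≤ {i = x} br (fits-eval e f) , ba
run-bounded {s = s} (put {a} {i} {e} _ f) (br , ba) = br , update₂-≤ {f = arr s} {a} {eval i s} ba (fits-eval e f)
run-bounded (seq p q) b = run-bounded q (run-bounded p b)
run-bounded (then′ _ _ p) b = run-bounded p b
run-bounded (else′ _ _ p) b = run-bounded p b
run-bounded (loop _ _ p q) b = run-bounded q (run-bounded p b)
run-bounded (done _ _) b = b

-- A syntactic frame analysis. Being Boolean, it evaluates on concrete programs, so that later frame
-- conditions are proved by `refl`.
writesReg : Cmd → ℕ → Bool
writesReg skip         x = false
writesReg (y ≔ _)      x = does (y ≟ x)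
writesReg (put _ _ _)  x = false
writesReg (c ⨾ d)      x = writesReg c x ∨ writesReg d x
writesReg (cond _ c d) x = writesReg c x ∨ writesReg d x
writesReg (while _ c)  x = writesReg c x

writesArr : Cmd → ℕ → Bool
writesArr skip         x = false
writesArr (y ≔ _)      x = false
writesArr (put a _ _)  x = does (a ≟ x)
writesArr (c ⨾ d)      x = writesArr c x ∨ writesArr d x
writesArr (cond _ c d) x = writesArr c x ∨ writesArr d x
writesArr (while _ c)  x = writesArr c x

record Agree (c : Cmd) (s s′ : State) : Set where
  constructor agree
  field
    onReg : ∀ x → writesReg c x ≡ false → reg s′ x ≡ reg s x
    onArr : ∀ a → writesArr c a ≡ false → arr s′ a ≡ arr s a
open Agree public

∨-falseˡ : ∀ {a b} → a ∨ b ≡ false → a ≡ false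
∨-falseˡ {false} _ = refl

∨-falseʳ : ∀ {a b} → a ∨ b ≡ false → b ≡ false
∨-falseʳ {false} p = p

run-agree : ∀ {B c s t s′} → B ⊢ c , s ⇓[ t ] s′ → Agree c s s′
run-agree skip = agree (λ _ _ → refl) (λ _ _ → refl)
run-agree {s = s} (assign {x = y} _) = agree (λ x p → update-miss-does (reg s) y x _ p) (λ _ _ → refl)
run-agree {s = s} (put {a} _ _) = agree (λ _ _ → refl) (λ x p → update-miss-does (arr s) a x _ p)
run-agree (seq {c} {d} p q) with run-agree p | run-agree q
... | agree r a | agree r′ a′ = agree
  (λ x w → trans (r′ x (∨-falseʳ {writesReg c x} w)) (r x (∨-falseˡ w)))
  (λ x w → trans (a′ x (∨-falseʳ {writesArr c x} w)) (a x (∨-falseˡ w)))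
run-agree (then′ _ _ p) with run-agree p
... | agree r a = agree (λ x w → r x (∨-falseˡ w)) (λ x w → a x (∨-falseˡ w))
run-agree (else′ {c = c} _ _ p) with run-agree p
... | agree r a = agree (λ x w → r x (∨-falseʳ {writesReg c x} w)) (λ x w → a x (∨-falseʳ {writesArr c x} w))
run-agree (loop _ _ p q) with run-agree p | run-agree q
... | agree r a | agree r′ a′ = agree (λ x w → trans (r′ x w) (r x w)) (λ x w → trans (a′ x w) (a x w))
run-agree (done _ _) = agree (λ _ _ → refl) (λ _ _ → refl)

cong-at : ∀ {f g : ℕ → ℕ} {i j} → f ≡ g → i ≡ j → f i ≡ g j
cong-at refl refl = refl

keptAt : ∀ {c s s′} → Agree c s s′ → ∀ a → writesArr c a ≡ false → ∀ i → arr s′ a i ≡ arr s a i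
keptAt ag a p i = cong (λ f → f i) (onArr ag a p)

agree-refl : ∀ {c s} → Agree c s s
agree-refl = agree (λ _ _ → refl) (λ _ _ → refl)

agree-trans : ∀ {c s s′ s″} → Agree c s s′ → Agree c s′ s″ → Agree c s s″
agree-trans (agree r a) (agree r′ a′) = agree (λ x w → trans (r′ x w) (r x w)) (λ x w → trans (a′ x w) (a x w))

-- The APSP program is relocated, so as not to interfere with the memory of the solver.

shiftExp : ℕ → Exp → Exp
shiftExp k (lit x)     = lit x
shiftExp k (var x)     = var (k + x)
shiftExp k (get a e)   = get (k + a) (shiftExp k e)
shiftExp k (bin o e f) = bin o (shiftExp k e) (shiftExp k f)

shift : ℕ → Cmd → Cmd
shift k skip         = skip
shift k (x ≔ e)      = (k + x) ≔ shiftExp k e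
shift k (put a i e)  = put (k + a) (shiftExp k i) (shiftExp k e)
shift k (c ⨾ d)      = shift k c ⨾ shift k d
shift k (cond b c d) = cond (shiftExp k b) (shift k c) (shift k d)
shift k (while b c)  = while (shiftExp k b) (shift k c)

Shifted : ℕ → State → State → Set
Shifted k σ s = (∀ x → reg s (k + x) ≡ reg σ x) × (∀ a i → arr s (k + a) i ≡ arr σ a i)

module _ (k : ℕ) where
  size-shift : ∀ e → size (shiftExp k e) ≡ size e
  size-shift (lit _)     = refl
  size-shift (var _)     = refl
  size-shift (get _ e)   = cong suc (size-shift e)
  size-shift (bin _ e f) = cong suc (cong₂ _+_ (size-shift e) (size-shift f))

  eval-shift : ∀ e {σ s} → Shifted k σ s → eval (shiftExp k e) s ≡ eval e σ
  eval-shift (lit _)   R = refl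
  eval-shift (var x)   R = proj₁ R x
  eval-shift (get a e) {σ} {s} R = trans (proj₂ R a _) (cong (arr σ a) (eval-shift e R))
  eval-shift (bin o e f) R = cong₂ (applyOp o) (eval-shift e R) (eval-shift f R)

  private
    moved : ∀ e {B σ s} → Shifted k σ s → eval e σ ≤ B → eval (shiftExp k e) s ≤ B
    moved e {B} {σ} {s} R = subst (_≤ _) (sym (eval-shift e {σ} {s} R))

  fits-shift : ∀ e {B σ s} → Shifted k σ s → Fits B e σ → Fits B (shiftExp k e) s
  fits-shift (lit x) R p = p
  fits-shift (var x) {B} {σ} {s} R p = moved (var x) {B} {σ} {s} R p
  fits-shift (get a e) {B} {σ} {s} R (p , q) = fits-shift e R p , moved (get a e) {B} {σ} {s} R q
  fits-shift (bin o e f) {B} {σ} {s} R (p , q , r) = fits-shift e R p , fits-shift f R q , moved (bin o e f) {B} {σ} {s} R r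

  private
    retime : ∀ {B c s s′ t u} → t ≡ u → B ⊢ c , s ⇓[ t ] s′ → B ⊢ c , s ⇓[ u ] s′
    retime refl p = p

  run-shift : ∀ {B c σ t σ′} → B ⊢ c , σ ⇓[ t ] σ′ → ∀ {s} → Shifted k σ s →
              ∃ λ s′ → B ⊢ shift k c , s ⇓[ t ] s′ × Shifted k σ′ s′
  run-shift skip R = _ , skip , R
  run-shift {σ = σ} (assign {x} {e} f) {s} R =
    _ , retime (cong suc (size-shift e)) (assign (fits-shift e R f)) ,
    update-ext {f = reg s} k x (proj₁ R) (eval-shift e R) , proj₂ R
  run-shift {σ = σ} (put {a} {i} {e} f g) {s} R =
    _ , retime (cong suc (cong₂ _+_ (size-shift i) (size-shift e))) (put (fits-shift i R f) (fits-shift e R g)) ,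
    proj₁ R , written
    where
    written : ∀ x j → (arr s [ k + a ↦ arr s (k + a) [ eval (shiftExp k i) s ↦ eval (shiftExp k e) s ] ]) (k + x) j
                      ≡ (arr σ [ a ↦ arr σ a [ eval i σ ↦ eval e σ ] ]) x j
    written x j = update-elim (λ f → _ ≡ f j) (arr σ) a _ x
      (λ { refl → trans (cong (λ f → f j) (update-hit (arr s) (k + a) _))
             (trans (cong (λ u → (arr s (k + a) [ u ↦ eval (shiftExp k e) s ]) j) (eval-shift i R))
                    (update-ext {f = arr s (k + a)} 0 (eval i σ) (proj₂ R a) (eval-shift e R) j)) })
      (λ a≢x → trans (cong (λ f → f j) (update-miss (arr s) _ (a≢x ∘ +-cancelˡ-≡ k a x))) (proj₂ R x j))
  run-shift (seq p q) R with run-shift p R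
  ... | _ , p′ , R′ with run-shift q R′
  ...   | _ , q′ , R″ = _ , seq p′ q′ , R″
  run-shift (then′ {b} f b≢0 p) R with run-shift p R
  ... | _ , p′ , R′ = _ , retime (cong (λ z → suc (z + _)) (size-shift b))
        (then′ (fits-shift b R f) (λ eq → b≢0 (trans (sym (eval-shift b R)) eq)) p′) , R′
  run-shift (else′ {b} f b≡0 p) R with run-shift p R
  ... | _ , p′ , R′ = _ , retime (cong (λ z → suc (z + _)) (size-shift b))
        (else′ (fits-shift b R f) (trans (eval-shift b R) b≡0) p′) , R′
  run-shift (loop {b} f b≢0 p q) R with run-shift p R
  ... | _ , p′ , R′ with run-shift q R′
  ...   | _ , q′ , R″ = _ , retime (cong (λ z → suc (z + _)) (size-shift b))
        (loop (fits-shift b R f) (λ eq → b≢0 (trans (sym (eval-shift b R)) eq)) p′ q′) , R″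
  run-shift (done {b} f b≡0) R = _ , retime (cong suc (size-shift b))
        (done (fits-shift b R f) (trans (eval-shift b R) b≡0)) , R

  private
    above : ∀ {x} y → x < k → does (k + y ≟ x) ≡ false
    above {x} y x<k = dec-false (k + y ≟ x) (λ { refl → n≮n k (≤-trans (s≤s (m≤m+n k y)) x<k) })

  shift-writesReg : ∀ c {x} → x < k → writesReg (shift k c) x ≡ false
  shift-writesReg skip l = refl
  shift-writesReg (y ≔ _) l = above y l
  shift-writesReg (put _ _ _) l = refl
  shift-writesReg (c ⨾ d) l rewrite shift-writesReg c l = shift-writesReg d l
  shift-writesReg (cond _ c d) l rewrite shift-writesReg c l = shift-writesReg d l
  shift-writesReg (while _ c) l = shift-writesReg c l

  shift-writesArr : ∀ c {x} → x < k → writesArr (shift k c) x ≡ false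
  shift-writesArr skip l = refl
  shift-writesArr (y ≔ _) l = refl
  shift-writesArr (put a _ _) l = above a l
  shift-writesArr (c ⨾ d) l rewrite shift-writesArr c l = shift-writesArr d l
  shift-writesArr (cond _ c d) l rewrite shift-writesArr c l = shift-writesArr d l
  shift-writesArr (while _ c) l = shift-writesArr c l

-- Every write costs at least one time unit, so the list of written positions is no longer than the
-- run. The lower bound for APSP rests on this.
run-changes : ∀ {B c s t s′} → B ⊢ c , s ⇓[ t ] s′ → ∀ a →
  ∃ λ (L : List ℕ) → List.length L ≤ t × (∀ i → i ∈ L ⊎ arr s′ a i ≡ arr s a i)
run-changes skip a = [] , z≤n , λ _ → inj₂ refl
run-changes (assign _) a = [] , z≤n , λ _ → inj₂ refl
run-changes {s = s} (put {b} {j} {e} _ _) a = eval j s ∷ [] , s≤s z≤n , changed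
  where
  changed : ∀ i → i ∈ (eval j s ∷ []) ⊎ (arr s [ b ↦ arr s b [ eval j s ↦ eval e s ] ]) a i ≡ arr s a i
  changed i = update-elim (λ f → i ∈ (eval j s ∷ []) ⊎ f i ≡ arr s a i) (arr s) b _ a
    (λ { refl → update-elim (λ v → i ∈ (eval j s ∷ []) ⊎ v ≡ arr s b i) (arr s b) (eval j s) (eval e s) i
                  (λ { refl → inj₁ (here refl) }) (λ _ → inj₂ refl) })
    (λ _ → inj₂ refl)
run-changes (seq p q) a with run-changes p a | run-changes q a
... | L , l , h | L′ , l′ , h′ = L ++ L′ , ≤-trans (≤-reflexive (length-++ L)) (+-mono-≤ l l′) , both
  where
  both : ∀ i → i ∈ (L ++ L′) ⊎ _
  both i with h i | h′ i
  ... | inj₁ x | _      = inj₁ (∈-++⁺ˡ x)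
  ... | inj₂ _ | inj₁ y = inj₁ (∈-++⁺ʳ L y)
  ... | inj₂ x | inj₂ y = inj₂ (trans y x)
run-changes (then′ {b} _ _ p) a with run-changes p a
... | L , l , h = L , ≤-trans l (≤-trans (m≤n+m _ (size b)) (n≤1+n _)) , h
run-changes (else′ {b} _ _ p) a with run-changes p a
... | L , l , h = L , ≤-trans l (≤-trans (m≤n+m _ (size b)) (n≤1+n _)) , h
run-changes (loop {b} _ _ p q) a with run-changes (seq p q) a
... | L , l , h = L , ≤-trans l (≤-trans (m≤n+m _ (size b)) (n≤1+n _)) , h
run-changes (done _ _) a = [] , z≤n , λ _ → inj₂ refl

-- Timed Hoare triples

setReg : State → ℕ → ℕ → State
setReg s x v = state (reg s [ x ↦ v ]) (arr s)

setArr : State → ℕ → ℕ → ℕ → State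
setArr s a i v = state (reg s) (arr s [ a ↦ arr s a [ i ↦ v ] ])

record Runs (B : ℕ) (c : Cmd) (s : State) (T : ℕ) (Q : State → Set) : Set where
  constructor runs
  field
    {time}  : ℕ
    {final} : State
    run     : B ⊢ c , s ⇓[ time ] final
    within  : time ≤ T
    post    : Q final

infixr 4 _⟫_

-- Besides the postcondition, the continuation receives the frame and the word bound of the first
-- command, so that specifications need only mention what changes.
_⟫_ : ∀ {B c d s T₁ T₂ P Q} → Runs B c s T₁ P →
      (∀ {s′} → Bounded B s → Agree c s s′ → P s′ → Bounded B s′ → Runs B d s′ T₂ Q) →
      Bounded B s → Runs B (c ⨾ d) s (T₁ + T₂) Q
(runs p l x ⟫ k) b with k b (run-agree p) x (run-bounded p b)
... | runs q l′ y = runs (seq p q) (+-mono-≤ l l′) y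

runs-mono : ∀ {B c s T T′ P Q} → T ≤ T′ → (∀ {s′} → P s′ → Q s′) → Runs B c s T P → Runs B c s T′ Q
runs-mono l f (runs p l′ x) = runs p (≤-trans l′ l) (f x)

with-agree : ∀ {B c s T P Q} → (∀ {s′} → Agree c s s′ → P s′ → Q s′) → Runs B c s T P → Runs B c s T Q
with-agree f (runs p l x) = runs p l (f (run-agree p) x)

runs-exact : ∀ {B c s s′ t} {Q : State → Set} → B ⊢ c , s ⇓[ t ] s′ → Q s′ → Runs B c s t Q
runs-exact p q = runs p ≤-refl q

assign-run : ∀ {B x e s} → Fits B e s → Runs B (x ≔ e) s (suc (size e)) (λ s′ → s′ ≡ setReg s x (eval e s))
assign-run f = runs-exact (assign f) refl

put-run : ∀ {B a i e s} → Fits B i s → Fits B e s →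
          Runs B (put a i e) s (suc (size i + size e)) (λ s′ → s′ ≡ setArr s a (eval i s) (eval e s))
put-run f g = runs-exact (put f g) refl

-- Adding the bounds of the two branches instead of taking their maximum loses only a constant
-- factor.
runs-cond : ∀ {B b c d s T₁ T₂ Q} → Fits B b s →
            (eval b s ≢ 0 → Runs B c s T₁ Q) → (eval b s ≡ 0 → Runs B d s T₂ Q) →
            Runs B (cond b c d) s (suc (size b + (T₁ + T₂))) Q
runs-cond {b = b} {s = s} {T₁ = T₁} {T₂} f x y with eval b s ≟ 0
... | no b≢0 with x b≢0
...   | runs p l q = runs (then′ f b≢0 p) (s≤s (+-monoʳ-≤ (size b) (≤-trans l (m≤m+n T₁ T₂)))) q
runs-cond {b = b} {T₁ = T₁} {T₂} f x y | yes b≡0 with y b≡0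
...   | runs p l q = runs (else′ f b≡0 p) (s≤s (+-monoʳ-≤ (size b) (≤-trans l (m≤n+m T₂ T₁)))) q

-- With all of memory bounded, only literals and growing operations need a bound.
Small : ℕ → Exp → State → Set
Small B (lit k)         s = k ≤ B
Small B (var _)         s = Unit
Small B (get _ e)       s = Small B e s
Small B (bin plus e f)  s = Small B e s × Small B f s × eval e s + eval f s ≤ B
Small B (bin times e f) s = Small B e s × Small B f s × eval e s * eval f s ≤ B
Small B (bin monus e f) s = Small B e s × Small B f s
Small B (bin div e f)   s = Small B e s × Small B f s

private
  div-≤ : ∀ x y → applyOp div x y ≤ x
  div-≤ x zero    = z≤n
  div-≤ x (suc y) = m/n≤m x (suc y)

small-fits : ∀ {B} e {s} → Bounded B s → Small B e s → Fits B e s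
small-fits (lit _) b p = p
small-fits (var x) b p = proj₁ b x
small-fits (get a e) b p = small-fits e b p , proj₂ b a _
small-fits (bin plus e f) b (p , q , r) = small-fits e b p , small-fits f b q , r
small-fits (bin times e f) b (p , q , r) = small-fits e b p , small-fits f b q , r
small-fits (bin monus e f) {s} b (p , q) = small-fits e b p , small-fits f b q ,
  ≤-trans (m∸n≤m (eval e s) (eval f s)) (fits-eval e (small-fits e b p))
small-fits (bin div e f) {s} b (p , q) = small-fits e b p , small-fits f b q ,
  ≤-trans (div-≤ (eval e s) (eval f s)) (fits-eval e (small-fits e b p))

-- Counting loops and their cost

for : ℕ → ℕ → Cmd → Cmd
for i N c = i ≔ lit 0 ⨾ while (bin monus (var N) (var i)) (c ⨾ i ≔ bin plus (var i) (lit 1))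

module _ {B i N : ℕ} {c : Cmd} {K : ℕ} (Inv : ℕ → State → Set) (τ : Fin K → ℕ)
         (ci : writesReg c i ≡ false) (cN : writesReg c N ≡ false) (i≢N : does (i ≟ N) ≡ false)
         (1≤B : 1 ≤ B)
  where
  private
    body = c ⨾ i ≔ bin plus (var i) (lit 1)

    -- Each round may assume that memory not written by the loop is still as in `s₀`, so invariants
    -- speak of the changing part only. The invariant is re-established for the state in which the
    -- counter has already advanced.
    Body : State → Set
    Body s₀ = ∀ (k : Fin K) {s} → Bounded B s → Agree body s₀ s → reg s i ≡ toℕ k → Inv (toℕ k) s →
              Runs B c s (τ k) (λ s′ → Inv (suc (toℕ k)) (setReg s′ i (suc (toℕ k))))

    -- The time still to come plus the time already allotted stays below the total, which states the
    -- bound without subtraction.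
    iterate : ∀ {s₀} → Body s₀ → ∀ r k {s} → k + r ≡ K → Bounded B s → Agree body s₀ s →
              reg s i ≡ k → reg s N ≡ K → Inv k s →
              ∃₂ λ t s′ → B ⊢ while (bin monus (var N) (var i)) body , s ⇓[ t ] s′ ×
                t + (8 * k + prefix τ k) ≤ 4 + (8 * K + prefix τ K) × Inv K s′ × reg s′ i ≡ K
    iterate bd zero k {s} k+r b ag ri rN inv = _ , s ,
      done (proj₁ b N , proj₁ b i , ≤-trans (m∸n≤m (reg s N) (reg s i)) (proj₁ b N))
        (trans (cong₂ _∸_ rN ri) (trans (cong (K ∸_) k≡K) (n∸n≡0 K))) ,
      ≤-reflexive (cong (λ z → 4 + (8 * z + prefix τ z)) k≡K) , subst (λ z → Inv z s) k≡K inv , trans ri k≡K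
      where k≡K = trans (sym (+-identityʳ k)) k+r
    iterate {s₀} bd (suc r) k {s} k+r b ag ri rN inv
      with fromℕ< {k} {K} k<K | toℕ-fromℕ< {k} {K} k<K
      where k<K = subst (k <_) k+r (m<m+n k (s≤s z≤n))
    ... | j | refl with bd j b ag ri inv
    ... | runs {t₁} {s₁} p l inv₁ = step′
      where
      b₁  = run-bounded p b
      ag₁ = run-agree p
      s₂  = setReg s₁ i (reg s₁ i + 1)
      v≡  : reg s₁ i + 1 ≡ suc (toℕ j)
      v≡  = trans (cong (_+ 1) (trans (onReg ag₁ i ci) ri)) (+-comm (toℕ j) 1)
      rN₁ = trans (onReg ag₁ N cN) rN
      sj≤B : suc (toℕ j) ≤ B
      sj≤B = ≤-trans (toℕ<n j) (subst (_≤ B) rN₁ (proj₁ b₁ N))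
      q   : B ⊢ i ≔ bin plus (var i) (lit 1) , s₁ ⇓[ 4 ] s₂
      q   = assign (proj₁ b₁ i , 1≤B , subst (_≤ B) (sym v≡) sj≤B)
      pq  = seq p q
      step′ : ∃₂ λ t s′ → B ⊢ while (bin monus (var N) (var i)) body , s ⇓[ t ] s′ ×
                t + (8 * toℕ j + prefix τ (toℕ j)) ≤ 4 + (8 * K + prefix τ K) × Inv K s′ × reg s′ i ≡ K
      step′ with iterate bd r (suc (toℕ j)) (trans (sym (+-suc (toℕ j) r)) k+r) (run-bounded pq b)
               (agree-trans ag (run-agree pq))
               (trans (update-hit (reg s₁) i _) v≡)
               (trans (update-miss-does (reg s₁) i N _ i≢N) rN₁)
               (subst (λ v → Inv (suc (toℕ j)) (setReg s₁ i v)) (sym v≡) inv₁)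
      ... | t₂ , s′ , w , l₂ , done′ = _ , s′ ,
        loop (proj₁ b N , proj₁ b i , ≤-trans (m∸n≤m (reg s N) (reg s i)) (proj₁ b N))
          (subst (_≢ 0) (sym (cong₂ _∸_ rN ri)) (m>n⇒m∸n≢0 (toℕ<n j))) pq w ,
        ≤-trans (≤-reflexive (solve 4 (λ t₁ t₂ k p → (con 4 :+ (t₁ :+ con 4 :+ t₂)) :+ (con 8 :* k :+ p)
                                := (t₂ :+ (con 8 :* (con 1 :+ k) :+ (p :+ t₁)))) refl t₁ t₂ (toℕ j) (prefix τ (toℕ j))))
          (≤-trans (+-monoʳ-≤ t₂ (+-monoʳ-≤ (8 * suc (toℕ j))
                      (≤-trans (+-monoʳ-≤ (prefix τ (toℕ j)) l) (≤-reflexive (sym (prefix-suc τ j))))))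
            l₂) , done′

  -- The overhead is 4 for the guard and 4 for the increment in each round, 2 for the initialisation
  -- and 4 for the final guard.
  for-rule : ∀ {s} → Bounded B s → reg s N ≡ K → Inv 0 (setReg s i 0) → Body (setReg s i 0) →
             Runs B (for i N c) s (6 + (8 * K + ∑ τ)) (λ s′ → Inv K s′ × reg s′ i ≡ K)
  for-rule {s} b rN inv bd with iterate bd K 0 refl
    (run-bounded (assign {x = i} {lit 0} {s} z≤n) b) agree-refl (update-hit (reg s) i 0)
    (trans (update-miss-does (reg s) i N _ i≢N) rN) inv
  ... | t , s′ , w , l , inv′ = runs (seq (assign z≤n) w)
    (s≤s (s≤s (≤-trans (≤-trans (m≤m+n t _) l) (≤-reflexive (cong (λ z → 4 + (8 * K + z)) (prefix-all τ)))))) inv′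

for-uniform : ∀ {B i N c K} (Inv : ℕ → State → Set) T →
  writesReg c i ≡ false → writesReg c N ≡ false → does (i ≟ N) ≡ false → 1 ≤ B →
  ∀ {s} → Bounded B s → reg s N ≡ K → Inv 0 (setReg s i 0) →
  (∀ (k : Fin K) {s′} → Bounded B s′ → Agree (c ⨾ i ≔ bin plus (var i) (lit 1)) (setReg s i 0) s′ →
     reg s′ i ≡ toℕ k → Inv (toℕ k) s′ → Runs B c s′ T (λ s″ → Inv (suc (toℕ k)) (setReg s″ i (suc (toℕ k))))) →
  Runs B (for i N c) s (6 + (8 * K + K * T)) (λ s′ → Inv K s′)
for-uniform {K = K} Inv T ci cN i≢N 1≤B b rN inv body =
  runs-mono (≤-reflexive (cong (λ z → 6 + (8 * K + z)) (∑-const {K} T))) proj₁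
    (for-rule Inv (λ _ → T) ci cN i≢N 1≤B b rN inv body)

-- A record, so that c and X can be inferred.
record _≲_·_ (x c X : ℕ) : Set where
  constructor bounded-by
  field bound : x ≤ c * X
open _≲_·_ public

-- The 14 absorbs the loop overhead `6 + 8 * K`. Nested loops are handled by measuring the body
-- against a smaller `Y` with `K * Y ≤ X`.
loop-≲ : ∀ {K X Y T c} → 1 ≤ X → K ≤ X → K * Y ≤ X → T ≲ c · Y → (6 + (8 * K + K * T)) ≲ 14 + c · X
loop-≲ {K} {X} {Y} {T} {c} 1≤X K≤X KY≤X (bounded-by T≤) = bounded-by (begin
  6 + (8 * K + K * T)       ≤⟨ +-mono-≤ (*-monoʳ-≤ 6 1≤X) (+-mono-≤ (*-monoʳ-≤ 8 K≤X) (*-monoʳ-≤ K T≤)) ⟩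
  6 * X + (8 * X + K * (c * Y)) ≡⟨ cong (λ z → 6 * X + (8 * X + z)) (solve 3 (λ K c Y → K :* (c :* Y) := c :* (K :* Y)) refl K c Y) ⟩
  6 * X + (8 * X + c * (K * Y)) ≤⟨ +-monoʳ-≤ (6 * X) (+-monoʳ-≤ (8 * X) (*-monoʳ-≤ c KY≤X)) ⟩
  6 * X + (8 * X + c * X)   ≡⟨ solve 2 (λ X c → con 6 :* X :+ (con 8 :* X :+ c :* X) := (con 14 :+ c) :* X) refl X c ⟩
  (14 + c) * X              ∎)
  where
  open ≤-Reasoning

const-≲ : ∀ {c X} → 1 ≤ X → c ≲ c · X
const-≲ {c} 1≤X = bounded-by (≤-trans (≤-reflexive (sym (*-identityʳ c))) (*-monoʳ-≤ c 1≤X))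

flat-loop-≲ : ∀ {K X c} → 1 ≤ X → K ≤ X → (6 + (8 * K + K * c)) ≲ 14 + c · X
flat-loop-≲ {K} 1≤X K≤X = loop-≲ {Y = 1} 1≤X K≤X (≤-trans (≤-reflexive (*-identityʳ K)) K≤X) (const-≲ ≤-refl)

infixr 5 _⊞_

_⊞_ : ∀ {x y c d X} → x ≲ c · X → y ≲ d · X → (x + y) ≲ c + d · X
_⊞_ {c = c} {d} {X} (bounded-by p) (bounded-by q) = bounded-by (≤-trans (+-mono-≤ p q) (≤-reflexive (sym (*-distribʳ-+ X c d))))

≲-mono : ∀ {x c d X} → c ≤ d → x ≲ c · X → x ≲ d · X
≲-mono {X = X} l (bounded-by p) = bounded-by (≤-trans p (*-monoˡ-≤ X l))

≲-scale : ∀ {x c X Y} → X ≤ Y → x ≲ c · X → x ≲ c · Y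
≲-scale {c = c} l (bounded-by p) = bounded-by (≤-trans p (*-monoʳ-≤ c l))

fill : ℕ → ℕ → ℕ → Exp → Exp → Cmd
fill a i N ix e = for i N (put a ix e)

fillTime : Exp → Exp → ℕ → ℕ
fillTime ix e K = 6 + (8 * K + K * suc (size ix + size e))

-- The expression may read the very cell that it overwrites, as the relaxation step does; hence the
-- assumption about the old content. That cells below `base` survive protects the lower rows of the
-- stack.
fill-rule : ∀ {B a i N ix e K s} base (g : Fin K → ℕ) → does (i ≟ N) ≡ false → 1 ≤ B →
  Bounded B s → reg s N ≡ K →
  (∀ k {s′} → Bounded B s′ → Agree (put a ix e ⨾ i ≔ bin plus (var i) (lit 1)) (setReg s i 0) s′ →
     reg s′ i ≡ toℕ k → arr s′ a (base + toℕ k) ≡ arr s a (base + toℕ k) →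
     Fits B ix s′ × Fits B e s′ × eval ix s′ ≡ base + toℕ k × eval e s′ ≡ g k) →
  Runs B (fill a i N ix e) s (fillTime ix e K)
    (λ s′ → (∀ k → arr s′ a (base + toℕ k) ≡ g k) × (∀ x → x < base → arr s′ a x ≡ arr s a x))
fill-rule {B} {a} {i} {N} {ix} {e} {K} {s} base g i≢N 1≤B b rN h =
  runs-mono (≤-reflexive (cong (λ z → 6 + (8 * K + z)) (∑-const {K} _)))
    (λ { ((p , _ , r) , _) → (λ k → p k (toℕ<n k)) , r })
    (for-rule Inv (λ _ → suc (size ix + size e)) refl refl i≢N 1≤B b rN
      ((λ _ ()) , (λ _ _ → refl) , (λ _ _ → refl)) body)
  where
  Inv : ℕ → State → Set
  Inv k s′ = (∀ (j : Fin K) → toℕ j < k → arr s′ a (base + toℕ j) ≡ g j)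
           × (∀ (j : Fin K) → k ≤ toℕ j → arr s′ a (base + toℕ j) ≡ arr s a (base + toℕ j))
           × (∀ x → x < base → arr s′ a x ≡ arr s a x)
  body : ∀ (k : Fin K) {s′} → _ → _ → _ → Inv (toℕ k) s′ → Runs B (put a ix e) s′ _ _
  body k {s′} b′ ag ri (p , q , r) with h k b′ ag ri (q k ≤-refl)
  ... | f₁ , f₂ , e₁ , e₂ = runs (put f₁ f₂) ≤-refl (p′ , q′ , r′)
    where
    new : ∀ x → (arr s′ [ a ↦ arr s′ a [ eval ix s′ ↦ eval e s′ ] ]) a x ≡ (arr s′ a [ base + toℕ k ↦ g k ]) x
    new x = trans (cong (λ f → f x) (update-hit (arr s′) a _)) (cong₂ (λ u v → (arr s′ a [ u ↦ v ]) x) e₁ e₂)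
    miss : ∀ {x} → base + toℕ k ≢ x → (arr s′ [ a ↦ arr s′ a [ eval ix s′ ↦ eval e s′ ] ]) a x ≡ arr s′ a x
    miss {x} ne = trans (new x) (update-miss (arr s′ a) _ ne)
    p′ : ∀ (j : Fin K) → toℕ j < suc (toℕ k) → _ ≡ g j
    p′ j (s≤s j≤k) with k Fin.≟ j
    ... | yes refl = trans (new _) (update-hit (arr s′ a) _ _)
    ... | no k≢j = trans (miss (k≢j ∘ toℕ-injective ∘ +-cancelˡ-≡ base (toℕ k) (toℕ j)))
                     (p j (≤∧≢⇒< j≤k (k≢j ∘ toℕ-injective ∘ sym)))
    q′ : ∀ (j : Fin K) → suc (toℕ k) ≤ toℕ j → _
    q′ j k<j = trans (miss (<⇒≢ k<j ∘ +-cancelˡ-≡ base (toℕ k) (toℕ j))) (q j (<⇒≤ k<j))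
    r′ : ∀ x → x < base → _
    r′ x x<b = trans (miss (λ eq → <⇒≱ x<b (subst (base ≤_) eq (m≤m+n base (toℕ k))))) (r x x<b)

sumLoop : ℕ → ℕ → ℕ → Exp → Cmd
sumLoop r i N e = r ≔ lit 0 ⨾ for i N (r ≔ bin plus (var r) e)

sumLoopTime : Exp → ℕ → ℕ
sumLoopTime e K = 2 + (6 + (8 * K + K * suc (suc (suc (size e)))))

sum-rule : ∀ {B r i N e K s} (g : Fin K → ℕ) → does (i ≟ N) ≡ false → does (r ≟ i) ≡ false →
  does (r ≟ N) ≡ false → does (i ≟ r) ≡ false → 1 ≤ B → ∑ g ≤ B → Bounded B s → reg s N ≡ K →
  (∀ k {s′} → Bounded B s′ → Agree (r ≔ bin plus (var r) e ⨾ i ≔ bin plus (var i) (lit 1)) (setReg (setReg s r 0) i 0) s′ →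
     reg s′ i ≡ toℕ k → Fits B e s′ × eval e s′ ≡ g k) →
  Runs B (sumLoop r i N e) s (sumLoopTime e K) (λ s′ → reg s′ r ≡ ∑ g)
sum-rule {B} {r} {i} {N} {e} {K} {s} g i≢N r≢i r≢N i≢r 1≤B ∑≤B b rN h =
  (assign-run z≤n ⟫ λ { _ _ refl b′ →
   runs-mono (≤-reflexive (cong (λ z → 6 + (8 * K + z)) (∑-const {K} _)))
     (λ { (p , _) → trans p (prefix-all g) })
    (for-rule Inv (λ _ → suc (size (bin plus (var r) e))) r≢i r≢N i≢N 1≤B b′
       (trans (update-miss-does (reg s) r N _ r≢N) rN)
       (trans (update-miss-does (reg s [ r ↦ 0 ]) i r 0 i≢r) (trans (update-hit (reg s) r 0) (sym (prefix-zero g)))) body) }) b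
  where
  Inv : ℕ → State → Set
  Inv k s′ = reg s′ r ≡ prefix g k
  body : ∀ (k : Fin K) {s′} → _ → _ → _ → Inv (toℕ k) s′ → Runs B (r ≔ bin plus (var r) e) s′ _ _
  body k {s′} b′ ag ri inv with h k b′ ag ri
  ... | f , ev = runs (assign (proj₁ b′ r , f ,
      subst (_≤ B) (sym val) (≤-trans (prefix≤∑ g (suc (toℕ k))) ∑≤B))) ≤-refl
    (trans (update-miss-does (reg s′ [ r ↦ _ ]) i r _ i≢r) (trans (update-hit (reg s′) r _) val))
    where
    val : reg s′ r + eval e s′ ≡ prefix g (suc (toℕ k))
    val = trans (cong₂ _+_ inv ev) (sym (prefix-suc g k))

-- Walks and distances

least : ∀ {P : ℕ → Set} → (∀ k → Dec (P k)) → ∀ {k₀} → P k₀ → ∃ λ k → P k × (∀ j → P j → k ≤ j)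
least {P} P? {k₀} p₀ = go k₀ 0 (+-identityʳ k₀) (λ j _ → z≤n)
  where
  go : ∀ r k → r + k ≡ k₀ → (∀ j → P j → k ≤ j) → ∃ λ k → P k × (∀ j → P j → k ≤ j)
  go zero    k refl low = k , p₀ , low
  go (suc r) k eq low with P? k
  ... | yes p = k , p , low
  ... | no ¬p = go r (suc k) (trans (+-suc r k) eq)
                  (λ j pj → ≤∧≢⇒< (low j pj) (λ { refl → ¬p pj }))

module Walks (G : Graph) where
  open Graph G

  flip : ∀ {e u v} → Joins e u v → Joins e v u
  flip (inj₁ (p , q)) = inj₂ (p , q)
  flip (inj₂ (p , q)) = inj₁ (p , q)

  Joins? : ∀ e u v → Dec (Joins e u v)
  Joins? e u v = ((src e FinP.≟ u) ×-dec (tgt e FinP.≟ v)) ⊎-dec ((src e FinP.≟ v) ×-dec (tgt e FinP.≟ u))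

  joined : ∀ e → Joins e (src e) (tgt e)
  joined e = inj₁ (refl , refl)

  same-ends : ∀ {e f u v} → Joins e u v → Joins f u v → e ≡ f
  same-ends (inj₁ (refl , refl)) j = simple _ _ j
  same-ends (inj₂ (refl , refl)) j = simple _ _ (flip j)

  edge : ∀ e → Walk (src e) (tgt e)
  edge e = step e (joined e) stop

  infixr 5 _⊕_

  _⊕_ : ∀ {u v x} → Walk u v → Walk v x → Walk u x
  stop       ⊕ q = q
  step e j p ⊕ q = step e j (p ⊕ q)

  edges-⊕ : ∀ {u v x} (p : Walk u v) (q : Walk v x) → edges (p ⊕ q) ≡ edges p ++ edges q
  edges-⊕ stop         q = refl
  edges-⊕ (step e j p) q = cong (e ∷_) (edges-⊕ p q)

  vertices-join : ∀ {u x y v} (p : Walk u x) e (j : Joins e x y) (q : Walk y v) →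
                  vertices (p ⊕ step e j q) ≡ vertices p ++ vertices q
  vertices-join stop         e j q = refl
  vertices-join (step _ _ p) e j q = cong (_ ∷_) (vertices-join p e j q)

  start-∈ : ∀ {u v} (p : Walk u v) → u ∈ vertices p
  start-∈ stop         = here refl
  start-∈ (step _ _ _) = here refl

  end-∈ : ∀ {u v} (p : Walk u v) → v ∈ vertices p
  end-∈ stop         = here refl
  end-∈ (step _ _ p) = there (end-∈ p)

  All-⊕ : ∀ {u v x} {Q : Fin m → Set} (p : Walk u v) {q : Walk v x} →
          All Q (edges p) → All Q (edges q) → All Q (edges (p ⊕ q))
  All-⊕ p {q} a b = subst (All _) (sym (edges-⊕ p q)) (AllP.++⁺ a b)

  rev : ∀ {u v} → Walk u v → Walk v u
  rev stop         = stop
  rev (step e j p) = rev p ⊕ step e (flip j) stop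

  All-rev : ∀ {u v} {Q : Fin m → Set} (p : Walk u v) → All Q (edges p) → All Q (edges (rev p))
  All-rev stop         []       = []
  All-rev (step e j p) (q ∷ qs) = All-⊕ (rev p) (All-rev p qs) (q ∷ [])

  len : (Fin m → ℕ) → ∀ {u v} → Walk u v → ℕ
  len ℓ p = List.sum (List.map ℓ (edges p))

  len-⊕ : ∀ ℓ {u v x} (p : Walk u v) (q : Walk v x) → len ℓ (p ⊕ q) ≡ len ℓ p + len ℓ q
  len-⊕ ℓ stop         q = refl
  len-⊕ ℓ (step e j p) q = trans (cong (ℓ e +_) (len-⊕ ℓ p q)) (sym (+-assoc (ℓ e) _ _))

  len-rev : ∀ ℓ {u v} (p : Walk u v) → len ℓ (rev p) ≡ len ℓ p
  len-rev ℓ stop         = refl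
  len-rev ℓ (step e j p) = trans (len-⊕ ℓ (rev p) _)
    (trans (cong₂ _+_ (len-rev ℓ p) (+-identityʳ (ℓ e))) (+-comm (len ℓ p) (ℓ e)))

  len-cong : ∀ {ℓ ℓ′ u v} (p : Walk u v) → All (λ e → ℓ e ≡ ℓ′ e) (edges p) → len ℓ p ≡ len ℓ′ p
  len-cong stop         []       = refl
  len-cong (step e j p) (q ∷ qs) = cong₂ _+_ q (len-cong p qs)

  ∈⇒≤len : ∀ ℓ {u v e} (p : Walk u v) → e ∈ edges p → ℓ e ≤ len ℓ p
  ∈⇒≤len ℓ (step e j p) (here refl) = m≤m+n _ _
  ∈⇒≤len ℓ (step e j p) (there i)   = ≤-trans (∈⇒≤len ℓ p i) (m≤n+m _ (ℓ e))

  -- All length functions are covered at once, since a walk is measured both by `ℓ` and by the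
  -- masked lengths.
  record Within-walk {u v x y} (p : Walk u v) (q : Walk x y) : Set where
    constructor inside-walk
    field
      edges-⊆    : ∀ {e} → e ∈ edges q → e ∈ edges p
      vertices-⊆ : ∀ {z} → z ∈ vertices q → z ∈ vertices p
      len-≤      : ∀ ℓ → len ℓ q ≤ len ℓ p

    All-⊆ : ∀ {Q : Fin m → Set} → All Q (edges p) → All Q (edges q)
    All-⊆ a = All.tabulate (λ e∈ → All.lookup a (edges-⊆ e∈))

  open Within-walk public

  suffix-from : ∀ {u v x} (p : Walk u v) → x ∈ vertices p →
                ∃ λ (q : Walk x v) → Within-walk p q × (Unique (vertices p) → Unique (vertices q))
  suffix-from stop         (here refl) = stop , inside-walk id id (λ _ → ≤-refl) , id
  suffix-from (step e j p) (here refl) = step e j p , inside-walk id id (λ _ → ≤-refl) , id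
  suffix-from (step e j p) (there x∈) with suffix-from p x∈
  ... | q , inside-walk es vs l , u = q ,
    inside-walk (there ∘ es) (there ∘ vs) (λ ℓ → ≤-trans (l ℓ) (m≤n+m _ (ℓ e))) , λ { (_ ∷ d) → u d }

  prefix-to : ∀ {u v x} (p : Walk u v) → x ∈ vertices p → ∃ λ (q : Walk u x) → Within-walk p q
  prefix-to stop         (here refl) = stop , inside-walk id id (λ _ → ≤-refl)
  prefix-to (step e j p) (here refl) = stop , inside-walk (λ ()) (λ { (here refl) → here refl }) (λ _ → z≤n)
  prefix-to (step e j p) (there x∈) with prefix-to p x∈
  ... | q , inside-walk es vs l = step e j q ,
    inside-walk (λ { (here refl) → here refl ; (there i) → there (es i) })
                (λ { (here refl) → here refl ; (there i) → there (vs i) })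
                (λ ℓ → +-monoʳ-≤ (ℓ e) (l ℓ))

  open DecMembership (FinP._≟_ {n}) using (_∈?_)

  to-path : ∀ {u v} (p : Walk u v) → ∃ λ (P : Path u v) → Within-walk p (walk P)
  to-path stop = path stop ([] ∷ []) , inside-walk id id (λ _ → ≤-refl)
  to-path {u} (step e j p) with to-path p
  ... | path q d , inside-walk es vs l with u ∈? vertices q
  ...   | yes u∈ with suffix-from q u∈
  ...     | r , inside-walk es′ vs′ l′ , d′ = path r (d′ d) ,
            inside-walk (there ∘ es ∘ es′) (there ∘ vs ∘ vs′) (λ ℓ → ≤-trans (l′ ℓ) (≤-trans (l ℓ) (m≤n+m _ (ℓ e))))
  to-path {u} (step e j p) | path q d , inside-walk es vs l | no u∉ =
    path (step e j q) (All.tabulate (λ { x∈ refl → u∉ x∈ }) ∷ d) ,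
    inside-walk (λ { (here refl) → here refl ; (there i) → there (es i) })
                (λ { (here refl) → here refl ; (there i) → there (vs i) })
                (λ ℓ → +-monoʳ-≤ (ℓ e) (l ℓ))

module Distances (N : Network) where
  open Network N
  open Walks graph public

  distance-≤ : ∀ {F u v d} → Distance F u v d → (p : Walk u v) → All (Subset._∈ F) (edges p) → d ≤ len ℓ p
  distance-≤ (_ , low) p a with to-path p
  ... | P , i = ≤-trans (low P (All-⊆ i a)) (len-≤ i ℓ)

  distance-unique : ∀ {F u v d d′} → Distance F u v d → Distance F u v d′ → d ≡ d′
  distance-unique ((P , a , refl) , low) ((P′ , a′ , refl) , low′) = ≤-antisym (low P′ a′) (low′ P a)

  in-⊤ : ∀ {u v} (p : Walk u v) → All (Subset._∈ Subset.⊤) (edges p)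
  in-⊤ p = All.universal (λ e → SubsetP.∈⊤) (edges p)

  module _ (F : Subset m) where
    private
      Short : ℕ → Fin n → Fin n → Set
      Short k u v = ∃ λ (p : Walk u v) → All (Subset._∈ F) (edges p) × len ℓ p ≤ k

      First : ℕ → Fin n → Fin n → Set
      First k u v = ∃ λ e → ∃ λ x → (Joins e u x × e Subset.∈ F × ℓ e ≤ k) × Short (k ∸ ℓ e) x v

      short? : ∀ f k → k ≤ f → ∀ u v → Dec (Short k u v)
      short? f k k≤f u v with u FinP.≟ v
      ... | yes refl = yes (stop , [] , z≤n)
      short? zero .0 z≤n u v | no u≢v = no λ
        { (stop , _) → u≢v refl
        ; (step e j p , _ , l) → <⇒≱ (≤-trans (ℓ-positive e) (m≤m+n _ _)) l }
      short? (suc f) k k≤f u v | no u≢v = map′ to from (FinP.any? λ e → FinP.any? λ x → first? e x)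
        where
        first? : ∀ e x → Dec ((Joins e u x × e Subset.∈ F × ℓ e ≤ k) × Short (k ∸ ℓ e) x v)
        first? e x with Joins? e u x ×-dec (e SubsetP.∈? F ×-dec (ℓ e ≤? k))
        ... | no ¬q = no (¬q ∘ proj₁)
        ... | yes q@(_ , _ , l) = map′ (q ,_) proj₂ (short? f (k ∸ ℓ e)
                (≤-trans (∸-monoʳ-≤ k (ℓ-positive e)) (∸-monoˡ-≤ 1 k≤f)) x v)
        to : First k u v → Short k u v
        to (e , x , (j , e∈ , l) , p , a , l′) = step e j p , e∈ ∷ a ,
          ≤-trans (+-monoʳ-≤ (ℓ e) l′) (≤-reflexive (m+[n∸m]≡n l))
        from : Short k u v → First k u v
        from (stop , _) = contradiction refl u≢v
        from (step {v = x} e j p , e∈ ∷ a , l) = e , x , (j , e∈ , ≤-trans (m≤m+n _ _) l) , p , a ,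
          ≤-trans (≤-reflexive (sym (m+n∸m≡n (ℓ e) (len ℓ p)))) (∸-monoˡ-≤ (ℓ e) l)

    -- Whether some walk has length at most `k` is decidable, because positive edge lengths make the
    -- bound shrink along each edge. So a least such `k` exists, and shortcutting a walk that
    -- attains it yields a path of the same length.
    distance-exists : ∀ {u v} (p : Walk u v) → All (Subset._∈ F) (edges p) → ∃ λ d → Distance F u v d × d ≤ len ℓ p
    distance-exists {u} {v} p a with least (λ k → short? k k ≤-refl u v) (p , a , ≤-refl)
    ... | d , (q , b , l) , low with to-path q
    ...   | Q , i = d , ((Q , All-⊆ i b ,
              ≤-antisym (≤-trans (len-≤ i ℓ) l) (low _ (walk Q , All-⊆ i b , ≤-refl)))
            , (λ R c → low _ (walk R , c , ≤-refl))) , low _ (p , a , ≤-refl)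

-- Latest departures

<∸⇒+< : ∀ a b c → c < a ∸ b → c + b < a
<∸⇒+< a zero    c p = subst (_< a) (sym (+-identityʳ c)) p
<∸⇒+< (suc a) (suc b) c p = subst (_< suc a) (sym (+-suc c b)) (s≤s (<∸⇒+< a b c p))

+<⇒<∸ : ∀ a b c → c + b < a → c < a ∸ b
+<⇒<∸ a b c p = m+n≤o⇒m≤o∸n (suc c) p

-- One relaxation: the old departure time, the deadline, the departure time of the settled neighbour
-- and the length of the edge to it.
relay : ℕ → ℕ → ℕ → ℕ → ℕ
relay a c x d = a ⊔ (c ⊓ (x ∸ d))

-- Latest departure times for v.  M y is one more than the last moment at which one can
-- leave y so as to be in v at time less than R, passing every vertex z strictly before
-- the deadline cap z; M y = 0 if there is no such moment.  An edge e is usable if g e ≢ 0.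
module Departures (N : Network) (g : Fin (Network.m N) → ℕ) (cap : Fin (Network.n N) → ℕ)
                  (v : Fin (Network.n N)) (R : ℕ) where
  open Network N
  open Distances N

  -- `b` is an exclusive bound: every departure time below it succeeds along the same walk. The
  -- deadline at `v` is not part of `arrive`; it enters where needed as `R ≤ cap v`.
  data Reach : Fin n → ℕ → Set where
    arrive : Reach v R
    leave  : ∀ {e y z a b} → Reach z a → g e ≢ 0 → Joins e y z → b + ℓ e ≤ a → b ≤ cap y → Reach y b

  -- `sound` says that the values are attained, `start` and `closed` that no usable edge can improve
  -- them; together they characterise the maximum.
  record Latest (M : Fin n → ℕ) : Set where
    field
      sound  : ∀ y → M y ≢ 0 → Reach y (M y)
      start  : R ≤ M v
      closed : ∀ {e y z b} → g e ≢ 0 → Joins e y z → b ≤ cap y → b + ℓ e ≤ M z → b ≤ M y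

  reach-≤R : ∀ {y b} → Reach y b → b ≤ R
  reach-≤R arrive              = ≤-refl
  reach-≤R (leave r _ _ l _) = ≤-trans (m≤m+n _ _) (≤-trans l (reach-≤R r))

  reach-≤cap : R ≤ cap v → ∀ {y b} → Reach y b → b ≤ cap y
  reach-≤cap Rv arrive            = Rv
  reach-≤cap Rv (leave _ _ _ _ c) = c

  Usable : Fin m → Set
  Usable e = g e ≢ 0

  -- Time only grows along the walk, so meeting the deadline of `z` on arrival implies that already
  -- the departure precedes it. This weaker statement is what keeps the walk apart from the vertices
  -- nearer to `u`.
  reach-walk : R ≤ cap v → ∀ {y b t} → Reach y b → t < b →
    ∃ λ (w : Walk y v) → All Usable (edges w) × t + len ℓ w < R × (∀ {z} → z ∈ vertices w → t < cap z)
  reach-walk Rv {t = t} arrive t<b =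
    stop , [] , subst (_< R) (sym (+-identityʳ t)) t<b , λ { (here refl) → ≤-trans t<b Rv }
  reach-walk Rv {t = t} (leave {e} r ge j l c) t<b
    with reach-walk Rv {t = t + ℓ e} r (≤-trans (+-monoˡ-≤ (ℓ e) t<b) l)
  ... | w , a , lt , ds = step e j w , ge ∷ a , subst (_< R) (+-assoc t (ℓ e) _) lt ,
    λ { (here refl) → ≤-trans t<b c ; (there i) → ≤-trans (s≤s (m≤m+n t (ℓ e))) (ds i) }

  module _ {M : Fin n → ℕ} (L : Latest M) where
    open Latest L

    latest-≤R : ∀ y → M y ≤ R
    latest-≤R y with M y ≟ 0
    ... | yes eq = ≤-trans (≤-reflexive eq) z≤n
    ... | no ne  = reach-≤R (sound y ne)

    latest-≤cap : R ≤ cap v → ∀ y → M y ≤ cap y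
    latest-≤cap Rv y with M y ≟ 0
    ... | yes eq = ≤-trans (≤-reflexive eq) z≤n
    ... | no ne  = reach-≤cap Rv (sound y ne)

    module _ (Rcap : ∀ y → R ≤ cap y) where
      latest-walk : ∀ {y b} (w : Walk y v) → All Usable (edges w) → b + len ℓ w ≤ R → b ≤ M y
      latest-walk {b = b} stop [] l = ≤-trans (≤-trans (m≤m+n b 0) l) start
      latest-walk {y} {b} (step e j w) (ge ∷ a) l = closed ge j
        (≤-trans (≤-trans (m≤m+n b _) l) (Rcap y))
        (latest-walk w a (subst (_≤ R) (sym (+-assoc b (ℓ e) _)) l))

      -- When no deadline is below `R`, `R ∸ M y` is the distance from `y` to `v` along usable
      -- edges, cut off at `R`. This lemma and `≤-latest` are the two directions.
      latest-≤ : ∀ {y k} → k < R → (w : Walk y v) → All Usable (edges w) → len ℓ w ≤ k → R ∸ M y ≤ k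
      latest-≤ {y} {k} k<R w a l = ≤-trans
        (≤-trans (∸-monoʳ-≤ R (latest-walk w a (≤-reflexive (m∸n+n≡m w≤R)))) (≤-reflexive (m∸[m∸n]≡n w≤R))) l
        where w≤R = ≤-trans l (<⇒≤ k<R)

      ≤-latest : ∀ {y k} → k < R → R ∸ M y ≤ k → ∃ λ (w : Walk y v) → All Usable (edges w) × len ℓ w ≤ k
      ≤-latest {y} {k} k<R l with M y in eq
      ... | zero  = contradiction l (<⇒≱ k<R)
      ... | suc b with reach-walk (Rcap v) (subst (Reach y) eq (sound y (λ p → contradiction (trans (sym eq) p) λ ()))) (≤-refl {suc b})
      ...   | w , a , lt , _ = w , a , ≤-trans (m+n≤o⇒m≤o∸n (len ℓ w) (≤-trans (≤-reflexive (+-suc (len ℓ w) b))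
                (≤-trans (s≤s (≤-reflexive (+-comm (len ℓ w) b))) lt))) l

  -- One round of Dijkstra's algorithm; U marks the vertices not yet settled and mat is
  -- the matrix of edge lengths.

  record Settling-invariant (M U : Fin n → ℕ) : Set where
    field
      sound  : ∀ y → M y ≢ 0 → Reach y (M y)
      start  : R ≤ M v
      closed : ∀ {e y z b} → U z ≡ 0 → g e ≢ 0 → Joins e y z → b ≤ cap y → b + ℓ e ≤ M z → b ≤ M y
      order  : ∀ {y z} → U z ≡ 0 → U y ≢ 0 → M y ≤ M z

  settled-latest : ∀ {M U} → Settling-invariant M U → (∀ z → U z ≡ 0) → Latest M
  settled-latest I all = record { sound = sound ; start = start ; closed = closed (all _) }
    where open Settling-invariant I

  -- A deadline only lowers an offer, so what a vertex is offered through `b` is at most `M b`. By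
  -- `order`, settled vertices then keep their values and edges into them stay closed; the only
  -- newly relevant edges are those into `b`, which the relaxation treats.
  module Round {M U M′ U′ : Fin n → ℕ} {b : Fin n} {mat : Fin n → ℕ} {big : ℕ} (R≤big : R ≤ big)
    (far  : ∀ y → mat y ≡ big ⊎ ∃ λ e → g e ≢ 0 × Joins e y b × mat y ≡ ℓ e)
    (near : ∀ {e y} → g e ≢ 0 → Joins e y b → mat y ≤ ℓ e)
    (b-open : U b ≢ 0) (b-max : ∀ y → U y ≢ 0 → M y ≤ M b)
    (M′≡ : ∀ y → M′ y ≡ relay (M y) (cap y) (M b) (mat y))
    (U′b : U′ b ≡ 0) (U′≡ : ∀ y → y ≢ b → U′ y ≡ U y)
    (I : Settling-invariant M U) where
    open Settling-invariant I

    private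
      M≤M′ : ∀ y → M y ≤ M′ y
      M≤M′ y = ≤-trans (m≤m⊔n _ _) (≤-reflexive (sym (M′≡ y)))

      M′≤ : ∀ y {c} → M y ≤ c → M b ≤ c → M′ y ≤ c
      M′≤ y p q = ≤-trans (≤-reflexive (M′≡ y))
        (⊔-lub p (≤-trans (m⊓n≤n (cap y) _) (≤-trans (m∸n≤m (M b) (mat y)) q)))

      Mb≤R : M b ≤ R
      Mb≤R with M b ≟ 0
      ... | yes eq = ≤-trans (≤-reflexive eq) z≤n
      ... | no ne  = reach-≤R (sound b ne)

      sound′ : ∀ y → M′ y ≢ 0 → Reach y (M′ y)
      sound′ y ne with ⊔-sel (M y) (cap y ⊓ (M b ∸ mat y))
      ... | inj₁ eq = subst (Reach y) (sym eq′) (sound y (ne ∘ trans eq′))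
        where eq′ = trans (M′≡ y) eq
      ... | inj₂ eq with trans (M′≡ y) eq | far y
      -- A missing edge has length `big`, which is at least `R`, so its offer is 0, that is, no
      -- departure at all.
      ...   | eq′ | inj₁ m≡big = contradiction (trans eq′ (n≤0⇒n≡0 (≤-trans (m⊓n≤n (cap y) _)
                (≤-reflexive (m≤n⇒m∸n≡0 (≤-trans Mb≤R (≤-trans R≤big (≤-reflexive (sym m≡big))))))))) ne
      ...   | eq′ | inj₂ (e , ge , j , m≡) = subst (Reach y) (sym eq′)
                (leave (sound b (λ z → <⇒≢ (≤-trans pos (m∸n≤m (M b) (mat y))) (sym z))) ge j fits (m⊓n≤m (cap y) _))
        where
        pos : 0 < M b ∸ mat y
        pos = ≤-trans (n≢0⇒n>0 (ne ∘ trans eq′)) (m⊓n≤n (cap y) _)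
        mat<M : mat y < M b
        mat<M = m∸n≢0⇒n<m (λ z → <⇒≢ pos (sym z))
        fits : (cap y ⊓ (M b ∸ mat y)) + ℓ e ≤ M b
        fits = ≤-trans (+-monoˡ-≤ (ℓ e) (m⊓n≤n (cap y) _))
          (≤-reflexive (trans (cong (M b ∸ mat y +_) (sym m≡)) (m∸n+n≡m (<⇒≤ mat<M))))

      closed′ : ∀ {e y z c} → U′ z ≡ 0 → g e ≢ 0 → Joins e y z → c ≤ cap y → c + ℓ e ≤ M′ z → c ≤ M′ y
      closed′ {e} {y} {z} {c} Uz ge j c≤ l with z FinP.≟ b
      ... | no z≢b = ≤-trans (closed Uz′ ge j c≤ (≤-trans l (M′≤ z ≤-refl (order Uz′ b-open)))) (M≤M′ y)
        where Uz′ = trans (sym (U′≡ z z≢b)) Uz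
      ... | yes refl = ≤-trans (≤-trans (⊓-glb c≤ (m+n≤o⇒m≤o∸n c
              (≤-trans (+-monoʳ-≤ c (near ge j)) (≤-trans l (M′≤ z ≤-refl ≤-refl)))))
              (m≤n⊔m (M y) _)) (≤-reflexive (sym (M′≡ y)))

      order′ : ∀ {y z} → U′ z ≡ 0 → U′ y ≢ 0 → M′ y ≤ M′ z
      order′ {y} {z} Uz Uy with y FinP.≟ b
      ... | yes refl = contradiction U′b Uy
      ... | no y≢b with z FinP.≟ b
      ...   | yes refl = M′≤ y (≤-trans (b-max y Uy′) (M≤M′ z)) (M≤M′ z)
        where Uy′ = Uy ∘ trans (U′≡ y y≢b)
      ...   | no z≢b = M′≤ y (≤-trans (order Uz′ (Uy ∘ trans (U′≡ y y≢b))) (M≤M′ z)) (≤-trans (order Uz′ b-open) (M≤M′ z))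
        where Uz′ = trans (sym (U′≡ z z≢b)) Uz

    round : Settling-invariant M′ U′
    round = record { sound = sound′ ; start = ≤-trans start (M≤M′ v) ; closed = closed′ ; order = order′ }

-- Subgraphs as networks with long edges, and the branching edges

module _ (N : Network) where
  open Network N

  relength : (ℓ′ : Fin m → ℕ) → (∀ e → 1 ≤ ℓ′ e) → Network
  relength ℓ′ pos = record { graph = graph ; connected = connected ; ℓ = ℓ′ ; ℓ-positive = pos }

-- H is the subgraph of the edges with f e ≢ 0; in ℓ′ all other edges have length big,
-- so they are of no use below big.
module Masked (N : Network) (f : Fin (Network.m N) → ℕ) (ℓ′ : Fin (Network.m N) → ℕ)
  (pos : ∀ e → 1 ≤ ℓ′ e) (big : ℕ)
  (ℓ′-on  : ∀ e → f e ≢ 0 → ℓ′ e ≡ Network.ℓ N e) (ℓ′-off : ∀ e → f e ≡ 0 → ℓ′ e ≡ big) where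
  open Network N
  open Distances N
  module N′ = Distances (relength N ℓ′ pos)

  Distance′ : Fin n → Fin n → ℕ → Set
  Distance′ = Network.Distance (relength N ℓ′ pos) Subset.⊤

  in-H : ∀ {x y} (p : Walk x y) → len ℓ′ p < big → All (λ e → f e ≢ 0) (edges p)
  in-H p lt = All.tabulate λ {e} e∈ fe≡0 →
    <⇒≱ lt (≤-trans (≤-reflexive (sym (ℓ′-off e fe≡0))) (∈⇒≤len ℓ′ p e∈))

  H-len : ∀ {x y} (p : Walk x y) → All (λ e → f e ≢ 0) (edges p) → len ℓ′ p ≡ len ℓ p
  H-len p a = len-cong p (All.map (λ {e} → ℓ′-on e) a)

  H-walk : ∀ {x y d k} → k < big → Distance′ x y d → d ≤ k →
           ∃ λ (p : Walk x y) → All (λ e → f e ≢ 0) (edges p) × len ℓ p ≤ k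
  H-walk k<big ((P , _ , eq) , _) d≤k = walk P , a , ≤-trans (≤-reflexive (trans (sym (H-len (walk P) a)) eq)) d≤k
    where a = in-H (walk P) (≤-trans (s≤s (≤-trans (≤-reflexive eq) d≤k)) k<big)

  H-≤ : ∀ {x y d} → Distance′ x y d → (p : Walk x y) → All (λ e → f e ≢ 0) (edges p) → d ≤ len ℓ p
  H-≤ D p a = ≤-trans (N′.distance-≤ D p (N′.in-⊤ p)) (≤-reflexive (H-len p a))

-- The edges to branch on, where D z is the distance from u to z in H.  The deadlines D
-- make every branching edge part of a simple path: a walk leaving the H-ball of u at x
-- at time D x and meeting the deadlines cannot return to a vertex of the shortest path
-- from u to x.
module Branching (N : Network) (f : Fin (Network.m N) → ℕ) (ℓ′ : Fin (Network.m N) → ℕ)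
  (pos : ∀ e → 1 ≤ ℓ′ e) (big : ℕ)
  (ℓ′-on  : ∀ e → f e ≢ 0 → ℓ′ e ≡ Network.ℓ N e) (ℓ′-off : ∀ e → f e ≡ 0 → ℓ′ e ≡ big)
  (u v : Fin (Network.n N)) (k : ℕ) (k<big : k < big)
  (D : Fin (Network.n N) → ℕ) (D-distance : ∀ z → Masked.Distance′ N f ℓ′ pos big ℓ′-on ℓ′-off u z (D z))
  (unsettled : k < D v) where
  open Network N
  open Distances N
  open Masked N f ℓ′ pos big ℓ′-on ℓ′-off

  open Departures N (λ _ → 1) D v (suc k)

  D-≤ : ∀ {z} (p : Walk u z) → D z ≤ len ℓ′ p
  D-≤ {z} p = N′.distance-≤ (D-distance z) p (N′.in-⊤ p)

  D-start : D u ≡ 0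
  D-start = n≤0⇒n≡0 (D-≤ stop)

  D-step : ∀ {e x y} → f e ≢ 0 → Joins e x y → D y ≤ D x + ℓ e
  D-step {e} {x} {y} fe j with D-distance x
  ... | (P , _ , eq) , _ = ≤-trans (D-≤ (walk P ⊕ step e j stop)) (≤-reflexive
    (trans (len-⊕ ℓ′ (walk P) _) (cong₂ _+_ eq (trans (+-identityʳ _) (ℓ′-on e fe)))))

  module _ {M : Fin n → ℕ} (L : Latest M) where
    open Latest L

    Candidate : Fin m → Fin n → Fin n → Set
    Candidate e x y = Joins e x y × D x + ℓ e < M y

    -- The deadline gives `M y ≤ D y`, and an edge of H would give `D y ≤ D x + ℓ e`. So each
    -- branching adds an edge that was missing.
    candidate-new : ∀ {e x y} → Candidate e x y → f e ≡ 0
    candidate-new {e} {x} {y} (j , l) with f e ≟ 0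
    ... | yes eq = eq
    ... | no ne  = contradiction (≤-trans l (≤-trans (latest-≤cap L unsettled y) (D-step ne j))) (n≮n _)

    candidate-path : ∀ {e x y} → Candidate e x y →
      ∃ λ (P : Path u v) → length P ≤ k × x ∈ vertices (walk P) × y ∈ vertices (walk P)
    candidate-path {e} {x} {y} (j , l) with D-distance x
    ... | (Q , _ , eq) , _ with reach-walk unsettled (sound y (λ z → <⇒≱ l (≤-trans (≤-reflexive z) z≤n))) l
    ...   | w , _ , lt , ds with to-path w
    ...     | path r r-simple , i =
      path whole whole-simple , whole-≤ ,
      subst (x ∈_) (sym split) (∈-++⁺ˡ (end-∈ (walk Q))) ,
      subst (y ∈_) (sym split) (∈-++⁺ʳ _ (start-∈ r))
      where
      whole = walk Q ⊕ step e j r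
      split = vertices-join (walk Q) e j r
      -- The masked length `D x` of `Q` is below `M y ≤ suc k ≤ big`. So `Q` stays in H, and `D x`
      -- is also its true length.
      Q-in-H : len ℓ′ (walk Q) ≡ len ℓ (walk Q)
      Q-in-H = H-len (walk Q) (in-H (walk Q) (≤-trans (s≤s (≤-trans (≤-reflexive eq) (m≤m+n _ (ℓ e))))
                 (≤-trans l (≤-trans (latest-≤R L y) k<big))))
      whole-≤ : len ℓ whole ≤ k
      whole-≤ = ≤-pred (≤-trans (s≤s (≤-trans (≤-reflexive (trans (len-⊕ ℓ (walk Q) _)
          (trans (cong (_+ (ℓ e + len ℓ r)) (trans (sym Q-in-H) eq)) (sym (+-assoc (D x) (ℓ e) _)))))
          (+-monoʳ-≤ (D x + ℓ e) (len-≤ i ℓ)))) lt)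
      before : ∀ {z} → z ∈ vertices (walk Q) → D z ≤ D x
      before z∈ with prefix-to (walk Q) z∈
      ... | q , i′ = ≤-trans (D-≤ q) (≤-trans (len-≤ i′ ℓ′) (≤-reflexive eq))
      whole-simple : Unique (vertices whole)
      whole-simple = subst Unique (sym split) (Unique.++⁺ (distinct Q) r-simple
        λ { (z∈Q , z∈r) → <⇒≱ (ds (vertices-⊆ i z∈r)) (≤-trans (before z∈Q) (m≤m+n _ (ℓ e))) })

    private
      search : ∀ {y t} (w : Walk y v) → t + len ℓ w ≤ k →
               t < M y ⊎ ∃ λ e → e ∈ edges w × ∃₂ λ x y → Candidate e x y
      search {t = t} stop l = inj₁ (≤-trans (s≤s (≤-trans (m≤m+n t 0) l)) start)
      search {y} {t} (step e j w) l with search {t = t + ℓ e} w (subst (_≤ k) (sym (+-assoc t (ℓ e) _)) l)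
      ... | inj₂ (e′ , e′∈ , c) = inj₂ (e′ , there e′∈ , c)
      ... | inj₁ t<M with t <? D y
      ...   | yes t<D = inj₁ (closed (λ ()) j t<D t<M)
      -- The first deadline that fails: H reaches this vertex no later than the walk does, so
      -- leaving it at time `D y` still leads to `v` in time.
      ...   | no t≮D  = inj₂ (e , here refl , y , _ , j , ≤-trans (s≤s (+-monoˡ-≤ (ℓ e) (≮⇒≥ t≮D))) t<M)

    candidate-exists : (w : Walk u v) → len ℓ w ≤ k → ∃ λ e → e ∈ edges w × ∃₂ λ x y → Candidate e x y
    candidate-exists w l with search {t = 0} w l
    ... | inj₂ c = c
    -- The deadline at `u` is 0, so the backward search cannot get past `u` without a violation.
    ... | inj₁ p = contradiction (≤-trans p (≤-trans (latest-≤cap L unsettled u) (≤-reflexive D-start))) λ ()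

-- Spanners and subproblems

¬¬-dec-all : ∀ {k} {P : Fin k → Set} → ¬ ¬ (∀ i → Dec (P i))
¬¬-dec-all {zero}      refute = refute λ ()
¬¬-dec-all {suc k} {P} refute = ¬¬-dec-all {k} λ d →
  let ¬p : ¬ P Fin.zero
      ¬p p = refute λ { Fin.zero → yes p ; (Fin.suc i) → d i }
  in refute λ { Fin.zero → no ¬p ; (Fin.suc i) → d i }

length-cartesianProduct : ∀ {A : Set} (xs ys : List A) →
  List.length (List.cartesianProduct xs ys) ≡ List.length xs * List.length ys
length-cartesianProduct []       ys = refl
length-cartesianProduct (x ∷ xs) ys = trans (length-++ (List.map (x ,_) ys))
  (cong₂ _+_ (length-map _ ys) (length-cartesianProduct xs ys))

flag : ℕ → Bool
flag zero    = false
flag (suc _) = true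

toSubset : ∀ {k} → (Fin k → ℕ) → Subset k
toSubset f = Vec.tabulate (flag ∘ f)

lookup-toSubset : ∀ {k} (f : Fin k → ℕ) i → lookup (toSubset f) i ≡ flag (f i)
lookup-toSubset f = VecP.lookup∘tabulate (flag ∘ f)

∈-toSubset⁺ : ∀ {k} (f : Fin k → ℕ) {i} → f i ≢ 0 → i Subset.∈ toSubset f
∈-toSubset⁺ f {i} ne = VecP.lookup⇒[]= i _ (trans (lookup-toSubset f i) (nonzero (f i) ne))
  where
  nonzero : ∀ x → x ≢ 0 → flag x ≡ true
  nonzero zero    ne = contradiction refl ne
  nonzero (suc _) _  = refl

∈-toSubset⁻ : ∀ {k} (f : Fin k → ℕ) {i} → i Subset.∈ toSubset f → f i ≢ 0
∈-toSubset⁻ f {i} i∈ eq with trans (sym (VecP.[]=⇒lookup i∈)) (trans (lookup-toSubset f i) (cong flag eq))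
... | ()

∣toSubset∣ : ∀ {k} (f : Fin k → ℕ) → ∣ toSubset f ∣ ≡ ∑ (ind ∘ f)
∣toSubset∣ {zero}  f = refl
∣toSubset∣ {suc k} f with f Fin.zero
... | zero  = ∣toSubset∣ (f ∘ Fin.suc)
... | suc _ = cong suc (∣toSubset∣ (f ∘ Fin.suc))

flags : ∀ {k} → Subset k → Fin k → ℕ
flags F i = if lookup F i then 1 else 0

flags≢0⇒∈ : ∀ {k} {F : Subset k} {i} → flags F i ≢ 0 → i Subset.∈ F
flags≢0⇒∈ {F = F} {i} ne with lookup F i in eq
... | true  = VecP.lookup⇒[]= i F eq
... | false = contradiction refl ne

∈⇒flags≢0 : ∀ {k} {F : Subset k} {i} → i Subset.∈ F → flags F i ≢ 0
∈⇒flags≢0 {F = F} {i} i∈ rewrite VecP.[]=⇒lookup i∈ = λ ()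

length-allFin : ∀ k → List.length (List.allFin k) ≡ k
length-allFin k = length-tabulate {n = k} id

-- Counting edges and vertices

module Sizes (G : Graph) where
  open Graph G
  open Walks G

  ends : Fin m → Fin n × Fin n
  ends e = src e , tgt e

  ends-injective : ∀ {e f} → ends e ≡ ends f → e ≡ f
  ends-injective {e} {f} eq = simple e f (subst₂ (Joins f) (cong proj₁ (sym eq)) (cong proj₂ (sym eq)) (joined f))

  -- In a simple graph the stored pair of ends determines the edge, so the edges inject into the
  -- ordered pairs.
  edges-among : ∀ (es : List (Fin m)) (vs : List (Fin n)) → Unique es →
                (∀ {e} → e ∈ es → src e ∈ vs × tgt e ∈ vs) →
                List.length es ≤ List.length vs * List.length vs
  edges-among es vs u h = begin
    List.length es                              ≡⟨ length-map ends es ⟨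
    List.length (List.map ends es)              ≤⟨ unique-⊆-length (Unique.map⁺ ends-injective u) sub ⟩
    List.length (List.cartesianProduct vs vs)   ≡⟨ length-cartesianProduct vs vs ⟩
    List.length vs * List.length vs             ∎
    where
    open ≤-Reasoning
    sub : ∀ {p} → p ∈ List.map ends es → p ∈ List.cartesianProduct vs vs
    sub p∈ with ∈-map⁻ ends p∈
    ... | e , e∈ , refl = ∈-cartesianProduct⁺ (proj₁ (h e∈)) (proj₂ (h e∈))

  m≤n² : m ≤ n * n
  m≤n² = subst₂ _≤_ (length-allFin m) (cong (λ z → z * z) (length-allFin n))
    (edges-among (List.allFin m) (List.allFin n) (Unique.allFin⁺ m) (λ _ → ∈-allFin _ , ∈-allFin _))

  private
    incident : ∀ {u v} → u ≢ v → Walk u v → u ∈ (List.map src (List.allFin m) ++ List.map tgt (List.allFin m))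
    incident u≢v stop = contradiction refl u≢v
    incident u≢v (step e (inj₁ (refl , _)) p) = ∈-++⁺ˡ (∈-map⁺ src (∈-allFin e))
    incident u≢v (step e (inj₂ (_ , refl)) p) = ∈-++⁺ʳ _ (∈-map⁺ tgt (∈-allFin e))

  -- A walk to vertex 0 begins with an edge at its start, so every other vertex is an end of an
  -- edge. This is cruder than the count of a spanning tree, but of the same order.
  connected-n≤ : Connected → n ≤ suc (m + m)
  connected-n≤ c = sized n refl
    where
    open ≤-Reasoning
    sized : ∀ k → k ≡ n → k ≤ suc (m + m)
    sized zero    _    = z≤n
    sized (suc k) refl = s≤s (begin
      k                                          ≡⟨ length-tabulate {n = k} Fin.suc ⟨
      List.length nonzero                        ≤⟨ unique-⊆-length {xs = nonzero} (Unique.tabulate⁺ FinP.suc-injective) sub ⟩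
      List.length (List.map src all ++ List.map tgt all) ≡⟨ length-++ (List.map src all) ⟩
      List.length (List.map src all) + List.length (List.map tgt all)
        ≡⟨ cong₂ _+_ (trans (length-map src all) (length-allFin m)) (trans (length-map tgt all) (length-allFin m)) ⟩
      m + m ∎)
      where
      all = List.allFin m
      nonzero : List (Fin (suc k))
      nonzero = List.tabulate Fin.suc
      sub : ∀ {x} → x ∈ nonzero → x ∈ (List.map src all ++ List.map tgt all)
      sub {Fin.zero} x∈ with ∈-tabulate⁻ x∈
      ... | _ , ()
      sub {Fin.suc i} _ = incident (λ ()) (walk (c (Fin.suc i) Fin.zero))

-- Words can only compare products of naturals. `1 ≤ α` excludes a negative numerator, whose sign
-- the absolute value would hide.
ratio-≤⁻ : ∀ {α} → 1ℚᵘ ℚᵘ.≤ α → ∀ {x d} → x ≤[ α ]· d → x * ↧ₙ α ≤ ℤ.∣ ↥ α ∣ * d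
ratio-≤⁻ {mkℚᵘ (int a) b} _ {x} {d} (ℚᵘ.*≤* p) = ℤP.drop‿+≤+ (subst₂ ℤ._≤_ lhs rhs p)
  where
  lhs : int x ℤ.* int (suc b * 1) ≡ int (x * suc b)
  lhs = trans (cong (λ z → int x ℤ.* int z) (*-identityʳ (suc b))) (sym (ℤP.pos-* x (suc b)))
  rhs : (int a ℤ.* int d) ℤ.* int 1 ≡ int (a * d)
  rhs = trans (ℤP.*-identityʳ _) (sym (ℤP.pos-* a d))
ratio-≤⁻ {mkℚᵘ -[1+ a ] b} (ℚᵘ.*≤* ())

ratio-≤⁺ : ∀ {α} → 1ℚᵘ ℚᵘ.≤ α → ∀ {x d} → x * ↧ₙ α ≤ ℤ.∣ ↥ α ∣ * d → x ≤[ α ]· d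
ratio-≤⁺ {mkℚᵘ (int a) b} _ {x} {d} p = ℚᵘ.*≤* (subst₂ ℤ._≤_ lhs rhs (ℤ.+≤+ p))
  where
  lhs : int (x * suc b) ≡ int x ℤ.* int (suc b * 1)
  lhs = trans (ℤP.pos-* x (suc b)) (cong (λ z → int x ℤ.* int z) (sym (*-identityʳ (suc b))))
  rhs : int (a * d) ≡ (int a ℤ.* int d) ℤ.* int 1
  rhs = trans (ℤP.pos-* a d) (sym (ℤP.*-identityʳ _))
ratio-≤⁺ {mkℚᵘ -[1+ a ] b} (ℚᵘ.*≤* ())

ratio-den≤num : ∀ {α} → 1ℚᵘ ℚᵘ.≤ α → ↧ₙ α ≤ ℤ.∣ ↥ α ∣
ratio-den≤num {mkℚᵘ (int a) b} (ℚᵘ.*≤* p) = ℤP.drop‿+≤+ (subst₂ ℤ._≤_ (ℤP.*-identityˡ _) (ℤP.*-identityʳ _) p)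
ratio-den≤num {mkℚᵘ -[1+ a ] b} (ℚᵘ.*≤* ())

module SpannerTheory (I : SpannerInstance) where
  open SpannerInstance I
  open Distances network
  open Sizes graph public

  num den : ℕ
  num = ℤ.∣ ↥ α ∣
  den = ↧ₙ α

  den≤num : den ≤ num
  den≤num = ratio-den≤num α≥1

  1≤num : 1 ≤ num
  1≤num = ≤-trans (s≤s z≤n) den≤num

  dist : Fin m → ℕ
  dist e = proj₁ (settles-itself e)

  dist-distance : ∀ e → Distance Subset.⊤ (src e) (tgt e) (dist e)
  dist-distance e = proj₁ (proj₂ (settles-itself e))

  dist≤ℓ : ∀ e → dist e ≤ ℓ e
  dist≤ℓ e = ≤-trans (distance-≤ (dist-distance e) (edge e) (in-⊤ (edge e))) (≤-reflexive (+-identityʳ (ℓ e)))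

  -- Lengths are integers, so a path settles the pair exactly if its length is at most this
  -- rounded-down bound.
  limit : Fin m → ℕ
  limit e = num * dist e / den

  limit⁺ : ∀ {e x} → x ≤[ α ]· dist e → x ≤ limit e
  limit⁺ {e} {x} p = subst (_≤ limit e) (m*n/n≡m x den) (/-monoˡ-≤ den (ratio-≤⁻ α≥1 p))

  limit-scaled : ∀ {e x} → x ≤ limit e → x * den ≤ num * dist e
  limit-scaled {e} p = ≤-trans (*-monoˡ-≤ den p) (m/n*n≤m (num * dist e) den)

  limit⁻ : ∀ {e x} → x ≤ limit e → x ≤[ α ]· dist e
  limit⁻ p = ratio-≤⁺ α≥1 (limit-scaled p)

  ℓ≤limit : ∀ e → ℓ e ≤ limit e
  ℓ≤limit e = limit⁺ (proj₂ (proj₂ (settles-itself e)))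

  limit≤ : ∀ e → limit e ≤ num * ℓ e
  limit≤ e = ≤-trans (≤-trans (m≤m*n (limit e) den) (limit-scaled {e} ≤-refl)) (*-monoʳ-≤ num (dist≤ℓ e))

  settling⁺ : ∀ {e} (P : Path (src e) (tgt e)) → length P ≤ limit e → Settling P
  settling⁺ {e} P l = dist e , dist-distance e , limit⁻ {e} l

  settling⁻ : ∀ {e} (P : Path (src e) (tgt e)) → Settling P → length P ≤ limit e
  settling⁻ {e} P (d , D , l) rewrite distance-unique D (dist-distance e) = limit⁺ {e} l

  -- Walks may stand in for paths, because shortcutting keeps to the same edges and does not add
  -- length.
  Settles : (Fin m → Set) → Fin m → Set
  Settles F e = ∃ λ (p : Walk (src e) (tgt e)) → All F (edges p) × len ℓ p ≤ limit e

  On : (Fin m → ℕ) → Fin m → Set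
  On f e = f e ≢ 0

  settles-⊆ : ∀ {F F′ : Fin m → Set} {e} → (∀ {x} → F x → F′ x) → Settles F e → Settles F′ e
  settles-⊆ h (p , a , l) = p , All.map h a , l

  -- Every edge of a shortest path is replaced by a walk that settles it. Multiplied by `den`, the
  -- bounds for the single edges add up.
  all-settled⇒spanner : ∀ {F} → (∀ e → Settles (Subset._∈ F) e) → IsSpanner F
  all-settled⇒spanner {F} h u v d ((P , _ , refl) , _) with stretch (walk P)
    where
    stretch-edge : ∀ {e u v} → Joins e u v → ∃ λ (p : Walk u v) → All (Subset._∈ F) (edges p) × len ℓ p * den ≤ num * ℓ e
    stretch-edge {e} j with h e
    ... | p , a , l with ≤-trans (limit-scaled {e} l) (*-monoʳ-≤ num (dist≤ℓ e))
    stretch-edge (inj₁ (refl , refl)) | p , a , _ | l = p , a , l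
    stretch-edge (inj₂ (refl , refl)) | p , a , _ | l = rev p , All-rev p a , subst (λ z → z * den ≤ _) (sym (len-rev ℓ p)) l
    stretch : ∀ {u v} (p : Walk u v) → ∃ λ (q : Walk u v) → All (Subset._∈ F) (edges q) × len ℓ q * den ≤ num * len ℓ p
    stretch stop = stop , [] , z≤n
    stretch (step e j p) with stretch-edge j | stretch p
    ... | q , a , l | q′ , a′ , l′ = q ⊕ q′ , All-⊕ q a a′ , (begin
      len ℓ (q ⊕ q′) * den            ≡⟨ cong (_* den) (len-⊕ ℓ q q′) ⟩
      (len ℓ q + len ℓ q′) * den      ≡⟨ *-distribʳ-+ den (len ℓ q) (len ℓ q′) ⟩
      len ℓ q * den + len ℓ q′ * den  ≤⟨ +-mono-≤ l l′ ⟩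
      num * ℓ e + num * len ℓ p       ≡⟨ *-distribˡ-+ num (ℓ e) (len ℓ p) ⟨
      num * (ℓ e + len ℓ p)           ∎)
      where open ≤-Reasoning
  ... | q , a , l with distance-exists F q a
  ...   | d′ , D , d′≤ = d′ , D , ratio-≤⁺ α≥1 (≤-trans (*-monoˡ-≤ den d′≤) l)

  spanner⇒settled : ∀ {F} → IsSpanner F → ∀ e → Settles (Subset._∈ F) e
  spanner⇒settled s e with s (src e) (tgt e) (dist e) (dist-distance e)
  ... | d , ((P , a , refl) , _) , l = walk P , a , limit⁺ {e} l

  mandatory⁺ : ∀ {e} → ¬ Settles (_≢ e) e → Mandatory e
  mandatory⁺ {e} refute (P , s , alt) = refute (walk P , All.tabulate (λ { x∈ refl → alt x∈ }) , settling⁻ P s)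

  mandatory⁻ : ∀ {e} → Settles (_≢ e) e → ¬ Mandatory e
  mandatory⁻ {e} (p , a , l) man with to-path p
  ... | P , i = man (P , settling⁺ P (≤-trans (len-≤ i ℓ) l) , λ e∈ → All.lookup (All-⊆ i a) e∈ refl)

  -- If `e` were missing, the path of the spanner that settles its ends would be alternative.
  mandatory-∈ : ∀ {e F} → Mandatory e → IsSpanner F → e Subset.∈ F
  mandatory-∈ {e} {F} man s with e SubsetP.∈? F
  ... | yes e∈ = e∈
  ... | no e∉  = contradiction man (mandatory⁻ (settles-⊆ (λ { x∈ refl → e∉ x∈ }) (spanner⇒settled s e)))

  wt : (Fin m → ℕ) → ℕ
  wt f = ∑ λ e → w e * ind (f e)

  wt-mono : ∀ {f g} → (∀ {e} → On f e → On g e) → wt f ≤ wt g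
  wt-mono {f} {g} f⊆g = ∑-mono λ e → *-monoʳ-≤ (w e) (ind-mono e)
    where
    ind-mono : ∀ e → ind (f e) ≤ ind (g e)
    ind-mono e with f e ≟ 0
    ... | yes eq rewrite eq = z≤n
    ... | no ne = ≤-trans (ind≤1 (f e)) (≤-reflexive (sym (ind-≢0 (f⊆g ne))))

  weight≡wt : ∀ f → weight (toSubset f) ≡ wt f
  weight≡wt f = ∑-cong λ e → trans (cong (if_then w e else 0) (lookup-toSubset f e)) (by (f e) (w e))
    where
    by : ∀ x y → (if flag x then y else 0) ≡ y * ind x
    by zero    y = sym (*-zeroʳ y)
    by (suc _) y = sym (*-identityʳ y)

  minus : (Fin m → ℕ) → (Fin m → ℕ) → Fin m → ℕ
  minus g f e = ind (g e) * (1 ∸ f e)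

  minus-on : ∀ {g f e} → On g e → f e ≡ 0 → minus g f e ≡ 1
  minus-on {g} {f} {e} ge fe rewrite fe | ind-≢0 ge = refl

  minus-off : ∀ {g f e} → On f e → minus g f e ≡ 0
  minus-off {g} {f} {e} fe with f e
  ... | zero  = contradiction refl fe
  ... | suc x = trans (cong (ind (g e) *_) (0∸n≡0 x)) (*-zeroʳ (ind (g e)))

  minus≢0 : ∀ {g f e} → minus g f e ≢ 0 → On g e × f e ≡ 0
  minus≢0 {g} {f} {e} ne with f e | g e
  ... | zero  | suc _ = (λ ()) , refl
  ... | zero  | zero  = contradiction refl ne
  ... | suc x | b     = contradiction (trans (cong (ind b *_) (0∸n≡0 x)) (*-zeroʳ (ind b))) ne

  minus≤1 : ∀ {g f e} → minus g f e ≤ 1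
  minus≤1 {g} {f} {e} = *-mono-≤ (ind≤1 (g e)) (m∸n≤m 1 (f e))

  TrivialFlags : (Fin m → ℕ) → Set
  TrivialFlags T = ∀ e → (T e ≢ 0 → Trivial e) × (T e ≡ 0 → Nontrivial e)

  -- The subproblem (f , r) of the search.
  Good : (Fin m → ℕ) → ℕ → Set
  Good f r = ∃ λ g → (∀ {e} → On f e → On g e) × (∀ e → Settles (On g) e) × wt g ≤ W × ∑ (minus g f) ≤ r

  good-resp : ∀ {f f′ r} → (∀ e → f e ≡ f′ e) → Good f r → Good f′ r
  good-resp eq (g , f⊆g , s , l , c) = g , (λ {e} ne → f⊆g (ne ∘ trans (sym (eq e)))) , s , l ,
    ≤-trans (≤-reflexive (∑-cong (λ e → cong (λ z → ind (g e) * (1 ∸ z)) (sym (eq e))))) c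

  good-weight : ∀ {f r} → Good f r → wt f ≤ W
  good-weight (g , f⊆g , _ , l , _) = ≤-trans (wt-mono f⊆g) l

  good-zero : ∀ {f} → Good f 0 → ∀ e → Settles (On f) e
  good-zero {f} (g , _ , s , _ , c) e = settles-⊆ g⊆f (s e)
    where
    g⊆f : ∀ {e} → On g e → On f e
    g⊆f {e} ge fe≡0 = contradiction (trans (sym (minus-on {g} {f} ge fe≡0)) (∑≡0 (minus g f) (n≤0⇒n≡0 c) e)) λ ()

  Adds : (f f′ : Fin m → ℕ) → Fin m → Set
  Adds f f′ e = f′ e ≢ 0 × (∀ x → x ≢ e → f′ x ≡ f x)

  -- The solution `g` settles `e₀` by a walk, and this walk contains a candidate. That edge belongs
  -- to `g` but not to `f`, so adding it leaves one edge fewer to be found for the same `g`.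
  good-branch : ∀ {f r e₀} {cand : Fin m → ℕ} → Good f (suc r) → (∀ {e} → cand e ≢ 0 → f e ≡ 0) →
    (∀ (p : Walk (src e₀) (tgt e₀)) → len ℓ p ≤ limit e₀ → ∃ λ e → e ∈ edges p × cand e ≢ 0) →
    ∃ λ e → cand e ≢ 0 × (∀ {f′} → Adds f f′ e → Good f′ r)
  good-branch {f} {r} {e₀} {cand} (g , f⊆g , s , l , c) new found with s e₀
  ... | p , a , l₀ with found p l₀
  ...   | e , e∈ , ce = e , ce , extend
    where
    ge = All.lookup a e∈
    extend : ∀ {f′} → Adds f f′ e → Good f′ r
    extend {f′} (f′e , same) = g , f′⊆g , s , l , ≤-pred (≤-trans (≤-reflexive count) c)
      where
      f′⊆g : ∀ {x} → On f′ x → On g x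
      f′⊆g {x} ne with x FinP.≟ e
      ... | yes refl = ge
      ... | no x≢e   = f⊆g (ne ∘ trans (same x x≢e))
      count : suc (∑ (minus g f′)) ≡ ∑ (minus g f)
      count = trans (+-comm 1 _) (trans (cong (∑ (minus g f′) +_) (sym (minus-on {g} {f} ge (new ce))))
        (trans (∑-exchange (minus g f′) (minus g f) e (λ x x≢e → cong (λ z → ind (g x) * (1 ∸ z)) (same x x≢e)))
        (trans (cong (∑ (minus g f) +_) (minus-off {g} {f′} f′e)) (+-identityʳ _))))

  module _ {T : Fin m → ℕ} (trivial : TrivialFlags T) where

    -- The counterpart of `Good`: it guarantees that edges spent and edges left stay within `μ`, so
    -- that whatever the search finds is a solution.
    Legal : (Fin m → ℕ) → ℕ → Set
    Legal f r = (∀ {e} → On T e → On f e) × ∑ (minus f T) + r ≤ μ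

    legal-resp : ∀ {f f′ r} → (∀ e → f e ≡ f′ e) → Legal f r → Legal f′ r
    legal-resp eq (T⊆f , c) = (λ {e} Te → T⊆f Te ∘ trans (eq e)) ,
      ≤-trans (≤-reflexive (cong (_+ _) (∑-cong (λ e → cong (λ z → ind z * (1 ∸ T e)) (sym (eq e)))))) c

    legal-root : Legal T μ
    legal-root = id , ≤-reflexive (cong (_+ μ) (trans (∑-cong zeros) (trans (∑-const {m} 0) (*-zeroʳ m))))
      where
      zeros : ∀ e → minus T T e ≡ 0
      zeros e with T e
      ... | zero  = refl
      ... | suc x = trans (cong (1 *_) (0∸n≡0 x)) refl

    legal-add : ∀ {f f′ r e} → Legal f (suc r) → Adds f f′ e → Legal f′ r
    legal-add {f} {f′} {r} {e} (T⊆f , c) (f′e , same) = T⊆f′ , ≤-trans (+-monoˡ-≤ r count)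
        (≤-trans (≤-reflexive (sym (+-suc (∑ (minus f T)) r))) c)
      where
      T⊆f′ : ∀ {x} → On T x → On f′ x
      T⊆f′ {x} Tx with x FinP.≟ e
      ... | yes refl = f′e
      ... | no x≢e   = T⊆f Tx ∘ trans (sym (same x x≢e))
      count : ∑ (minus f′ T) ≤ suc (∑ (minus f T))
      count = ≤-trans (m≤m+n _ (minus f T e))
        (≤-trans (≤-reflexive (∑-exchange (minus f′ T) (minus f T) e (λ x x≢e → cong (λ z → ind z * (1 ∸ T x)) (same x x≢e))))
        (≤-trans (+-monoʳ-≤ (∑ (minus f T)) (minus≤1 {f′} {T} {e})) (≤-reflexive (+-comm _ 1))))

    legal-solution : ∀ {f r} → Legal f r → (∀ e → Settles (On f) e) → wt f ≤ W → Solvable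
    legal-solution {f} {r} (T⊆f , c) s l = toSubset f ,
      all-settled⇒spanner (λ e → settles-⊆ (∈-toSubset⁺ f) (s e)) ,
      subst (_≤ W) (sym (weight≡wt f)) l ,
      ∑ (minus f T) , (toSubset (minus f T) , members , count) , ≤-trans (m≤m+n _ r) c
      where
      members : ∀ e → _
      members e = mk⇔
        (λ e∈ → let fe , Te = minus≢0 {f} {T} (∈-toSubset⁻ (minus f T) e∈)
                in ∈-toSubset⁺ f fe , proj₂ (trivial e) Te)
        (λ { (e∈ , nt) → ∈-toSubset⁺ (minus f T)
               (λ z → contradiction (trans (sym (minus-on {f} {T} (∈-toSubset⁻ f e∈) (decidable-stable (T e ≟ 0) (λ ne → nt (proj₁ (trivial e) ne))))) z) λ ()) })
      count : ∣ toSubset (minus f T) ∣ ≡ ∑ (minus f T)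
      count = trans (∣toSubset∣ (minus f T)) (∑-cong λ e → ≤1⇒ind (minus≤1 {f} {T} {e}))

    -- Joining all trivial edges to a solution does not change its weight: the mandatory ones are in
    -- it already, the others weigh nothing. Nor does it add nontrivial edges.
    good-root : Solvable → Good T μ
    good-root (F , sp , l , k , (S , members , refl) , k≤μ) = g ,
      (λ {e} Te z → Te (m+n≡0⇒n≡0 (flags F e) z)) ,
      (λ e → settles-⊆ (λ e∈ z → ∈⇒flags≢0 e∈ (m+n≡0⇒m≡0 _ z)) (spanner⇒settled sp e)) ,
      ≤-trans (≤-reflexive (∑-cong weights)) l , ≤-trans count k≤μ
      where
      g : Fin m → ℕ
      g e = flags F e + T e
      weights : ∀ e → w e * ind (g e) ≡ (if lookup F e then w e else 0)
      weights e with lookup F e in eq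
      ... | true  = *-identityʳ (w e)
      ... | false with T e in eqT
      ...   | zero  = *-zeroʳ (w e)
      ...   | suc t with proj₁ (trivial e) (λ z → contradiction (trans (sym eqT) z) λ ())
      ...     | inj₂ w≡0 = trans (*-identityʳ (w e)) w≡0
      ...     | inj₁ man with trans (sym (VecP.[]=⇒lookup (mandatory-∈ man sp))) eq
      ...       | ()
      ones : ∀ e → minus g T e ≡ ind (minus g T e)
      ones e = sym (≤1⇒ind (minus≤1 {g} {T} {e}))
      sub : ∀ {e} → e ∈ support (minus g T) → e ∈ elements S
      sub {e} e∈ with minus≢0 {g} {T} (∈-support⁻ (minus g T) e∈)
      ... | ge , Te = ∈-elements S (Equivalence.from (members e)
              (flags≢0⇒∈ (λ z → ge (cong₂ _+_ z Te)) , proj₂ (trivial e) Te))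
      count : ∑ (minus g T) ≤ ∣ S ∣
      count = ≤-trans (≤-reflexive (trans (∑-cong ones) (sym (length-support (minus g T)))))
        (≤-trans (unique-⊆-length (support-unique (minus g T)) sub) (≤-reflexive (length-elements S)))

    -- A settling path of trivial edges would lie in `f`, which contains them all.
    unsettled-critical : ∀ {f e} → (∀ {x} → On T x → On f x) → ¬ Settles (On f) e → Critical e
    unsettled-critical {f} {e} T⊆f refute (P , s , a) = refute (walk P ,
      All.map (λ {x} tr → T⊆f (λ Tx → proj₂ (trivial x) Tx tr)) a , settling⁻ P s)

  -- The bound `h` applies to a set only once its cardinality is exhibited, which presupposes a
  -- decision for every vertex. The double negation makes such a decision available.
  visited-list : ∀ {h e} → LocalNeighborhoodSize h → Critical e →
                 ¬ ¬ ∃ λ xs → List.length xs ≤ h × (∀ {x} → Visited e x → x ∈ xs)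
  visited-list {h} {e} (bound , _) crit refute = ¬¬-dec-all λ d → refute (elements (V d) ,
    ≤-trans (≤-reflexive (length-elements (V d))) (bound e _ crit (V d , members d , refl)) ,
    λ {x} v → ∈-elements (V d) (Equivalence.from (members d x) v))
    where
    pick : ∀ {x} → Dec (Visited e x) → ℕ
    pick (yes _) = 1
    pick (no _)  = 0
    pick⁺ : ∀ {x} (d : Dec (Visited e x)) → Visited e x → pick d ≢ 0
    pick⁺ (yes _) _ ()
    pick⁺ (no ¬v) v = contradiction v ¬v
    pick⁻ : ∀ {x} (d : Dec (Visited e x)) → pick d ≢ 0 → Visited e x
    pick⁻ (yes v) _ = v
    pick⁻ (no _) ne = contradiction refl ne
    V : (∀ x → Dec (Visited e x)) → Subset n
    V d = toSubset (λ x → pick (d x))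
    members : ∀ d x → x Subset.∈ V d ⇔ Visited e x
    members d x = mk⇔ (λ x∈ → pick⁻ (d x) (∈-toSubset⁻ (λ x → pick (d x)) x∈))
                      (λ v → ∈-toSubset⁺ (λ x → pick (d x)) (pick⁺ (d x) v))

  -- The edge settles itself, so both of its distinct ends are visited. Branching degrees of at
  -- least 2 make the search tree a geometric sum.
  critical-h≥2 : ∀ {h e} → LocalNeighborhoodSize h → Critical e → 2 ≤ h
  critical-h≥2 {h} {e} lns crit with to-path (edge e)
  ... | P , i = decidable-stable (2 ≤? h) λ refute → visited-list lns crit λ { (vs , l , all) →
    refute (≤-trans (unique-⊆-length {xs = src e ∷ tgt e ∷ []} ((loopless e ∷ []) ∷ [] ∷ [])
      (λ { (here refl) → all (P , settling⁺ P short , start-∈ (walk P))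
         ; (there (here refl)) → all (P , settling⁺ P short , end-∈ (walk P)) })) l) }
    where short = ≤-trans (len-≤ i ℓ) (≤-trans (≤-reflexive (+-identityʳ (ℓ e))) (ℓ≤limit e))

  candidates-≤ : ∀ {h e} (cand : Fin m → ℕ) → LocalNeighborhoodSize h → Critical e →
    (∀ {x} → cand x ≢ 0 → Visited e (src x) × Visited e (tgt x)) → ∑ (ind ∘ cand) ≤ h * h
  candidates-≤ {h} {e} cand lns crit vis = decidable-stable (∑ (ind ∘ cand) ≤? h * h) λ refute →
    visited-list lns crit λ { (vs , l , all) → refute (≤-trans (≤-reflexive (sym (length-support cand)))
      (≤-trans (edges-among (support cand) vs (support-unique cand)
          (λ x∈ → let p , q = vis (∈-support⁻ cand x∈) in all p , all q))
        (*-mono-≤ l l))) }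

-- Dijkstra's algorithm

anyBelow : ℕ → (ℕ → Bool) → Bool
anyBelow zero    f = false
anyBelow (suc k) f = f k ∨ anyBelow k f

below : ∀ k f → anyBelow k f ≡ false → ∀ x → x < k → f x ≡ false
below (suc k) f p x (s≤s x≤k) with x ≟ k
... | yes refl = ∨-falseˡ p
... | no x≢k   = below k f (∨-falseʳ {f k} p) x (≤∧≢⇒< x≤k x≢k)

cellExp : Exp → Exp → Exp
cellExp a b = bin plus (bin times a (var 0)) b

minExp maxExp : Exp → Exp → Exp
minExp a b = bin monus a (bin monus a b)
maxExp a b = bin plus a (bin monus b a)

m∸[m∸n]≡m⊓n : ∀ m n → m ∸ (m ∸ n) ≡ m ⊓ n
m∸[m∸n]≡m⊓n m n with ≤-total m n
... | inj₁ m≤n = trans (cong (m ∸_) (m≤n⇒m∸n≡0 m≤n)) (sym (m≤n⇒m⊓n≡m m≤n))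
... | inj₂ n≤m = trans (m∸[m∸n]≡n n≤m) (sym (m≥n⇒m⊓n≡n n≤m))

m+[n∸m]≡m⊔n : ∀ m n → m + (n ∸ m) ≡ m ⊔ n
m+[n∸m]≡m⊔n m n with ≤-total m n
... | inj₁ m≤n = trans (m+[n∸m]≡n m≤n) (sym (m≤n⇒m⊔n≡n m≤n))
... | inj₂ n≤m = trans (cong (m +_) (m≤n⇒m∸n≡0 n≤m)) (trans (+-identityʳ m) (sym (m≥n⇒m⊔n≡m n≤m)))

-- Memory map of the solver.  Registers: 0 – 5 the input, 6 a length exceeding all bounds
-- (big), 7 n², 8 and 9 target and its time for the latest departures, 10, 11 and 14 loop
-- counters, 12 and 13 the vertex to settle and its key, 15 unsettled edge, 16 answer,
-- 17 stack height, 18 remaining edges, 19 weight, 20 start of a row of the stack.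
-- Arrays: 0 – 3 the input, 4 usable edges, 5 length matrix, 6 latest departures,
-- 7 unsettled vertices, 8 deadlines, 9 length bounds of settling paths, 10 trivial edges,
-- 11 current edge set, 12 stacked edge sets (row by row), 13 stacked numbers of
-- remaining edges.  The APSP program uses the registers and arrays from 32 on.
matrix : Cmd
matrix = fill 5 10 7 (var 10) (var 6) ⨾
  for 10 1 (cond (get 4 (var 10))
    (put 5 (cellExp (get 0 (var 10)) (get 1 (var 10))) (get 2 (var 10)) ⨾
     put 5 (cellExp (get 1 (var 10)) (get 0 (var 10))) (get 2 (var 10)))
    skip)

-- The flags in array 7 are at most 1, so the guard holds exactly for open vertices whose value is
-- at least the current key. Ties count, so that an open vertex is chosen even when all values are
-- 0.
pick : Cmd
pick = 13 ≔ lit 0 ⨾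
  for 10 0 (cond (bin monus (get 7 (var 10)) (bin monus (var 13) (get 6 (var 10))))
    (12 ≔ var 10 ⨾ 13 ≔ get 6 (var 10))
    skip)

-- The key of the settled vertex comes from register 13, so the only cell of array 6 that is read is
-- the one about to be overwritten.
relayExp : Exp
relayExp = maxExp (get 6 (var 10))
  (minExp (get 8 (var 10)) (bin monus (var 13) (get 5 (cellExp (var 12) (var 10)))))

settle : Cmd
settle = put 7 (var 12) (lit 0) ⨾ fill 6 10 0 (var 10) relayExp

dijkstra : Cmd
dijkstra = fill 6 10 0 (var 10) (lit 0) ⨾ fill 7 10 0 (var 10) (lit 1) ⨾ put 6 (var 8) (var 9) ⨾
  for 11 0 (pick ⨾ settle)

departures : Cmd
departures = matrix ⨾ dijkstra

-- Correctness and cost of Dijkstra's algorithm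

module Machine (I : SpannerInstance) (B : ℕ) where
  open SpannerInstance I
  open SpannerTheory I
  open Distances network

  big : ℕ
  big = suc (num * ∑ ℓ)

  -- `big+big≤` is for the sums in `trivialExp` and `candidateExp`. `stack≤` leaves room for rows 0
  -- to `μ * m` of `m` cells each.
  record Room : Set where
    field
      big+big≤ : big + big ≤ B
      n²≤      : n * n ≤ B
      ∑w≤      : ∑ w ≤ B
      stack≤   : suc (μ * m) * m + m ≤ B

  ℓ<big : ∀ e → ℓ e < big
  ℓ<big e = s≤s (≤-trans (∑-≤ ℓ e) (≤-trans (≤-reflexive (sym (*-identityˡ _))) (*-monoˡ-≤ (∑ ℓ) 1≤num)))

  limit<big : ∀ e → limit e < big
  limit<big e = s≤s (≤-trans (limit≤ e) (*-monoʳ-≤ num (∑-≤ ℓ e)))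

  opaque
    -- The cost of one pass over the adjacency matrix and the edges.
    pass : ℕ
    pass = suc n * suc n + m

    pass≡ : pass ≡ suc n * suc n + m
    pass≡ = refl

    1≤pass : 1 ≤ pass
    1≤pass = s≤s z≤n

    n≤pass : n ≤ pass
    n≤pass = ≤-trans (≤-trans (n≤1+n n) (m≤m*n (suc n) (suc n))) (m≤m+n _ m)

    n²≤pass : n * n ≤ pass
    n²≤pass = ≤-trans (*-mono-≤ (n≤1+n n) (n≤1+n n)) (m≤m+n _ m)

    m≤pass : m ≤ pass
    m≤pass = m≤n+m m _

    n[n+1]≤pass : n * suc n ≤ pass
    n[n+1]≤pass = ≤-trans (*-monoˡ-≤ (suc n) (n≤1+n n)) (m≤m+n _ m)

  record Env (s : State) : Set where
    field
      r0 : reg s 0 ≡ n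
      r1 : reg s 1 ≡ m
      r2 : reg s 2 ≡ num
      r3 : reg s 3 ≡ den
      r4 : reg s 4 ≡ W
      r5 : reg s 5 ≡ μ
      a0 : ∀ e → arr s 0 (toℕ e) ≡ toℕ (src e)
      a1 : ∀ e → arr s 1 (toℕ e) ≡ toℕ (tgt e)
      a2 : ∀ e → arr s 2 (toℕ e) ≡ ℓ e
      a3 : ∀ e → arr s 3 (toℕ e) ≡ w e

  record Env₁ (s : State) : Set where
    field
      env : Env s
      r6  : reg s 6 ≡ big
      r7  : reg s 7 ≡ n * n
    open Env env public

  env-keep : ∀ {c s s′} → anyBelow 6 (writesReg c) ≡ false → anyBelow 4 (writesArr c) ≡ false →
             Agree c s s′ → Env s → Env s′
  env-keep {c} {s} {s′} kr ka ag E = record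
    { r0 = R 0 tt r0 ; r1 = R 1 tt r1 ; r2 = R 2 tt r2 ; r3 = R 3 tt r3 ; r4 = R 4 tt r4 ; r5 = R 5 tt r5
    ; a0 = A 0 tt a0 ; a1 = A 1 tt a1 ; a2 = A 2 tt a2 ; a3 = A 3 tt a3 }
    where
    open Env E
    R : ∀ x {v} → T (x <ᵇ 6) → reg s x ≡ v → reg s′ x ≡ v
    R x lt = trans (onReg ag x (below 6 (writesReg c) kr x (<ᵇ⇒< x 6 lt)))
    A : ∀ a {v : Fin m → ℕ} → T (a <ᵇ 4) → (∀ e → arr s a (toℕ e) ≡ v e) → ∀ e → arr s′ a (toℕ e) ≡ v e
    A a lt h e = trans (cong (λ f → f _) (onArr ag a (below 4 (writesArr c) ka a (<ᵇ⇒< a 4 lt)))) (h e)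

  env₁-keep : ∀ {c s s′} → anyBelow 8 (writesReg c) ≡ false → anyBelow 4 (writesArr c) ≡ false →
              Agree c s s′ → Env₁ s → Env₁ s′
  env₁-keep {c} {s} {s′} kr ka ag E = record
    { env = env-keep (∨-falseʳ {writesReg c 6} (∨-falseʳ {writesReg c 7} kr)) ka ag env
    ; r6 = trans (onReg ag 6 (below 8 (writesReg c) kr 6 (<ᵇ⇒< 6 8 tt))) r6
    ; r7 = trans (onReg ag 7 (below 8 (writesReg c) kr 7 (<ᵇ⇒< 7 8 tt))) r7 }
    where open Env₁ E

  module Routines (room : Room) where
    open Room room

    big≤B : big ≤ B
    big≤B = ≤-trans (m≤m+n big big) big+big≤

    1≤B : 1 ≤ B
    1≤B = ≤-trans (s≤s z≤n) big≤B

    cell-ok : ∀ {a b s} {u v : Fin n} → reg s 0 ≡ n → Small B a s → Small B b s → eval a s ≡ toℕ u → eval b s ≡ toℕ v →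
              Small B (cellExp a b) s × eval (cellExp a b) s ≡ cell u v
    cell-ok {a} {b} {s} {u} {v} r0 sa sb ea eb =
      ((sa , tt , subst (_≤ B) (sym prod) (≤-trans (m≤m+n _ (toℕ v)) cell≤)) , sb , subst (_≤ B) (sym val) cell≤) , val
      where
      cell≤ = ≤-trans (<⇒≤ (cell<n*n u v)) n²≤
      prod : eval a s * reg s 0 ≡ toℕ u * n
      prod = cong₂ _*_ ea r0
      val = cong₂ _+_ prod eb

    Adjacency : (Fin m → ℕ) → (Fin n → Fin n → ℕ) → Set
    Adjacency g mat =
        (∀ z y → mat z y ≡ big ⊎ ∃ λ e → g e ≢ 0 × Joins e y z × mat z y ≡ ℓ e)
      × (∀ {e z y} → g e ≢ 0 → Joins e y z → mat z y ≡ ℓ e)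

    -- 17 for clearing the matrix and 38 for the loop over the edges.
    matrixTime : ℕ
    matrixTime = 55

    matrix-ok : ∀ {s} → Bounded B s → Env₁ s →
      Runs B matrix s (matrixTime * pass) (λ s′ → Adjacency (λ e → arr s 4 (toℕ e)) (λ z y → arr s′ 5 (cell z y)))
    matrix-ok {s} b E = runs-mono (bound time≤) id
      ((fill-rule 0 (λ _ → big) refl 1≤B b r7 (λ k {s′} b′ ag ri _ →
          proj₁ b′ 10 , proj₁ b′ 6 , ri , trans (onReg ag 6 refl) r6)
        ⟫ λ { {s₁} _ ag (bigs , _) b₁ → runs-mono ≤-refl (λ { (p , q) → p , λ ge j → q _ (toℕ<n _) ge j }) (loop₂ ag bigs b₁) }) b)
      where
      open Env₁ E
      g : Fin m → ℕ
      g e = arr s 4 (toℕ e)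
      Inv : ℕ → State → Set
      Inv k s′ = (∀ z y → arr s′ 5 (cell z y) ≡ big ⊎ ∃ λ e → g e ≢ 0 × Joins e y z × arr s′ 5 (cell z y) ≡ ℓ e)
               × (∀ e → toℕ e < k → ∀ {z y} → g e ≢ 0 → Joins e y z → arr s′ 5 (cell z y) ≡ ℓ e)
      written : ∀ (f : ℕ → ℕ) e v z y →
        let f′ = (f [ cell (src e) (tgt e) ↦ v ]) [ cell (tgt e) (src e) ↦ v ] in
        (Joins e y z × f′ (cell z y) ≡ v) ⊎ (¬ Joins e y z × f′ (cell z y) ≡ f (cell z y))
      written f e v z y with Joins? e y z
      ... | yes j@(inj₁ (refl , refl)) = inj₁ (j , update-hit (f [ cell (src e) (tgt e) ↦ v ]) (cell (tgt e) (src e)) v)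
      ... | yes j@(inj₂ (refl , refl)) = inj₁ (j , update-elim (_≡ v) (f [ cell (src e) (tgt e) ↦ v ])
              (cell (tgt e) (src e)) v (cell (src e) (tgt e)) (λ _ → refl) (λ _ → update-hit f (cell (src e) (tgt e)) v))
      ... | no ¬j = inj₂ (¬j , trans
              (update-miss (f [ cell (src e) (tgt e) ↦ v ]) v (λ eq → ¬j (inj₁ (let p , q = cell-injective _ _ z y eq in q , p))))
              (update-miss f v (λ eq → ¬j (inj₂ (cell-injective _ _ z y eq)))))
      body : ∀ (k : Fin m) {s′} → Bounded B s′ → Env₁ s′ → arr s′ 4 ≡ arr s 4 → reg s′ 10 ≡ toℕ k → Inv (toℕ k) s′ → Runs B _ s′ _ _
      body k {s′} b′ E′ a4 ri (far , near) = runs-cond {T₁ = 20} {T₂ = 1} (small-fits (get 4 (var 10)) b′ tt)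
        (λ ne → runs (seq put₁ put₂) (≤ᵇ⇒≤ _ _ tt) (flagged (ne ∘ trans val4)))
        (λ eq → runs skip ≤-refl (far , unflagged (trans (sym val4) eq)))
        where
        module E′ = Env₁ E′
        val4 : arr s′ 4 (reg s′ 10) ≡ g k
        val4 = cong-at a4 ri
        v0 : arr s′ 0 (reg s′ 10) ≡ toℕ (src k)
        v0 = trans (cong (arr s′ 0) ri) (E′.a0 k)
        v1 : arr s′ 1 (reg s′ 10) ≡ toℕ (tgt k)
        v1 = trans (cong (arr s′ 1) ri) (E′.a1 k)
        v2 : arr s′ 2 (reg s′ 10) ≡ ℓ k
        v2 = trans (cong (arr s′ 2) ri) (E′.a2 k)
        ix₁ = cellExp (get 0 (var 10)) (get 1 (var 10))
        ix₂ = cellExp (get 1 (var 10)) (get 0 (var 10))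
        c₁ = cell-ok {get 0 (var 10)} {get 1 (var 10)} {s′} E′.r0 tt tt v0 v1
        s₁ = setArr s′ 5 (eval ix₁ s′) (arr s′ 2 (reg s′ 10))
        put₁ : B ⊢ put 5 ix₁ (get 2 (var 10)) , s′ ⇓[ _ ] s₁
        put₁ = put (small-fits ix₁ b′ (proj₁ c₁)) (small-fits (get 2 (var 10)) b′ tt)
        b₁ = run-bounded put₁ b′
        c₂ = cell-ok {get 1 (var 10)} {get 0 (var 10)} {s₁} E′.r0 tt tt v1 v0
        put₂ : B ⊢ put 5 ix₂ (get 2 (var 10)) , s₁ ⇓[ _ ] setArr s₁ 5 (eval ix₂ s₁) (arr s₁ 2 (reg s₁ 10))
        put₂ = put (small-fits ix₂ b₁ (proj₁ c₂)) (small-fits (get 2 (var 10)) b₁ tt)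
        f′ : ℕ → ℕ
        f′ = (arr s′ 5 [ eval ix₁ s′ ↦ arr s′ 2 (reg s′ 10) ]) [ eval ix₂ s′ ↦ arr s′ 2 (reg s′ 10) ]
        f′≡ : ∀ x → f′ x ≡ ((arr s′ 5 [ cell (src k) (tgt k) ↦ ℓ k ]) [ cell (tgt k) (src k) ↦ ℓ k ]) x
        f′≡ x = trans (cong₂ (λ i j → ((arr s′ 5 [ i ↦ arr s′ 2 (reg s′ 10) ]) [ j ↦ arr s′ 2 (reg s′ 10) ]) x) (proj₂ c₁) (proj₂ c₂))
                      (cong (λ v → ((arr s′ 5 [ cell (src k) (tgt k) ↦ v ]) [ cell (tgt k) (src k) ↦ v ]) x) v2)
        flagged : g k ≢ 0 →
          (∀ z y → f′ (cell z y) ≡ big ⊎ ∃ λ e → g e ≢ 0 × Joins e y z × f′ (cell z y) ≡ ℓ e)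
          × (∀ e → toℕ e < suc (toℕ k) → ∀ {z y} → g e ≢ 0 → Joins e y z → f′ (cell z y) ≡ ℓ e)
        flagged gk = far′ , near′
          where
          far′ : ∀ z y → f′ (cell z y) ≡ big ⊎ ∃ λ e → g e ≢ 0 × Joins e y z × f′ (cell z y) ≡ ℓ e
          far′ z y with written (arr s′ 5) k (ℓ k) z y
          ... | inj₁ (j , eq) = inj₂ (k , gk , j , trans (f′≡ _) eq)
          ... | inj₂ (_ , eq) with far z y
          ...   | inj₁ eq′ = inj₁ (trans (f′≡ _) (trans eq eq′))
          ...   | inj₂ (e , ge , j , eq′) = inj₂ (e , ge , j , trans (f′≡ _) (trans eq eq′))
          near′ : ∀ e → toℕ e < suc (toℕ k) → ∀ {z y} → g e ≢ 0 → Joins e y z → f′ (cell z y) ≡ ℓ e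
          near′ e (s≤s e≤k) {z} {y} ge j with written (arr s′ 5) k (ℓ k) z y
          ... | inj₁ (j′ , eq) = trans (f′≡ _) (trans eq (cong ℓ (same-ends j′ j)))
          ... | inj₂ (¬j , eq) = trans (f′≡ _) (trans eq (near e (≤∧≢⇒< e≤k (λ q → ¬j (subst (λ x → Joins x y z) (toℕ-injective q) j))) ge j))
        unflagged : g k ≡ 0 → ∀ e → toℕ e < suc (toℕ k) → ∀ {z y} → g e ≢ 0 → Joins e y z → arr s′ 5 (cell z y) ≡ ℓ e
        unflagged gk e (s≤s e≤k) ge = near e (≤∧≢⇒< e≤k (λ q → ge (trans (cong g (toℕ-injective q)) gk))) ge
      loop₂ : ∀ {s₁} → Agree (fill 5 10 7 (var 10) (var 6)) s s₁ → (∀ (k : Fin (n * n)) → arr s₁ 5 (toℕ k) ≡ big) → Bounded B s₁ →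
              Runs B _ s₁ (6 + (8 * m + m * 24)) (Inv m)
      loop₂ {s₁} ag bigs b₁ = for-uniform Inv 24 refl refl refl 1≤B b₁ (Env₁.r1 E₁)
        ((λ z y → inj₁ (trans (cong (arr s₁ 5) (sym (toℕ-fromℕ< (cell<n*n z y)))) (bigs (fromℕ< (cell<n*n z y))))) , (λ _ ()))
        (λ k b′ ag′ ri inv → body k b′ (env₁-keep refl refl ag′ E₁″)
           (trans (onArr ag′ 4 refl) (onArr ag 4 refl)) ri inv)
        where
        E₁ = env₁-keep refl refl ag E
        E₁″ : Env₁ (setReg s₁ 10 0)
        E₁″ = env₁-keep {10 ≔ lit 0} refl refl (run-agree {B} (assign {x = 10} {lit 0} {s₁} z≤n)) E₁
      time≤ : (fillTime (var 10) (var 6) (n * n) + (6 + (8 * m + m * 24))) ≲ matrixTime · pass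
      time≤ = flat-loop-≲ 1≤pass n²≤pass ⊞ flat-loop-≲ 1≤pass m≤pass

    Best : (M U : Fin n → ℕ) → State → Set
    Best M U s = ∃ λ b → reg s 12 ≡ toℕ b × U b ≢ 0 × reg s 13 ≡ M b × (∀ y → U y ≢ 0 → M y ≤ M b)

    pick-ok : ∀ {s} → Bounded B s → Env₁ s → let M = λ y → arr s 6 (toℕ {n} y); U = λ y → arr s 7 (toℕ {n} y) in
      (∀ y → U y ≤ 1) → (∃ λ y → U y ≢ 0) → Runs B pick s (2 + (6 + (8 * n + n * 14))) (Best M U)
    pick-ok {s} b E U≤1 (y₀ , Uy₀) =
      (assign-run z≤n ⟫ λ { _ ag refl b₁ →
        runs-mono ≤-refl (λ {s′} → finish {s′}) (for-uniform Inv 14 refl refl refl 1≤B b₁ r0 ((λ _ ()) , inj₁ refl)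
          (λ k b′ ag′ ri inv → body k b′ (onArr ag′ 6 refl) (onArr ag′ 7 refl) ri inv)) }) b
      where
      open Env₁ E
      M U : Fin n → ℕ
      M y = arr s 6 (toℕ y)
      U y = arr s 7 (toℕ y)
      Is : State → Set
      Is s′ = ∃ λ b → reg s′ 12 ≡ toℕ b × U b ≢ 0 × reg s′ 13 ≡ M b
      Inv : ℕ → State → Set
      Inv k s′ = (∀ y → toℕ y < k → U y ≢ 0 → M y ≤ reg s′ 13 × Is s′) × (reg s′ 13 ≡ 0 ⊎ Is s′)
      body : ∀ (k : Fin n) {s′} → Bounded B s′ → arr s′ 6 ≡ arr s 6 → arr s′ 7 ≡ arr s 7 → reg s′ 10 ≡ toℕ k → Inv (toℕ k) s′ → Runs B _ s′ _ _
      body k {s′} b′ a6 a7 ri (all , is) = runs-cond {T₁ = 5} {T₂ = 1} (small-fits guard b′ _)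
        (λ ne → runs (seq p₁ p₂) (≤ᵇ⇒≤ _ _ tt) (taken ne))
        (λ eq → runs skip ≤-refl ((λ y y< Uy → kept eq y y< Uy) , is))
        where
        guard = bin monus (get 7 (var 10)) (bin monus (var 13) (get 6 (var 10)))
        v6 : arr s′ 6 (reg s′ 10) ≡ M k
        v6 = cong-at a6 ri
        guard≡ : eval guard s′ ≡ U k ∸ (reg s′ 13 ∸ M k)
        guard≡ = cong₂ (λ x y → x ∸ (reg s′ 13 ∸ y)) (cong-at a7 ri) v6
        s₁ = setReg s′ 12 (reg s′ 10)
        p₁ : B ⊢ 12 ≔ var 10 , s′ ⇓[ 2 ] s₁
        p₁ = assign (proj₁ b′ 10)
        s₂ = setReg s₁ 13 (arr s′ 6 (reg s′ 10))
        p₂ : B ⊢ 13 ≔ get 6 (var 10) , s₁ ⇓[ 3 ] s₂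
        p₂ = assign (small-fits (get 6 (var 10)) (run-bounded p₁ b′) tt)
        taken : eval guard s′ ≢ 0 → Inv (suc (toℕ k)) (setReg s₂ 10 (suc (toℕ k)))
        taken ne = (λ y y< Uy → bigger y y< Uy , now) , inj₂ now
          where
          Uk : U k ≢ 0
          Uk z = ne (trans guard≡ (trans (cong (_∸ (reg s′ 13 ∸ M k)) z) (0∸n≡0 (reg s′ 13 ∸ M k))))
          val≤ : reg s′ 13 ≤ M k
          val≤ = m∸n≡0⇒m≤n (n≤0⇒n≡0 (≤-pred (≤-trans (m∸n≢0⇒n<m (ne ∘ trans guard≡)) (U≤1 k))))
          now : Is (setReg s₂ 10 (suc (toℕ k)))
          now = k , ri , Uk , v6
          bigger : ∀ y → toℕ y < suc (toℕ k) → U y ≢ 0 → M y ≤ arr s′ 6 (reg s′ 10)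
          bigger y (s≤s y≤k) Uy with toℕ y ≟ toℕ k
          ... | yes eq = ≤-reflexive (trans (cong M (toℕ-injective eq)) (sym v6))
          ... | no ne′ = ≤-trans (proj₁ (all y (≤∧≢⇒< y≤k ne′) Uy)) (≤-trans val≤ (≤-reflexive (sym v6)))
        kept : eval guard s′ ≡ 0 → ∀ y → toℕ y < suc (toℕ k) → U y ≢ 0 → M y ≤ reg s′ 13 × Is s′
        kept eq y (s≤s y≤k) Uy with toℕ y ≟ toℕ k
        ... | no ne = all y (≤∧≢⇒< y≤k ne) Uy
        ... | yes eq′ with toℕ-injective eq′
        -- A key above `M k` is positive, so some vertex has been chosen before.
        ...   | refl = <⇒≤ M<val , [ (λ z → contradiction (≤-trans M<val (≤-reflexive z)) λ ()) , id ]′ is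
          where
          M<val : M k < reg s′ 13
          M<val = m∸n≢0⇒n<m (λ z → Uy (n≤0⇒n≡0 (≤-trans (m∸n≡0⇒m≤n (trans (sym guard≡) eq)) (≤-reflexive z))))
      finish : ∀ {s′} → Inv n s′ → Best M U s′
      finish (all , _) with proj₂ (all y₀ (toℕ<n y₀) Uy₀)
      ... | b , rb , Ub , val = b , rb , Ub , val , λ y Uy → ≤-trans (proj₁ (all y (toℕ<n y) Uy)) (≤-reflexive val)

    settle-ok : ∀ {s} → Bounded B s → Env₁ s → ∀ b → reg s 12 ≡ toℕ b → reg s 13 ≡ arr s 6 (toℕ b) →
      Runs B settle s (3 + fillTime (var 10) relayExp n) (λ s′ →
          (∀ (y : Fin n) → arr s′ 6 (toℕ y) ≡ relay (arr s 6 (toℕ y)) (arr s 8 (toℕ y)) (arr s 6 (toℕ b)) (arr s 5 (cell b y)))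
        × (arr s′ 7 (toℕ b) ≡ 0) × (∀ (y : Fin n) → y ≢ b → arr s′ 7 (toℕ y) ≡ arr s 7 (toℕ y)))
    settle-ok {s} bd E b rb rv =
      (put-run (proj₁ bd 12) z≤n ⟫ λ { _ _ refl b₁ →
        with-agree
          (λ ag (p , _) → p ,
            trans (keptAt ag 7 refl (toℕ b)) (trans (cong (λ i → (arr s 7 [ i ↦ 0 ]) (toℕ b)) rb) (update-hit (arr s 7) (toℕ b) 0)) ,
            λ y y≢b → trans (keptAt ag 7 refl (toℕ y)) (trans (cong (λ i → (arr s 7 [ i ↦ 0 ]) (toℕ y)) rb)
              (update-miss (arr s 7) 0 (λ eq → y≢b (sym (toℕ-injective eq))))))
          (fill-rule 0 g refl 1≤B b₁ r0 relays) }) bd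
      where
      open Env₁ E
      g : Fin n → ℕ
      g y = relay (arr s 6 (toℕ y)) (arr s 8 (toℕ y)) (arr s 6 (toℕ b)) (arr s 5 (cell b y))
      s₁ = setArr s 7 (reg s 12) 0
      relays : ∀ (k : Fin n) {s′} → Bounded B s′ → Agree (put 6 (var 10) relayExp ⨾ 10 ≔ bin plus (var 10) (lit 1)) (setReg s₁ 10 0) s′ →
        reg s′ 10 ≡ toℕ k → arr s′ 6 (toℕ k) ≡ arr s 6 (toℕ k) →
        Fits B (var 10) s′ × Fits B relayExp s′ × reg s′ 10 ≡ toℕ k × eval relayExp s′ ≡ g k
      relays k {s′} b′ ag ri old = proj₁ b′ 10 , small-fits relayExp b′ (tt , small , max≤) , ri , val
        where
        ix = cellExp (var 12) (var 10)
        c = cell-ok {var 12} {var 10} {s′} {b} {k} (trans (onReg ag 0 refl) r0) tt tt (trans (onReg ag 12 refl) rb) ri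
        a6 = get 6 (var 10)
        m₀ = minExp (get 8 (var 10)) (bin monus (var 13) (get 5 ix))
        v6 : eval a6 s′ ≡ arr s 6 (toℕ k)
        v6 = trans (cong (arr s′ 6) ri) old
        vm : eval m₀ s′ ≡ arr s 8 (toℕ k) ⊓ (arr s 6 (toℕ b) ∸ arr s 5 (cell b k))
        vm = trans (m∸[m∸n]≡m⊓n (arr s′ 8 (reg s′ 10)) (reg s′ 13 ∸ arr s′ 5 (eval ix s′)))
          (cong₂ _⊓_ (cong-at (onArr ag 8 refl) ri)
            (cong₂ _∸_ (trans (onReg ag 13 refl) rv) (cong-at (onArr ag 5 refl) (proj₂ c))))
        val : eval a6 s′ + (eval m₀ s′ ∸ eval a6 s′) ≡ g k
        val = trans (m+[n∸m]≡m⊔n (eval a6 s′) (eval m₀ s′)) (cong₂ _⊔_ v6 vm)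
        smallm : Small B m₀ s′
        smallm = tt , tt , tt , proj₁ c
        small : Small B m₀ s′ × Small B a6 s′
        small = smallm , tt
        max≤ : eval a6 s′ + (eval m₀ s′ ∸ eval a6 s′) ≤ B
        max≤ = ≤-trans (≤-reflexive (m+[n∸m]≡m⊔n (eval a6 s′) (eval m₀ s′)))
          (⊔-lub (fits-eval a6 {s′} (small-fits a6 b′ tt)) (fits-eval m₀ {s′} (small-fits m₀ b′ smallm)))

    module Dijkstra (g : Fin m → ℕ) (v : Fin n) (R : ℕ) (R≤big : R ≤ big) where

      Latest-at : (cap : Fin n → ℕ) → State → Set
      Latest-at cap s = Departures.Latest network g cap v R (λ y → arr s 6 (toℕ y))

      roundTime : ℕ
      roundTime = (2 + (6 + (8 * n + n * 14))) + (3 + fillTime (var 10) relayExp n)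

      dijkstra-ok : ∀ {s} → Bounded B s → Env₁ s → reg s 8 ≡ toℕ v → reg s 9 ≡ R →
        Adjacency g (λ z y → arr s 5 (cell z y)) →
        Runs B dijkstra s (fillTime (var 10) (lit 0) n + (fillTime (var 10) (lit 1) n + (3 + (6 + (8 * n + n * roundTime)))))
          (Latest-at (λ y → arr s 8 (toℕ y)))
      dijkstra-ok {s} b E rv rR (far , near) =
        (fill-rule 0 (λ _ → 0) refl 1≤B b r0 (λ k b′ ag ri _ → proj₁ b′ 10 , z≤n , ri , refl)
        ⟫ λ { {s₁} _ ag₁ (zeros , _) b₁ →
          (fill-rule 0 (λ _ → 1) refl 1≤B b₁ (trans (onReg ag₁ 0 refl) r0) (λ k b′ ag ri _ → proj₁ b′ 10 , 1≤B , ri , refl)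
        ⟫ λ { {s₂} _ ag₂ (ones , _) b₂ →
          (put-run (proj₁ b₂ 8) (proj₁ b₂ 9)
        ⟫ λ { _ _ refl b₃ →
          runs-mono ≤-refl (λ {s′} → finish {s′}) (for-uniform Inv roundTime refl refl refl 1≤B b₃
            (trans (onReg ag₂ 0 refl) (trans (onReg ag₁ 0 refl) r0))
            (start-inv ag₁ ag₂ zeros ones)
            (body (env₁-keep {11 ≔ lit 0} refl refl (run-agree {B} (assign {x = 11} {lit 0} {setArr s₂ 6 (reg s₂ 8) (reg s₂ 9)} z≤n))
                    (env₁-keep {put 6 (var 8) (var 9)} refl refl (run-agree (put (proj₁ b₂ 8) (proj₁ b₂ 9)))
                      (env₁-keep refl refl ag₂ (env₁-keep refl refl ag₁ E))))
                  (trans (onArr ag₂ 5 refl) (onArr ag₁ 5 refl)) (trans (onArr ag₂ 8 refl) (onArr ag₁ 8 refl)))) }) b₂ }) b₁ }) b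
        where
        open Env₁ E
        cap : Fin n → ℕ
        cap y = arr s 8 (toℕ y)
        open Departures network g cap v R
        M-of U-of : State → Fin n → ℕ
        M-of s′ y = arr s′ 6 (toℕ y)
        U-of s′ y = arr s′ 7 (toℕ y)
        Inv : ℕ → State → Set
        Inv k s′ = Settling-invariant (M-of s′) (U-of s′) × (∀ y → U-of s′ y ≤ 1) × ∑ (U-of s′) + k ≡ n
        finish : ∀ {s′} → Inv n s′ → Latest-at cap s′
        finish {s′} (S , _ , eq) = settled-latest S (∑≡0 (U-of s′) (+-cancelʳ-≡ n (∑ (U-of s′)) 0 eq))
        start-inv : ∀ {s₁ s₂} → Agree (fill 6 10 0 (var 10) (lit 0)) s s₁ → Agree (fill 7 10 0 (var 10) (lit 1)) s₁ s₂ →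
          (∀ (y : Fin n) → arr s₁ 6 (toℕ y) ≡ 0) → (∀ (y : Fin n) → arr s₂ 7 (toℕ y) ≡ 1) →
          Inv 0 (setReg (setArr s₂ 6 (reg s₂ 8) (reg s₂ 9)) 11 0)
        start-inv {s₁} {s₂} ag₁ ag₂ zeros ones =
          record { sound = sound′ ; start = ≤-reflexive (sym at-v)
                 ; closed = λ {_} {_} {z} Uz → contradiction (trans (sym (ones z)) Uz) λ ()
                 ; order = λ {_} {z} Uz → contradiction (trans (sym (ones z)) Uz) λ () } ,
          (λ y → ≤-reflexive (ones y)) ,
          trans (+-identityʳ _) (trans (∑-cong ones) (trans (∑-const {n} 1) (*-identityʳ n)))
          where
          r8 : reg s₂ 8 ≡ toℕ v
          r8 = trans (onReg ag₂ 8 refl) (trans (onReg ag₁ 8 refl) rv)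
          r9 : reg s₂ 9 ≡ R
          r9 = trans (onReg ag₂ 9 refl) (trans (onReg ag₁ 9 refl) rR)
          M₀ : Fin n → ℕ
          M₀ y = (arr s₂ 6 [ reg s₂ 8 ↦ reg s₂ 9 ]) (toℕ y)
          at-v : M₀ v ≡ R
          at-v = trans (cong₂ (λ i x → (arr s₂ 6 [ i ↦ x ]) (toℕ v)) r8 r9) (update-hit (arr s₂ 6) (toℕ v) R)
          off-v : ∀ y → y ≢ v → M₀ y ≡ 0
          off-v y y≢v = trans (cong (λ i → (arr s₂ 6 [ i ↦ reg s₂ 9 ]) (toℕ y)) r8)
            (trans (update-miss (arr s₂ 6) _ (λ eq → y≢v (sym (toℕ-injective eq))))
            (trans (keptAt ag₂ 6 refl (toℕ y)) (zeros y)))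
          sound′ : ∀ y → M₀ y ≢ 0 → Reach y (M₀ y)
          sound′ y ne with y FinP.≟ v
          ... | yes refl = subst (Reach y) (sym at-v) arrive
          ... | no y≢v   = contradiction (off-v y y≢v) ne
        body : ∀ {s₀} → Env₁ s₀ → arr s₀ 5 ≡ arr s 5 → arr s₀ 8 ≡ arr s 8 → ∀ (k : Fin n) {s′} → Bounded B s′ →
          Agree ((pick ⨾ settle) ⨾ 11 ≔ bin plus (var 11) (lit 1)) s₀ s′ → reg s′ 11 ≡ toℕ k → Inv (toℕ k) s′ →
          Runs B (pick ⨾ settle) s′ roundTime (λ s″ → Inv (suc (toℕ k)) (setReg s″ 11 (suc (toℕ k))))
        body E₀ a5 a8 k {s′} b′ ag _ (S , U≤1 , count) =
          (pick-ok b′ E′ U≤1 (∑≢0 (U-of s′) (λ z → <⇒≢ (toℕ<n k) (trans (sym (cong (_+ toℕ k) z)) count)))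
          ⟫ λ { {s₁} _ ag₁ (bst , r12 , Ub , r13 , max) b₁ →
            let a6 = onArr ag₁ 6 refl ; a7 = onArr ag₁ 7 refl in
            runs-mono ≤-refl (λ {s₂} (new , Ub′ , Us) →
              let M≡ : ∀ y → M-of s₂ y ≡ relay (M-of s′ y) (cap y) (M-of s′ bst) (arr s 5 (cell bst y))
                  M≡ y = trans (new y) (cong₄ relay (cong (λ f → f (toℕ y)) a6)
                           (cong (λ f → f (toℕ y)) (trans (onArr ag₁ 8 refl) (trans (onArr ag 8 refl) a8)))
                           (cong (λ f → f (toℕ bst)) a6)
                           (cong (λ f → f (cell bst y)) (trans (onArr ag₁ 5 refl) (trans (onArr ag 5 refl) a5))))
                  Us′ : ∀ y → y ≢ bst → U-of s₂ y ≡ U-of s′ y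
                  Us′ y ne = trans (Us y ne) (cong (λ f → f (toℕ y)) a7)
              in Round.round R≤big (far bst) (λ ge j → ≤-reflexive (near ge j)) Ub max M≡ Ub′ Us′ S ,
                 (λ y → flags≤1 bst (U-of s₂) (U-of s′) Ub′ Us′ U≤1 y) ,
                 recount bst (U-of s₂) (U-of s′) Ub Ub′ Us′ U≤1 count)
            (settle-ok b₁ (env₁-keep refl refl ag₁ E′) bst r12 (trans r13 (cong (λ f → f (toℕ bst)) (sym a6)))) }) b′
          where
          E′ = env₁-keep refl refl ag E₀
          cong₄ : (f : ℕ → ℕ → ℕ → ℕ → ℕ) → ∀ {a a′ b b′ c c′ d d′} → a ≡ a′ → b ≡ b′ → c ≡ c′ → d ≡ d′ → f a b c d ≡ f a′ b′ c′ d′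
          cong₄ f refl refl refl refl = refl
          flags≤1 : ∀ b (U′ U : Fin n → ℕ) → U′ b ≡ 0 → (∀ y → y ≢ b → U′ y ≡ U y) → (∀ y → U y ≤ 1) → ∀ y → U′ y ≤ 1
          flags≤1 b U′ U z same le y with y FinP.≟ b
          ... | yes refl = ≤-trans (≤-reflexive z) z≤n
          ... | no y≢b   = ≤-trans (≤-reflexive (same y y≢b)) (le y)
          recount : ∀ b (U′ U : Fin n → ℕ) → U b ≢ 0 → U′ b ≡ 0 → (∀ y → y ≢ b → U′ y ≡ U y) → (∀ y → U y ≤ 1) →
            ∑ U + toℕ k ≡ n → ∑ U′ + suc (toℕ k) ≡ n
          recount b U′ U Ub U′b same le eq = trans (+-suc (∑ U′) (toℕ k)) (trans (cong (_+ toℕ k) (trans (+-comm 1 (∑ U′))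
            (trans (cong (∑ U′ +_) (sym (≤-antisym (le b) (n≢0⇒n>0 Ub))))
            (trans (∑-exchange U′ U b same) (trans (cong (∑ U +_) U′b) (+-identityʳ _)))))) eq)

      departuresTime : ℕ
      departuresTime = 200

      departures-ok : ∀ {s} → Bounded B s → Env₁ s → (∀ e → arr s 4 (toℕ e) ≡ g e) → reg s 8 ≡ toℕ v → reg s 9 ≡ R →
        Runs B departures s (departuresTime * pass) (Latest-at (λ y → arr s 8 (toℕ y)))
      departures-ok {s} b E a4 rv rR = runs-mono (bound (≲-mono {d = departuresTime} (≤ᵇ⇒≤ 175 200 tt) time≲)) id
        ((matrix-ok b E ⟫ λ { {s₁} _ ag (far , near) b₁ →
          runs-mono ≤-refl (λ {s′} → subst (λ f → Departures.Latest network g (λ y → f (toℕ y)) v R (λ y → arr s′ 6 (toℕ y))) (onArr ag 8 refl))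
            (dijkstra-ok b₁ (env₁-keep refl refl ag E) (trans (onReg ag 8 refl) rv) (trans (onReg ag 9 refl) rR)
              ((λ z y → Sum.map₂ (λ { (e , ge , h) → e , ge ∘ trans (a4 e) , h }) (far z y)) ,
               (λ {e} ge → near (ge ∘ trans (sym (a4 e)))))) }) b)
        where
        time≲ = bounded-by {c = matrixTime} {pass} ≤-refl ⊞ flat-loop-≲ 1≤pass n≤pass ⊞ flat-loop-≲ 1≤pass n≤pass ⊞ const-≲ {3} 1≤pass
              -- A round is measured against `suc n` and not `n`, so that its constant costs are
              -- covered whatever `n` is; this is why `pass` contains `suc n * suc n`.
              ⊞ loop-≲ {Y = suc n} 1≤pass n≤pass n[n+1]≤pass
                  ((const-≲ {2} (s≤s z≤n) ⊞ flat-loop-≲ {c = 14} (s≤s z≤n) (n≤1+n n))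
                   ⊞ const-≲ {3} (s≤s z≤n) ⊞ flat-loop-≲ (s≤s z≤n) (n≤1+n n))

-- Preprocessing

setup : Cmd
setup = sumLoop 6 10 1 (get 2 (var 10)) ⨾
  6 ≔ bin plus (lit 1) (bin times (var 2) (var 6)) ⨾
  7 ≔ bin times (var 0) (var 0) ⨾
  -- With deadlines `big` and `R = big` no deadline binds, and the preprocessing obtains ordinary
  -- distances.
  fill 8 10 0 (var 10) (var 6)

route : Cmd
route = 8 ≔ get 1 (var 14) ⨾ 9 ≔ var 6 ⨾ departures

-- The distance between the ends of the edge in register 14 along usable edges, cut off at `big`.
gap : Exp
gap = bin monus (var 6) (get 6 (get 0 (var 14)))

-- When `trivialExp` is evaluated, `gap` refers to the graph without the edge, so its first summand
-- is nonzero exactly for mandatory edges; the second is nonzero exactly for weight 0.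
limitExp trivialExp : Exp
limitExp   = bin div (bin times (var 2) gap) (var 3)
trivialExp = bin plus (bin monus gap (get 9 (var 14))) (bin monus (lit 1) (get 3 (var 14)))

-- The first run uses all edges and yields the length bound of the pair; the second leaves out the
-- edge itself and thereby looks for an alternative path.
classify : Cmd
classify = fill 4 10 1 (var 10) (lit 1) ⨾ route ⨾ put 9 (var 14) limitExp ⨾
  put 4 (var 14) (lit 0) ⨾ route ⨾ put 10 (var 14) trivialExp

check : Cmd
check = 15 ≔ lit 0 ⨾ fill 4 10 1 (var 10) (get 10 (var 10)) ⨾
  for 14 1 (route ⨾ cond (bin monus gap (get 9 (var 14))) (15 ≔ lit 1) skip)

weigh : Cmd
weigh = sumLoop 19 10 1 (bin times (get 3 (var 10)) (bin monus (lit 1) (bin monus (lit 1) (get 11 (var 10)))))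

-- Correctness and cost of the preprocessing

module Preprocessing (I : SpannerInstance) (B : ℕ) (room : Machine.Room I B) where
  open SpannerInstance I
  open SpannerTheory I
  open Distances network
  open Machine I B
  open Room room
  open Routines room

  Caps : State → Set
  Caps s = ∀ (y : Fin n) → arr s 8 (toℕ y) ≡ big

  setup-ok : ∀ {s} → Bounded B s → Env s → Runs B setup s (100 * pass) (λ s′ → Env₁ s′ × Caps s′)
  setup-ok {s} b E = runs-mono (bound (≲-mono {d = 100} (≤ᵇ⇒≤ _ 100 tt) time≲)) id
    ((sum-rule ℓ refl refl refl refl 1≤B ∑ℓ≤B b (Env.r1 E)
        (λ k b′ ag ri → small-fits (get 2 (var 10)) b′ tt ,
           trans (cong-at (onArr ag 2 refl) ri) (Env.a2 E k))
    ⟫ λ { {s₁} _ ag₁ r6 b₁ →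
      let E₁ = env-keep refl refl ag₁ E
          prod : reg s₁ 2 * reg s₁ 6 ≡ num * ∑ ℓ
          prod = cong₂ _*_ (Env.r2 E₁) r6
          e₂ = bin plus (lit 1) (bin times (var 2) (var 6))
          fits₂ : Fits B e₂ s₁
          fits₂ = small-fits e₂ b₁ (1≤B , (tt , tt , subst (_≤ B) (sym prod) (≤-trans (n≤1+n _) big≤B)) ,
                 subst (_≤ B) (cong suc (sym prod)) big≤B)
      in (assign-run fits₂
    ⟫ λ { {s₂} _ ag₂ refl b₂ →
      let E₂ = env-keep refl refl ag₂ E₁
          sq : reg s₂ 0 * reg s₂ 0 ≡ n * n
          sq = cong₂ _*_ (Env.r0 E₂) (Env.r0 E₂)
      in (assign-run (small-fits (bin times (var 0) (var 0)) b₂ (tt , tt , subst (_≤ B) (sym sq) n²≤))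
    ⟫ λ { {s₃} _ ag₃ refl b₃ →
      let E₃ : Env₁ s₃
          E₃ = record { env = env-keep refl refl ag₃ E₂ ; r6 = cong suc prod ; r7 = sq }
      in with-agree (λ ag (caps , _) → env₁-keep refl refl ag E₃ , caps)
        (fill-rule 0 (λ _ → big) refl 1≤B b₃ (Env₁.r0 E₃) (λ k b′ ag ri _ → proj₁ b′ 10 , proj₁ b′ 6 , ri , trans (onReg ag 6 refl) (Env₁.r6 E₃))) }) b₂ }) b₁ }) b)
    where
    ∑ℓ≤B : ∑ ℓ ≤ B
    ∑ℓ≤B = ≤-trans (≤-trans (≤-trans (≤-reflexive (sym (*-identityˡ _))) (*-monoˡ-≤ (∑ ℓ) 1≤num)) (n≤1+n _)) big≤B
    time≲ = (const-≲ {2} 1≤pass ⊞ flat-loop-≲ 1≤pass m≤pass) ⊞ const-≲ {6} 1≤pass ⊞ const-≲ {4} 1≤pass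
            ⊞ flat-loop-≲ 1≤pass n≤pass

  -- The usable edges need not connect the two ends, so `x` is described by the walks it stands for,
  -- and only below `big`.
  Gap : (Fin m → ℕ) → Fin m → ℕ → Set
  Gap g e x = ∀ k → k < big →
      (x ≤ k → ∃ λ (p : Walk (src e) (tgt e)) → All (On g) (edges p) × len ℓ p ≤ k)
    × (∀ (p : Walk (src e) (tgt e)) → All (On g) (edges p) → len ℓ p ≤ k → x ≤ k)

  gapAt : State → Fin m → ℕ
  gapAt s e = big ∸ arr s 6 (toℕ (src e))

  gap-val : ∀ {s e} → Env₁ s → reg s 14 ≡ toℕ e → eval gap s ≡ gapAt s e
  gap-val {s} {e} E r14 = cong₂ _∸_ r6 (cong (arr s 6) (trans (cong (arr s 0) r14) (a0 e)))
    where open Env₁ E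

  routeTime : ℕ
  routeTime = 5 + 200 * pass

  route-ok : ∀ {s} g e → Bounded B s → Env₁ s → Caps s → (∀ x → arr s 4 (toℕ x) ≡ g x) → reg s 14 ≡ toℕ e →
    Runs B route s routeTime (λ s′ → Gap g e (gapAt s′ e))
  route-ok {s} g e b E caps a4 r14 =
    (assign-run (small-fits (get 1 (var 14)) b tt) ⟫ λ { _ ag₁ refl b₁ →
      (assign-run (proj₁ b₁ 6) ⟫ λ { _ ag₂ refl b₂ →
        runs-mono ≤-refl (λ L k k<big → ≤-latest L caps′ k<big , λ p a l → latest-≤ L caps′ k<big p a l)
          (departures-ok b₂ (env₁-keep refl refl ag₂ (env₁-keep refl refl ag₁ E)) a4 (trans (cong (arr s 1) r14) (Env₁.a1 E e)) (Env₁.r6 E)) }) b₁ }) b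
    where
    open Dijkstra g (tgt e) big ≤-refl
    open Departures network g (λ y → arr s 8 (toℕ y)) (tgt e) big
    caps′ : ∀ y → big ≤ arr s 8 (toℕ y)
    caps′ y = ≤-reflexive (sym (caps y))

  gap-dist : ∀ {g e x} → (∀ f → g f ≢ 0) → Gap g e x → x ≡ dist e
  gap-dist {g} {e} {x} all G = ≤-antisym x≤d
      (let q , _ , l = proj₁ (G x (≤-trans (s≤s x≤d) d<big)) ≤-refl in ≤-trans (distance-≤ (dist-distance e) q (in-⊤ q)) l)
    where
    d<big : dist e < big
    d<big = ≤-trans (s≤s (dist≤ℓ e)) (ℓ<big e)
    x≤d : x ≤ dist e
    x≤d with proj₁ (dist-distance e)
    ... | P , _ , eq = proj₂ (G (dist e) d<big) (walk P) (All.universal all _) (≤-reflexive eq)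

  gap-settles : ∀ {g e x} → Gap g e x → (x ≤ limit e → Settles (On g) e) × (Settles (On g) e → x ≤ limit e)
  gap-settles {g} {e} G = proj₁ (G (limit e) (limit<big e)) , λ { (p , a , l) → proj₂ (G (limit e) (limit<big e)) p a l }

  TrivialFlag : Fin m → ℕ → Set
  TrivialFlag e t = (t ≢ 0 → Trivial e) × (t ≡ 0 → Nontrivial e)

  trivial-flag : ∀ {g e x} → (∀ f → f ≢ e → g f ≢ 0) → g e ≡ 0 → Gap g e x →
                 TrivialFlag e ((x ∸ limit e) + (1 ∸ w e))
  trivial-flag {g} {e} {x} others ge G = to , from
    where
    settles : (x ≤ limit e → Settles (_≢ e) e) × (Settles (_≢ e) e → x ≤ limit e)
    settles = (λ l → settles-⊆ (λ { gx refl → gx ge }) (proj₁ (gap-settles G) l)) ,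
              (λ s → proj₂ (gap-settles G) (settles-⊆ (λ {f} → others f) s))
    to : (x ∸ limit e) + (1 ∸ w e) ≢ 0 → Trivial e
    to ne with w e
    ... | zero  = inj₂ refl
    ... | suc y = inj₁ (mandatory⁺ λ s → ne (cong₂ _+_ (m≤n⇒m∸n≡0 (proj₂ settles s)) (0∸n≡0 y)))
    from : (x ∸ limit e) + (1 ∸ w e) ≡ 0 → Nontrivial e
    from eq (inj₁ man) = mandatory⁻ (proj₁ settles (m∸n≡0⇒m≤n (m+n≡0⇒m≡0 _ eq))) man
    from eq (inj₂ w≡0) = contradiction (trans (sym (cong (1 ∸_) w≡0)) (m+n≡0⇒n≡0 (x ∸ limit e) eq)) λ ()

  opaque
    passes : ℕ
    passes = suc m * pass

    passes≡ : passes ≡ suc m * pass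
    passes≡ = refl

    pass≤passes : pass ≤ passes
    pass≤passes = m≤m+n pass (m * pass)

    m*pass≤passes : m * pass ≤ passes
    m*pass≤passes = *-monoˡ-≤ pass (n≤1+n m)

  1≤passes : 1 ≤ passes
  1≤passes = ≤-trans 1≤pass pass≤passes

  m≤passes : m ≤ passes
  m≤passes = ≤-trans m≤pass pass≤passes

  Classified : ℕ → State → Set
  Classified k s = ∀ e → toℕ e < k → arr s 9 (toℕ e) ≡ limit e × TrivialFlag e (arr s 10 (toℕ e))

  classifyTime : ℕ
  classifyTime = fillTime (var 10) (lit 1) m + (routeTime + (11 + (3 + (routeTime + 15))))

  classify-ok : ∀ {s} e → Bounded B s → Env₁ s → Caps s → reg s 14 ≡ toℕ e → Classified (toℕ e) s →
    Runs B classify s classifyTime (Classified (suc (toℕ e)))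
  classify-ok {s} e b E caps r14 earlier =
    (fill-rule 0 (λ _ → 1) refl 1≤B b (Env₁.r1 E) (λ k b′ ag ri _ → proj₁ b′ 10 , 1≤B , ri , refl)
    ⟫ λ { {s₁} _ ag₁ (ones , _) b₁ →
      let E₁ = env₁-keep refl refl ag₁ E
          c₁ = λ y → trans (keptAt ag₁ 8 refl (toℕ y)) (caps y)
          r14₁ = trans (onReg ag₁ 14 refl) r14
      in (route-ok (λ _ → 1) e b₁ E₁ c₁ ones r14₁
    ⟫ λ { {s₂} _ ag₂ G b₂ →
      let E₂ = env₁-keep refl refl ag₂ E₁
          c₂ = λ y → trans (keptAt ag₂ 8 refl (toℕ y)) (c₁ y)
          r14₂ = trans (onReg ag₂ 14 refl) r14₁
          gv : eval gap s₂ ≡ dist e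
          gv = trans (gap-val E₂ r14₂) (gap-dist (λ _ ()) G)
          prod : reg s₂ 2 * eval gap s₂ ≡ num * dist e
          prod = cong₂ _*_ (Env₁.r2 E₂) gv
          lim : eval limitExp s₂ ≡ limit e
          lim = cong₂ (applyOp div) prod (Env₁.r3 E₂)
          fits₃ : Fits B limitExp s₂
          fits₃ = small-fits limitExp b₂ ((tt , (tt , tt) ,
                 subst (_≤ B) (sym prod) (≤-trans (*-monoʳ-≤ num (≤-trans (dist≤ℓ e) (∑-≤ ℓ e))) (≤-trans (n≤1+n _) big≤B))) , tt)
      in (put-run (proj₁ b₂ 14) fits₃
    ⟫ λ { {s₃} _ ag₃ refl b₃ →
      let E₃ = env₁-keep refl refl ag₃ E₂
      in (put-run (proj₁ b₃ 14) z≤n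
    ⟫ λ { {s₄} _ ag₄ refl b₄ →
      let E₄ = env₁-keep refl refl ag₄ E₃
      in (route-ok (without e) e b₄ E₄ c₂
            (λ x → trans (cong (λ i → (arr s₂ 4 [ i ↦ 0 ]) (toℕ x)) r14₂) (without-at {arr s₂ 4} x (trans (keptAt ag₂ 4 refl (toℕ x)) (ones x)))) r14₂
    ⟫ λ { {s₅} _ ag₅ G′ b₅ → last {s₂ = s₂} b₅ (env₁-keep refl refl ag₅ E₄) (trans (onReg ag₅ 14 refl) r14₂) G′
            (λ x → trans (keptAt ag₅ 9 refl (toℕ x))
               (cong₂ (λ i v → (arr s₂ 9 [ i ↦ v ]) (toℕ x)) r14₂ lim))
            (trans (onArr ag₂ 9 refl) (onArr ag₁ 9 refl))
            (trans (onArr ag₅ 10 refl) (trans (onArr ag₂ 10 refl) (onArr ag₁ 10 refl))) }) b₄ }) b₃ }) b₂ }) b₁ }) b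
    where
    without : Fin m → Fin m → ℕ
    without e x = ((λ _ → 1) [ toℕ e ↦ 0 ]) (toℕ x)
    without-at : ∀ {f : ℕ → ℕ} x → f (toℕ x) ≡ 1 → (f [ toℕ e ↦ 0 ]) (toℕ x) ≡ without e x
    without-at {f} x eq = update-elim (λ z → z ≡ without e x) f (toℕ e) 0 (toℕ x)
      (λ p → trans (sym (update-hit (λ _ → 1) (toℕ e) 0)) (cong (((λ _ → 1) [ toℕ e ↦ 0 ])) p))
      (λ p → trans eq (sym (update-miss (λ _ → 1) 0 p)))
    last : ∀ {s₅ s₂} → Bounded B s₅ → Env₁ s₅ → reg s₅ 14 ≡ toℕ e → Gap (without e) e (gapAt s₅ e) →
      (∀ (x : Fin m) → arr s₅ 9 (toℕ x) ≡ (arr s₂ 9 [ toℕ e ↦ limit e ]) (toℕ x)) → arr s₂ 9 ≡ arr s 9 → arr s₅ 10 ≡ arr s 10 →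
      Runs B (put 10 (var 14) trivialExp) s₅ 15 (Classified (suc (toℕ e)))
    last {s₅} {s₂} b₅ E₅ r14₅ G′ a9 old9 old10 = runs (put (proj₁ b₅ 14) (small-fits trivialExp b₅
        (((tt , tt) , tt) , (1≤B , tt) , sum≤))) (≤ᵇ⇒≤ _ _ tt) post′
      where
      gv = gap-val E₅ r14₅
      sum≤ : (eval gap s₅ ∸ arr s₅ 9 (reg s₅ 14)) + (1 ∸ arr s₅ 3 (reg s₅ 14)) ≤ B
      sum≤ = ≤-trans (+-mono-≤ (≤-trans (m∸n≤m _ (arr s₅ 9 (reg s₅ 14))) (≤-trans (≤-reflexive gv) (m∸n≤m big (arr s₅ 6 (toℕ (src e))))))
               (≤-trans (m∸n≤m 1 (arr s₅ 3 (reg s₅ 14))) (s≤s z≤n))) big+big≤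
      val : eval trivialExp s₅ ≡ (gapAt s₅ e ∸ limit e) + (1 ∸ w e)
      val = cong₂ _+_ (cong₂ _∸_ gv (trans (cong (arr s₅ 9) r14₅) (trans (a9 e) (update-hit (arr s₂ 9) (toℕ e) (limit e)))))
                      (cong (1 ∸_) (trans (cong (arr s₅ 3) r14₅) (Env₁.a3 E₅ e)))
      post′ : Classified (suc (toℕ e)) (setArr s₅ 10 (reg s₅ 14) (eval trivialExp s₅))
      post′ x (s≤s x≤e) with x FinP.≟ e
      ... | yes refl = trans (a9 x) (update-hit (arr s₂ 9) (toℕ x) (limit x)) ,
            subst (TrivialFlag x) (sym (trans (cong (λ i → (arr s₅ 10 [ i ↦ eval trivialExp s₅ ]) (toℕ x)) r14₅)
                                        (trans (update-hit (arr s₅ 10) (toℕ x) _) val)))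
              (trivial-flag (λ f f≢x → λ z → contradiction (trans (sym (update-miss (λ _ → 1) 0 (λ p → f≢x (sym (toℕ-injective p))))) z) λ ())
                (update-hit (λ _ → 1) (toℕ x) 0) G′)
      ... | no x≢e with earlier x (≤∧≢⇒< x≤e (x≢e ∘ toℕ-injective))
      ...   | l , t = trans (a9 x) (trans (update-miss (arr s₂ 9) (limit e) (λ p → x≢e (sym (toℕ-injective p))))
                        (trans (cong (λ f → f (toℕ x)) old9) l)) ,
            subst (TrivialFlag x) (sym (trans (cong (λ i → (arr s₅ 10 [ i ↦ eval trivialExp s₅ ]) (toℕ x)) r14₅)
                     (trans (update-miss (arr s₅ 10) _ (λ p → x≢e (sym (toℕ-injective p)))) (cong (λ f → f (toℕ x)) old10)))) t

  classify-all-ok : ∀ {s} → Bounded B s → Env₁ s → Caps s →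
    Runs B (for 14 1 classify) s (500 * passes) (λ s′ → Env₁ s′ × Caps s′ × Classified m s′)
  classify-all-ok {s} b E caps = runs-mono (bound (≲-mono {d = 500} (≤ᵇ⇒≤ _ 500 tt) time≲)) id
    (with-agree (λ ag c → env₁-keep refl refl ag E , (λ y → trans (keptAt ag 8 refl (toℕ y)) (caps y)) , c)
      (for-uniform Classified classifyTime refl refl refl 1≤B b (Env₁.r1 E) (λ _ ())
        (λ k b′ ag r14 c → classify-ok k b′ (env₁-keep refl refl ag E₀)
           (λ y → trans (keptAt ag 8 refl (toℕ y)) (caps y)) r14 c)))
    where
    E₀ : Env₁ (setReg s 14 0)
    E₀ = env₁-keep {14 ≔ lit 0} refl refl (run-agree {B} (assign {x = 14} {lit 0} {s} z≤n)) E
    route≲ : routeTime ≲ 205 · pass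
    route≲ = const-≲ {5} 1≤pass ⊞ bounded-by {c = 200} {pass} ≤-refl
    time≲ = loop-≲ {Y = pass} 1≤passes m≤passes m*pass≤passes
      (flat-loop-≲ {c = 3} 1≤pass m≤pass ⊞ route≲ ⊞ const-≲ {11} 1≤pass ⊞ const-≲ {3} 1≤pass ⊞ route≲ ⊞ const-≲ {15} 1≤pass)

  record Env₂ (tr : Fin m → ℕ) (s : State) : Set where
    field
      env₁ : Env₁ s
      a9   : ∀ e → arr s 9 (toℕ e) ≡ limit e
      a10  : ∀ e → arr s 10 (toℕ e) ≡ tr e
    open Env₁ env₁ public

  env₂-keep : ∀ {c s s′ tr} → anyBelow 8 (writesReg c) ≡ false → anyBelow 4 (writesArr c) ≡ false →
              writesArr c 9 ≡ false → writesArr c 10 ≡ false → Agree c s s′ → Env₂ tr s → Env₂ tr s′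
  env₂-keep kr ka k9 k10 ag E = record
    { env₁ = env₁-keep kr ka ag env₁
    ; a9 = λ e → trans (keptAt ag 9 k9 (toℕ e)) (a9 e)
    ; a10 = λ e → trans (keptAt ag 10 k10 (toℕ e)) (a10 e) }
    where open Env₂ E

  Checked : (Fin m → ℕ) → State → Set
  Checked tr s = (reg s 15 ≢ 0 × ∃ λ e → ¬ Settles (On tr) e) ⊎ (reg s 15 ≡ 0 × ∀ e → Settles (On tr) e)

  check-ok : ∀ {s tr} → Bounded B s → Env₂ tr s → Caps s → Runs B check s (500 * passes) (Checked tr)
  check-ok {s} {tr} b E caps = runs-mono (bound (≲-mono {d = 500} (≤ᵇ⇒≤ _ 500 tt) time≲)) id
    ((assign-run z≤n ⟫ λ { _ ag₁ refl b₁ →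
      let E₁ = env₂-keep refl refl refl refl ag₁ E
      in (fill-rule 0 tr refl 1≤B b₁ (Env₂.r1 E₁) (λ k b′ ag ri _ → proj₁ b′ 10 , small-fits (get 10 (var 10)) b′ tt , ri ,
            trans (cong-at (onArr ag 10 refl) ri) (Env₂.a10 E k))
    ⟫ λ { {s₂} _ ag₂ (fl , _) b₂ →
      let E₂ = env₂-keep refl refl refl refl ag₂ E₁
      in runs-mono ≤-refl (λ {s′} → finish {s′}) (for-uniform Inv (routeTime + 18) refl refl refl 1≤B b₂ (Env₂.r1 E₂)
           (inj₂ (onReg ag₂ 15 refl , λ _ ()))
           (body (env₂-keep {14 ≔ lit 0} refl refl refl refl (run-agree {B} (assign {x = 14} {lit 0} {s₂} z≤n)) E₂)
             fl (λ y → trans (keptAt ag₂ 8 refl (toℕ y)) (caps y)))) }) b₁ }) b)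
    where
    Inv : ℕ → State → Set
    Inv k s′ = (reg s′ 15 ≢ 0 × ∃ λ e → ¬ Settles (On tr) e) ⊎ (reg s′ 15 ≡ 0 × ∀ e → toℕ e < k → Settles (On tr) e)
    finish : ∀ {s′} → Inv m s′ → Checked tr s′
    finish (inj₁ p) = inj₁ p
    finish (inj₂ (z , h)) = inj₂ (z , λ e → h e (toℕ<n e))
    step′ : Cmd
    step′ = route ⨾ cond (bin monus gap (get 9 (var 14))) (15 ≔ lit 1) skip
    body : ∀ {s₀} → Env₂ tr s₀ → (∀ x → arr s₀ 4 (toℕ x) ≡ tr x) → Caps s₀ → ∀ (k : Fin m) {s′} → Bounded B s′ →
      Agree (step′ ⨾ 14 ≔ bin plus (var 14) (lit 1)) s₀ s′ → reg s′ 14 ≡ toℕ k → Inv (toℕ k) s′ →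
      Runs B step′ s′ (routeTime + 18) (λ s″ → Inv (suc (toℕ k)) (setReg s″ 14 (suc (toℕ k))))
    body E₀ fl caps₀ k {s′} b′ ag r14 inv =
      (route-ok tr k b′ (Env₂.env₁ E′) (λ y → trans (keptAt ag 8 refl (toℕ y)) (caps₀ y))
        (λ x → trans (keptAt ag 4 refl (toℕ x)) (fl x)) r14
      ⟫ λ { {s₁} _ ag₁ G b₁ →
        let E₁ = env₂-keep refl refl refl refl ag₁ E′
            r14₁ = trans (onReg ag₁ 14 refl) r14
            r15 = onReg ag₁ 15 refl
            val : eval (bin monus gap (get 9 (var 14))) s₁ ≡ gapAt s₁ k ∸ limit k
            val = cong₂ _∸_ (gap-val (Env₂.env₁ E₁) r14₁) (trans (cong (arr s₁ 9) r14₁) (Env₂.a9 E₁ k))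
        in runs-mono (≤ᵇ⇒≤ _ _ tt) id (runs-cond {T₁ = 2} {T₂ = 1} (small-fits (bin monus gap (get 9 (var 14))) b₁ ((tt , tt) , tt))
          (λ ne → runs (assign 1≤B) ≤-refl (inj₁ ((λ ()) , k ,
             λ st → ne (trans val (m≤n⇒m∸n≡0 (proj₂ (gap-settles G) st))))))
          (λ eq → runs skip ≤-refl (extend {s₁} r15 inv (proj₁ (gap-settles G) (m∸n≡0⇒m≤n (trans (sym val) eq)))))) }) b′
      where
      E′ = env₂-keep refl refl refl refl ag E₀
      extend : ∀ {s₁} → reg s₁ 15 ≡ reg s′ 15 → Inv (toℕ k) s′ → Settles (On tr) k → Inv (suc (toℕ k)) (setReg s₁ 14 (suc (toℕ k)))
      extend r15 (inj₁ (ne , u)) _ = inj₁ (ne ∘ trans (sym r15) , u)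
      extend r15 (inj₂ (z , h)) st = inj₂ (trans r15 z , λ { e (s≤s e≤k) → new e e≤k })
        where
        new : ∀ e → toℕ e ≤ toℕ k → Settles (On tr) e
        new e e≤k with e FinP.≟ k
        ... | yes refl = st
        ... | no e≢k = h e (≤∧≢⇒< e≤k (e≢k ∘ toℕ-injective))
    route≲ : routeTime ≲ 205 · pass
    route≲ = const-≲ {5} 1≤pass ⊞ bounded-by {c = 200} {pass} ≤-refl
    time≲ = const-≲ {2} 1≤passes ⊞ ≲-scale pass≤passes (flat-loop-≲ {c = 4} 1≤pass m≤pass)
      ⊞ loop-≲ {Y = pass} 1≤passes m≤passes m*pass≤passes (route≲ ⊞ const-≲ {18} 1≤pass)

  weigh-ok : ∀ {s} → Bounded B s → Env s → (f : Fin m → ℕ) → (∀ e → arr s 11 (toℕ e) ≡ f e) →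
    Runs B weigh s (100 * pass) (λ s′ → reg s′ 19 ≡ wt f)
  weigh-ok {s} b E f a11 = runs-mono (bound (≲-mono {d = 100} (≤ᵇ⇒≤ _ 100 tt) time≲)) id
    (sum-rule (λ e → w e * ind (f e)) refl refl refl refl 1≤B (≤-trans (∑-mono (λ e → term≤ e)) ∑w≤) b r1
      (λ k {s′} b′ ag ri →
        let v3 : arr s′ 3 (reg s′ 10) ≡ w k
            v3 = trans (cong-at (onArr ag 3 refl) ri) (a3 k)
            v11 : arr s′ 11 (reg s′ 10) ≡ f k
            v11 = trans (cong-at (onArr ag 11 refl) ri) (a11 k)
            val : arr s′ 3 (reg s′ 10) * (1 ∸ (1 ∸ arr s′ 11 (reg s′ 10))) ≡ w k * ind (f k)
            val = cong₂ _*_ v3 (trans (cong (λ z → 1 ∸ (1 ∸ z)) v11) (1∸[1∸n]≡ind (f k)))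
        in small-fits e₀ b′ (tt , (1≤B , 1≤B , tt) , subst (_≤ B) (sym val) (≤-trans (term≤ k) (≤-trans (∑-≤ w k) ∑w≤))) , val))
    where
    open Env E
    e₀ = bin times (get 3 (var 10)) (bin monus (lit 1) (bin monus (lit 1) (get 11 (var 10))))
    term≤ : ∀ e → w e * ind (f e) ≤ w e
    term≤ e = ≤-trans (*-monoʳ-≤ (w e) (ind≤1 (f e))) (≤-reflexive (*-identityʳ (w e)))
    time≲ = const-≲ {2} 1≤pass ⊞ flat-loop-≲ 1≤pass m≤pass

-- The search tree

offset : Exp
offset = bin plus (var 20) (var 10)

pop : Cmd
pop = 17 ≔ bin monus (var 17) (lit 1) ⨾ 18 ≔ get 13 (var 17) ⨾ 20 ≔ bin times (var 17) (var 1) ⨾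
  fill 11 10 1 (var 10) (get 12 offset)

maskExp : Exp
maskExp = bin plus (get 2 (var 10)) (bin times (bin monus (var 6) (get 2 (var 10))) (bin monus (lit 1) (get 11 (var 10))))

-- Offset by 32, this is the input format of APSP; its distance matrix will appear in array 35.
prepare : Cmd
prepare = 32 ≔ var 0 ⨾ 33 ≔ var 1 ⨾ fill 32 10 1 (var 10) (get 0 (var 10)) ⨾
  fill 33 10 1 (var 10) (get 1 (var 10)) ⨾ fill 34 10 1 (var 10) maskExp

pairDistance : Exp
pairDistance = get 35 (cellExp (get 0 (var 10)) (get 1 (var 10)))

-- The value `m` in register 15 signals that every pair is settled.
scan : Cmd
scan = 15 ≔ var 1 ⨾ for 10 1 (cond (bin monus pairDistance (get 9 (var 10))) (15 ≔ var 10) skip)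

push : Cmd
push = 20 ≔ bin times (var 17) (var 1) ⨾ fill 12 10 1 offset (get 11 (var 10)) ⨾
  put 12 (bin plus (var 20) (var 14)) (lit 1) ⨾ put 13 (var 17) (var 18) ⨾ 17 ≔ bin plus (var 17) (lit 1)

-- The two summands test `D x + ℓ e < M y` for the two orientations of the edge.
candidateExp : Exp
candidateExp = bin plus
  (bin monus (bin monus (get 6 (get 1 (var 14))) (get 2 (var 14))) (get 8 (get 0 (var 14))))
  (bin monus (bin monus (get 6 (get 0 (var 14))) (get 2 (var 14))) (get 8 (get 1 (var 14))))

branch : Cmd
branch = for 14 1 (cond candidateExp push skip)

focus : Cmd
focus = fill 8 10 0 (var 10) (get 35 (cellExp (get 0 (var 15)) (var 10))) ⨾ fill 4 10 1 (var 10) (lit 1) ⨾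
  -- Latest departures count arrivals strictly before `R`, so walks of length up to the limit
  -- require `R` to be the limit plus 1.
  8 ≔ get 1 (var 15) ⨾ 9 ≔ bin plus (get 9 (var 15)) (lit 1) ⨾ departures ⨾
  18 ≔ bin monus (var 18) (lit 1)

expand : Cmd
expand = focus ⨾ branch

-- Success empties the stack, which ends the search.
finish : Cmd
finish = weigh ⨾ cond (bin monus (var 19) (var 4)) skip (16 ≔ lit 1 ⨾ 17 ≔ lit 0)

node : Cmd → Cmd
node c = pop ⨾ prepare ⨾ shift 32 c ⨾ scan ⨾ cond (bin monus (var 1) (var 15)) (cond (var 18) expand skip) finish

anyBelow-false : ∀ k f → (∀ x → x < k → f x ≡ false) → anyBelow k f ≡ false
anyBelow-false zero    f h = refl
anyBelow-false (suc k) f h rewrite h k ≤-refl = anyBelow-false k f (λ x l → h x (m≤n⇒m≤1+n l))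

-- The number of nodes and pushes in a search tree of depth r and degree b.
treeSize : ℕ → ℕ → ℕ
treeSize b zero    = 1
treeSize b (suc r) = suc (b * suc (treeSize b r))

1≤treeSize : ∀ b r → 1 ≤ treeSize b r
1≤treeSize b zero    = ≤-refl
1≤treeSize b (suc r) = s≤s z≤n

-- The summand 3 strengthens the claim so that the induction closes: the 4 that arises at each level
-- is at most `b * 2`.
treeSize-≤ : ∀ {b} → 2 ≤ b → ∀ r → 3 + treeSize b r ≤ 4 * b ^ r
treeSize-≤ 2≤b zero = ≤-refl
treeSize-≤ {b} 2≤b (suc r) = begin
  4 + b * suc (treeSize b r)            ≤⟨ +-monoˡ-≤ _ (*-monoˡ-≤ 2 2≤b) ⟩
  b * 2 + b * suc (treeSize b r)        ≡⟨ *-distribˡ-+ b 2 (suc (treeSize b r)) ⟨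
  b * (3 + treeSize b r)                ≤⟨ *-monoʳ-≤ b (treeSize-≤ 2≤b r) ⟩
  b * (4 * b ^ r)                       ≡⟨ solve 2 (λ b x → b :* (con 4 :* x) := con 4 :* (b :* x)) refl b (b ^ r) ⟩
  4 * (b * b ^ r)                       ∎
  where
  open ≤-Reasoning

sumBelow : ℕ → (ℕ → ℕ) → ℕ
sumBelow zero    g = 0
sumBelow (suc k) g = sumBelow k g + g k

sumBelow-cong : ∀ k {g h} → (∀ p → p < k → g p ≡ h p) → sumBelow k g ≡ sumBelow k h
sumBelow-cong zero    eq = refl
sumBelow-cong (suc k) eq = cong₂ _+_ (sumBelow-cong k (λ p p<k → eq p (m≤n⇒m≤1+n p<k))) (eq k ≤-refl)

sumBelow-block : ∀ t c {g v} → (∀ p → t ≤ p → p < t + c → g p ≡ v) → sumBelow (t + c) g ≡ sumBelow t g + c * v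
sumBelow-block t zero {g} eq = trans (cong (λ z → sumBelow z g) (+-identityʳ t)) (sym (+-identityʳ _))
sumBelow-block t (suc c) {g} {v} eq = trans (cong (λ z → sumBelow z g) (+-suc t c))
  (trans (cong₂ _+_ (sumBelow-block t c (λ p t≤p p< → eq p t≤p (≤-trans p< (+-monoʳ-≤ t (n≤1+n c)))))
                    (eq (t + c) (m≤m+n t c) (+-monoʳ-< t ≤-refl)))
  (trans (+-assoc (sumBelow t g) (c * v) v) (cong (sumBelow t g +_) (+-comm (c * v) v))))

-- Correctness and cost of a node of the search

module Searching (A : APSPAlgorithm) (I : SpannerInstance) (B : ℕ) (room : Machine.Room I B)
  (oracle-room : (2 + (SpannerInstance.n I + SpannerInstance.m I + SpannerInstance.m I * Machine.big I B))
                 ^ proj₁ (APSPAlgorithm.solves A) ≤ B)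
  (tr : Fin (SpannerInstance.m I) → ℕ) (trivial : SpannerTheory.TrivialFlags I tr) where
  open SpannerInstance I
  open SpannerTheory I
  open Distances network
  open Machine I B
  open Room room
  open Routines room
  open Preprocessing I B room

  mask : (Fin m → ℕ) → Fin m → ℕ
  mask f e = ℓ e + (big ∸ ℓ e) * (1 ∸ f e)

  mask-on : ∀ f e → f e ≢ 0 → mask f e ≡ ℓ e
  mask-on f e ne with f e
  ... | zero  = contradiction refl ne
  ... | suc x = trans (cong (λ z → ℓ e + (big ∸ ℓ e) * z) (0∸n≡0 x)) (trans (cong (ℓ e +_) (*-zeroʳ (big ∸ ℓ e))) (+-identityʳ (ℓ e)))

  mask-off : ∀ f e → f e ≡ 0 → mask f e ≡ big
  mask-off f e eq rewrite eq = trans (cong (ℓ e +_) (*-identityʳ (big ∸ ℓ e))) (m+[n∸m]≡n (<⇒≤ (ℓ<big e)))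

  mask-positive : ∀ f e → 1 ≤ mask f e
  mask-positive f e = ≤-trans (ℓ-positive e) (m≤m+n (ℓ e) _)

  mask≤big : ∀ f e → mask f e ≤ big
  mask≤big f e with f e ≟ 0
  ... | yes eq = ≤-reflexive (mask-off f e eq)
  ... | no ne  = ≤-trans (≤-reflexive (mask-on f e ne)) (<⇒≤ (ℓ<big e))

  Distances-at : (Fin m → ℕ) → State → Set
  Distances-at f s = ∀ z y → Masked.Distance′ network f (mask f) (mask-positive f) big (mask-on f) (mask-off f) z y (arr s 35 (cell z y))

  oracle-ok : ∀ {s} (f : Fin m → ℕ) → Bounded B s → reg s 32 ≡ n → reg s 33 ≡ m →
    (∀ e → arr s 32 (toℕ e) ≡ toℕ (src e)) → (∀ e → arr s 33 (toℕ e) ≡ toℕ (tgt e)) → (∀ e → arr s 34 (toℕ e) ≡ mask f e) →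
    Runs B (shift 32 (APSPAlgorithm.program A)) s (APSPAlgorithm.time A n m) (Distances-at f)
  oracle-ok {s} f b r32 r33 a32 a33 a34
    with proj₂ (APSPAlgorithm.solves A) (relength network (mask f) (mask-positive f)) B σ
           (≤-trans (^-monoˡ-≤ (proj₁ (APSPAlgorithm.solves A)) magnitude≤) oracle-room)
           ((λ x → proj₁ b (32 + x)) , λ a i → proj₂ b (32 + a) i) (r32 , r33 , a32 , a33 , a34)
    where
    σ = state (λ x → reg s (32 + x)) (λ a → arr s (32 + a))
    magnitude≤ : 2 + (n + m + ∑ (mask f)) ≤ 2 + (n + m + m * big)
    magnitude≤ = s≤s (s≤s (+-monoʳ-≤ (n + m) (≤-trans (∑-mono (mask≤big f)) (≤-reflexive (∑-const {m} big)))))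
  ... | t , σ′ , run , dist-ok , t≤ with run-shift 32 run {s} ((λ _ → refl) , λ _ _ → refl)
  ...   | s′ , run′ , (_ , same) = runs run′ t≤ λ z y →
            subst (Network.Distance (relength network (mask f) (mask-positive f)) Subset.⊤ z y) (sym (same 3 (cell z y))) (dist-ok z y)

  F-at : State → ℕ → Fin m → ℕ
  F-at s p e = arr s 12 (p * m + toℕ e)

  pop-ok : ∀ {s t} → Bounded B s → Env₂ tr s → reg s 17 ≡ suc t → t * m + m ≤ B →
    Runs B pop s (4 + (3 + (4 + fillTime (var 10) (get 12 offset) m)))
      (λ s′ → reg s′ 17 ≡ t × reg s′ 18 ≡ arr s 13 t × (∀ e → arr s′ 11 (toℕ e) ≡ F-at s t e))
  pop-ok {s} {t} b E r17 tm≤ =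
    (assign-run (small-fits (bin monus (var 17) (lit 1)) b (tt , 1≤B))
    ⟫ λ { {s₁} _ _ refl b₁ →
      (assign-run (small-fits (get 13 (var 17)) b₁ tt)
    ⟫ λ { {s₂} _ _ refl b₂ →
      (assign-run (small-fits (bin times (var 17) (var 1)) b₂
           (tt , tt , subst (_≤ B) (sym prod) (≤-trans (m≤m+n (t * m) m) tm≤)))
    ⟫ λ { {s₃} _ _ refl b₃ → with-agree
        (λ ag (h , _) → trans (onReg ag 17 refl) r17′ , trans (onReg ag 18 refl) (cong (arr s 13) r17′) , h)
        (fill-rule 0 (F-at s t) refl 1≤B b₃ (Env₂.r1 E) (λ k {s′} b′ ag ri _ →
          let val : reg s′ 20 + reg s′ 10 ≡ t * m + toℕ k
              val = cong₂ _+_ (trans (onReg ag 20 refl) prod) ri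
          in proj₁ b′ 10 , small-fits (get 12 offset) b′ (tt , tt , subst (_≤ B) (sym val)
               (≤-trans (+-monoʳ-≤ (t * m) (<⇒≤ (toℕ<n k))) tm≤)) , ri ,
             cong-at (onArr ag 12 refl) val)) }) b₂ }) b₁ }) b
    where
    r17′ : reg s 17 ∸ 1 ≡ t
    r17′ = cong (_∸ 1) r17
    prod : (reg s 17 ∸ 1) * reg s 1 ≡ t * m
    prod = cong₂ _*_ r17′ (Env₂.r1 E)

  prepareTime : ℕ
  prepareTime = 2 + (2 + (fillTime (var 10) (get 0 (var 10)) m + (fillTime (var 10) (get 1 (var 10)) m + fillTime (var 10) maskExp m)))

  prepare-ok : ∀ {s} (f : Fin m → ℕ) → Bounded B s → Env₂ tr s → (∀ e → arr s 11 (toℕ e) ≡ f e) →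
    Runs B prepare s prepareTime (λ s′ → reg s′ 32 ≡ n × reg s′ 33 ≡ m ×
      (∀ e → arr s′ 32 (toℕ e) ≡ toℕ (src e)) × (∀ e → arr s′ 33 (toℕ e) ≡ toℕ (tgt e)) × (∀ e → arr s′ 34 (toℕ e) ≡ mask f e))
  prepare-ok {s} f b E a11 =
    (assign-run (proj₁ b 0)
    ⟫ λ { {s₁} _ _ refl b₁ →
      (assign-run (proj₁ b₁ 1)
    ⟫ λ { {s₂} _ _ refl b₂ →
      (fill-rule 0 (toℕ ∘ src) refl 1≤B b₂ r1 (λ k b′ ag ri _ → proj₁ b′ 10 , small-fits (get 0 (var 10)) b′ tt , ri ,
          trans (cong-at (onArr ag 0 refl) ri) (a0 k))
    ⟫ λ { {s₃} _ ag₃ (h₃ , _) b₃ →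
      (fill-rule 0 (toℕ ∘ tgt) refl 1≤B b₃ (trans (onReg ag₃ 1 refl) r1) (λ k b′ ag ri _ → proj₁ b′ 10 , small-fits (get 1 (var 10)) b′ tt , ri ,
          trans (cong-at (trans (onArr ag 1 refl) (onArr ag₃ 1 refl)) ri) (a1 k))
    ⟫ λ { {s₄} _ ag₄ (h₄ , _) b₄ → with-agree
        (λ ag (h , _) → trans (onReg ag 32 refl) (trans (onReg ag₄ 32 refl) (trans (onReg ag₃ 32 refl) r0)) ,
           trans (onReg ag 33 refl) (trans (onReg ag₄ 33 refl) (trans (onReg ag₃ 33 refl) r1)) ,
           (λ e → trans (cong (λ f → f (toℕ e)) (trans (onArr ag 32 refl) (onArr ag₄ 32 refl))) (h₃ e)) ,
           (λ e → trans (keptAt ag 33 refl (toℕ e)) (h₄ e)) , h)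
        (fill-rule 0 (mask f) refl 1≤B b₄ (trans (onReg ag₄ 1 refl) (trans (onReg ag₃ 1 refl) r1)) (λ k {s′} b′ ag ri _ →
          let v2 : arr s′ 2 (reg s′ 10) ≡ ℓ k
              v2 = trans (cong-at (trans (onArr ag 2 refl) (trans (onArr ag₄ 2 refl) (onArr ag₃ 2 refl))) ri) (a2 k)
              v11 : arr s′ 11 (reg s′ 10) ≡ f k
              v11 = trans (cong-at (trans (onArr ag 11 refl) (trans (onArr ag₄ 11 refl) (onArr ag₃ 11 refl))) ri) (a11 k)
              r6′ : reg s′ 6 ≡ big
              r6′ = trans (onReg ag 6 refl) (trans (onReg ag₄ 6 refl) (trans (onReg ag₃ 6 refl) r6))
              prod : (reg s′ 6 ∸ arr s′ 2 (reg s′ 10)) * (1 ∸ arr s′ 11 (reg s′ 10)) ≡ (big ∸ ℓ k) * (1 ∸ f k)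
              prod = cong₂ _*_ (cong₂ _∸_ r6′ v2) (cong (1 ∸_) v11)
              whole : eval maskExp s′ ≡ mask f k
              whole = cong₂ _+_ v2 prod
          in proj₁ b′ 10 , small-fits maskExp b′ (tt , ((tt , tt) , (1≤B , tt) ,
               subst (_≤ B) (sym prod) (≤-trans (m≤n+m _ (ℓ k)) (≤-trans (mask≤big f k) big≤B))) ,
               subst (_≤ B) (sym whole) (≤-trans (mask≤big f k) big≤B)) , ri , whole)) }) b₃ }) b₂ }) b₁ }) b
    where open Env₂ E

  Scanned : (Fin m → ℕ) → State → Set
  Scanned f s = (reg s 15 ≡ m × ∀ e → Settles (On f) e) ⊎ ∃ λ e → reg s 15 ≡ toℕ e × ¬ Settles (On f) e × limit e < arr s 35 (cell (src e) (tgt e))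

  module _ (f : Fin m → ℕ) where
    open Masked network f (mask f) (mask-positive f) big (mask-on f) (mask-off f)

    settles-iff : ∀ {e d} → Distance′ (src e) (tgt e) d → (d ≤ limit e → Settles (On f) e) × (Settles (On f) e → d ≤ limit e)
    settles-iff {e} D = H-walk (limit<big e) D , λ { (p , a , l) → ≤-trans (H-≤ D p a) l }

    scan-ok : ∀ {s} → Bounded B s → Env₂ tr s → Distances-at f s → Runs B scan s (2 + (6 + (8 * m + m * 17))) (Scanned f)
    scan-ok {s} b E D =
      (assign-run (proj₁ b 1) ⟫ λ { {s₁} _ ag₁ refl b₁ →
        let E₁ = env₂-keep refl refl refl refl ag₁ E in
        runs-mono ≤-refl (λ {s′} → finish′ {s′}) (for-uniform Inv 17 refl refl refl 1≤B b₁ (Env₂.r1 E₁) (inj₁ (Env₂.r1 E , λ _ ()))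
          (body (env₂-keep {10 ≔ lit 0} refl refl refl refl (run-agree {B} (assign {x = 10} {lit 0} {s₁} z≤n)) E₁))) }) b
      where
      d : Fin m → ℕ
      d e = arr s 35 (cell (src e) (tgt e))
      Found : State → Set
      Found s′ = ∃ λ e → reg s′ 15 ≡ toℕ e × ¬ Settles (On f) e × limit e < arr s′ 35 (cell (src e) (tgt e))
      Inv : ℕ → State → Set
      Inv k s′ = (reg s′ 15 ≡ m × ∀ e → toℕ e < k → Settles (On f) e) ⊎ Found s′
      finish′ : ∀ {s′} → Inv m s′ → Scanned f s′
      finish′ (inj₁ (z , h)) = inj₁ (z , λ e → h e (toℕ<n e))
      finish′ (inj₂ p) = inj₂ p
      guard = bin monus pairDistance (get 9 (var 10))
      body : Env₂ tr (setReg (setReg s 15 (reg s 1)) 10 0) → ∀ (k : Fin m) {s′} → Bounded B s′ → Agree _ (setReg (setReg s 15 (reg s 1)) 10 0) s′ → reg s′ 10 ≡ toℕ k → Inv (toℕ k) s′ →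
        Runs B (cond guard (15 ≔ var 10) skip) s′ 17 (λ s″ → Inv (suc (toℕ k)) (setReg s″ 10 (suc (toℕ k))))
      body E₀ k {s′} b′ ag ri inv = runs-mono (≤ᵇ⇒≤ _ _ tt) id
        (runs-cond {T₁ = 2} {T₂ = 1} (small-fits guard b′ (proj₁ c , tt))
          (λ ne → let lt = m∸n≢0⇒n<m (ne ∘ trans val) in
             runs (assign (proj₁ b′ 10)) ≤-refl (inj₂ (k , ri , (λ st → <⇒≱ lt (proj₂ (settles-iff (D _ _)) st)) , subst (limit k <_) (sym v35) lt)))
          (λ eq → runs skip ≤-refl (extend inv (proj₁ (settles-iff (D _ _)) (m∸n≡0⇒m≤n (trans (sym val) eq))))))
        where
        E′ = env₂-keep refl refl refl refl ag E₀
        c = cell-ok {get 0 (var 10)} {get 1 (var 10)} {s′} (Env₂.r0 E′) tt tt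
              (trans (cong (arr s′ 0) ri) (Env₂.a0 E′ k)) (trans (cong (arr s′ 1) ri) (Env₂.a1 E′ k))
        v35 : arr s′ 35 (cell (src k) (tgt k)) ≡ d k
        v35 = cong (λ f → f (cell (src k) (tgt k))) (onArr ag 35 refl)
        val : eval guard s′ ≡ d k ∸ limit k
        val = cong₂ _∸_ (trans (cong (arr s′ 35) (proj₂ c)) v35) (trans (cong (arr s′ 9) ri) (Env₂.a9 E′ k))
        extend : Inv (toℕ k) s′ → Settles (On f) k → Inv (suc (toℕ k)) (setReg s′ 10 (suc (toℕ k)))
        extend (inj₂ p) _ = inj₂ p
        extend (inj₁ (z , h)) st = inj₁ (z , λ { e (s≤s e≤k) → new e e≤k })
          where
          new : ∀ e → toℕ e ≤ toℕ k → Settles (On f) e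
          new e e≤k with e FinP.≟ k
          ... | yes refl = st
          ... | no e≢k = h e (≤∧≢⇒< e≤k (e≢k ∘ toℕ-injective))

  opaque
    pushTime : ℕ
    pushTime = 4 + (fillTime offset (get 11 (var 10)) m + (5 + (3 + 4)))

    pushTime≡ : 4 + (fillTime offset (get 11 (var 10)) m + (5 + (3 + 4))) ≡ pushTime
    pushTime≡ = refl

  Pushed : (Fin m → ℕ) → ℕ → ℕ → Fin m → State → State → Set
  Pushed f q r e s s′ = reg s′ 17 ≡ suc q × arr s′ 13 q ≡ r × Adds f (F-at s′ q) e
    × (∀ x → x < q * m → arr s′ 12 x ≡ arr s 12 x) × (∀ p → p ≢ q → arr s′ 13 p ≡ arr s 13 p)

  push-ok : ∀ {s} f q e → Bounded B s → Env₂ tr s → (∀ e → arr s 11 (toℕ e) ≡ f e) → reg s 17 ≡ q → reg s 14 ≡ toℕ e →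
    q ≤ μ * m → Runs B push s pushTime (Pushed f q (reg s 18) e s)
  push-ok {s} f q e b E a11 r17 r14 q≤ = runs-mono (≤-reflexive pushTime≡) id
    ((assign-run (small-fits (bin times (var 17) (var 1)) b
        (tt , tt , subst (_≤ B) (sym prod) (≤-trans (m≤m+n (q * m) m) qm≤)))
    ⟫ λ { {s₁} _ _ refl b₁ →
      (fill-rule (q * m) f refl 1≤B b₁ (Env₂.r1 E) (λ k {s′} b′ ag ri _ →
          let val : reg s′ 20 + reg s′ 10 ≡ q * m + toℕ k
              val = cong₂ _+_ (trans (onReg ag 20 refl) prod) ri
          in small-fits offset b′ (tt , tt , subst (_≤ B) (sym val) (idx≤ k)) , small-fits (get 11 (var 10)) b′ tt , val ,
             trans (cong-at (onArr ag 11 refl) ri) (a11 k))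
    ⟫ λ { {s₂} _ ag₂ (h₂ , low₂) b₂ →
      let r20 : reg s₂ 20 + reg s₂ 14 ≡ q * m + toℕ e
          r20 = cong₂ _+_ (trans (onReg ag₂ 20 refl) prod) (trans (onReg ag₂ 14 refl) r14)
      in (put-run (small-fits (bin plus (var 20) (var 14)) b₂
            (tt , tt , subst (_≤ B) (sym r20) (idx≤ e))) 1≤B
    ⟫ λ { {s₃} _ _ refl b₃ →
      (put-run (proj₁ b₃ 17) (proj₁ b₃ 18)
    ⟫ λ { {s₄} _ _ refl b₄ →
      let r17₂ : reg s₂ 17 ≡ q
          r17₂ = trans (onReg ag₂ 17 refl) r17
          a12 : ∀ x → (arr s₂ 12 [ reg s₂ 20 + reg s₂ 14 ↦ 1 ]) x ≡ (arr s₂ 12 [ q * m + toℕ e ↦ 1 ]) x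
          a12 x = cong (λ i → (arr s₂ 12 [ i ↦ 1 ]) x) r20
          v : reg s₂ 17 + 1 ≡ suc q
          v = trans (+-comm _ 1) (cong suc r17₂)
      in runs (assign (small-fits (bin plus (var 17) (lit 1)) b₄ (tt , 1≤B , subst (_≤ B) (sym v) sq≤))) ≤-refl
        ( v
        , trans (cong (λ i → (arr s₂ 13 [ i ↦ reg s₂ 18 ]) q) r17₂) (trans (update-hit (arr s₂ 13) q _) (onReg ag₂ 18 refl))
        , ( (λ z → contradiction (trans (sym (trans (a12 _) (update-hit (arr s₂ 12) (q * m + toℕ e) 1))) z) λ ())
          , λ x x≢e → trans (a12 _) (trans (update-miss (arr s₂ 12) 1 (λ p → x≢e (sym (toℕ-injective (+-cancelˡ-≡ (q * m) (toℕ e) (toℕ x) p))))) (h₂ x)) )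
        , (λ x x<qm → trans (a12 x) (trans (update-miss (arr s₂ 12) 1 (λ p → <⇒≱ x<qm (subst (q * m ≤_) p (m≤m+n (q * m) (toℕ e))))) (low₂ x x<qm)))
        , (λ p p≢q → trans (cong (λ i → (arr s₂ 13 [ i ↦ reg s₂ 18 ]) p) r17₂) (trans (update-miss (arr s₂ 13) _ (λ z → p≢q (sym z))) (keptAt ag₂ 13 refl p))) )
      }) b₃ }) b₂ }) b₁ }) b)
    where
    prod : reg s 17 * reg s 1 ≡ q * m
    prod = cong₂ _*_ r17 (Env₂.r1 E)
    qm≤ : q * m + m ≤ B
    qm≤ = ≤-trans (+-monoˡ-≤ m (*-monoˡ-≤ m (m≤n⇒m≤1+n q≤))) stack≤
    idx≤ : ∀ (k : Fin m) → q * m + toℕ k ≤ B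
    idx≤ k = ≤-trans (+-monoʳ-≤ (q * m) (<⇒≤ (toℕ<n k))) qm≤
    1≤m : 1 ≤ m
    1≤m = ≤-trans (s≤s z≤n) (toℕ<n e)
    sq≤ : suc q ≤ B
    sq≤ = ≤-trans (≤-trans (s≤s q≤) (≤-trans (≤-reflexive (sym (*-identityʳ _))) (*-monoʳ-≤ (suc (μ * m)) 1≤m))) (≤-trans (m≤m+n _ m) stack≤)

  cand : (M D : Fin n → ℕ) → Fin m → ℕ
  cand M D e = ((M (tgt e) ∸ ℓ e) ∸ D (src e)) + ((M (src e) ∸ ℓ e) ∸ D (tgt e))

  record Branched (f c : Fin m → ℕ) (t r k : ℕ) (s s′ : State) : Set where
    field
      top  : reg s′ 17 ≡ t + prefix (ind ∘ c) k
      low  : ∀ x → x < t * m → arr s′ 12 x ≡ arr s 12 x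
      lowᵣ : ∀ p → p < t → arr s′ 13 p ≡ arr s 13 p
      new  : ∀ p → t ≤ p → p < t + prefix (ind ∘ c) k → arr s′ 13 p ≡ r × ∃ λ e → c e ≢ 0 × Adds f (F-at s′ p) e
      all  : ∀ e → toℕ e < k → c e ≢ 0 → ∃ λ p → t ≤ p × p < t + prefix (ind ∘ c) k × Adds f (F-at s′ p) e

  -- Testing an edge costs at most 23, whereas a push copies a whole edge set. The number of pushes
  -- is kept apart so that they can be charged to the children.
  branchTime : ℕ → ℕ
  branchTime cnt = 6 + (8 * m + (m * 23 + cnt * pushTime))

  then-time : ∀ {t P x} → t ≤ P → x ≢ 0 → 22 + t ≤ 23 + ind x * P
  then-time {x = zero}  _ x≢0 = contradiction refl x≢0
  then-time {t} {P} {suc x} t≤P _ = ≤-trans (+-mono-≤ (n≤1+n 22) t≤P) (≤-reflexive (cong (23 +_) (sym (*-identityˡ P))))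

  prefix-taken : ∀ {c : Fin m → ℕ} k → c k ≢ 0 → prefix (ind ∘ c) (suc (toℕ k)) ≡ suc (prefix (ind ∘ c) (toℕ k))
  prefix-taken {c} k ck = trans (prefix-suc (ind ∘ c) k) (trans (cong (prefix (ind ∘ c) (toℕ k) +_) (ind-≢0 ck)) (+-comm _ 1))

  prefix-skipped : ∀ {c : Fin m → ℕ} k → c k ≡ 0 → prefix (ind ∘ c) (suc (toℕ k)) ≡ prefix (ind ∘ c) (toℕ k)
  prefix-skipped {c} k ck = trans (prefix-suc (ind ∘ c) k) (trans (cong (λ z → prefix (ind ∘ c) (toℕ k) + ind z) ck) (+-identityʳ _))

  ∑ind≤m : ∀ (c : Fin m → ℕ) → ∑ (ind ∘ c) ≤ m
  ∑ind≤m c = ≤-trans (∑-mono (λ e → ind≤1 (c e))) (≤-reflexive (trans (∑-const {m} 1) (*-identityʳ m)))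

  branched-push : ∀ {f c t r} (k : Fin m) {s s₁ s₂} → c k ≢ 0 → Branched f c t r (toℕ k) s s₁ →
    Pushed f (t + prefix (ind ∘ c) (toℕ k)) r k s₁ s₂ → Branched f c t r (suc (toℕ k)) s s₂
  branched-push {f} {c} {t} {r} k {s} {s₁} {s₂} ck Br (r17 , a13 , adds , low₂ , rest₂) = record
    { top  = trans r17 (sym next)
    ; low  = λ x x<tm → trans (low₂ x (≤-trans x<tm (*-monoˡ-≤ m (m≤m+n t _)))) (low x x<tm)
    ; lowᵣ = λ p p<t → trans (rest₂ p (<⇒≢ (≤-trans p<t (m≤m+n t _)))) (lowᵣ p p<t)
    ; new  = new′
    ; all  = all′ }
    where
    open Branched Br
    q = t + prefix (ind ∘ c) (toℕ k)
    next : t + prefix (ind ∘ c) (suc (toℕ k)) ≡ suc q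
    next = trans (cong (t +_) (prefix-taken {c} k ck)) (+-suc t _)
    keep : ∀ {p} → p < q → ∀ {e} → Adds f (F-at s₁ p) e → Adds f (F-at s₂ p) e
    keep {p} p<q (ne , same) = (ne ∘ trans (sym (old _))) , λ x x≢e → trans (old x) (same x x≢e)
      where
      old : ∀ x → F-at s₂ p x ≡ F-at s₁ p x
      old x = low₂ _ (≤-trans (+-monoʳ-< (p * m) (toℕ<n x)) (≤-trans (≤-reflexive (+-comm (p * m) m)) (*-monoˡ-≤ m p<q)))
    new′ : ∀ p → t ≤ p → p < t + prefix (ind ∘ c) (suc (toℕ k)) → arr s₂ 13 p ≡ r × ∃ λ e → c e ≢ 0 × Adds f (F-at s₂ p) e
    new′ p t≤p p< with p ≟ q
    ... | yes refl = a13 , k , ck , adds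
    ... | no p≢q with ≤∧≢⇒< (≤-pred (≤-trans p< (≤-reflexive next))) p≢q
    ...   | p<q with new p t≤p p<q
    ...     | eq , e , ce , ad = trans (rest₂ p p≢q) eq , e , ce , keep p<q ad
    all′ : ∀ e → toℕ e < suc (toℕ k) → c e ≢ 0 → ∃ λ p → t ≤ p × p < t + prefix (ind ∘ c) (suc (toℕ k)) × Adds f (F-at s₂ p) e
    all′ e (s≤s e≤k) ce with e FinP.≟ k
    ... | yes refl = q , m≤m+n t _ , ≤-reflexive (sym next) , adds
    ... | no e≢k with all e (≤∧≢⇒< e≤k (e≢k ∘ toℕ-injective)) ce
    ...   | p , t≤p , p<q , ad = p , t≤p , ≤-trans p<q (≤-trans (n≤1+n q) (≤-reflexive (sym next))) , keep p<q ad

  branched-skip : ∀ {f c t r} (k : Fin m) {s s₁} → c k ≡ 0 → Branched f c t r (toℕ k) s s₁ → Branched f c t r (suc (toℕ k)) s s₁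
  branched-skip {f} {c} {t} {r} k {s} {s₁} ck Br = record
    { top = trans top (cong (t +_) (sym eq)) ; low = low ; lowᵣ = lowᵣ
    ; new = λ p t≤p p< → new p t≤p (subst (λ z → p < t + z) eq p<)
    ; all = all′ }
    where
    open Branched Br
    eq = prefix-skipped {c} k ck
    all′ : ∀ e → toℕ e < suc (toℕ k) → c e ≢ 0 → _
    all′ e (s≤s e≤k) ce with e FinP.≟ k
    ... | yes refl = contradiction ck ce
    ... | no e≢k with all e (≤∧≢⇒< e≤k (e≢k ∘ toℕ-injective)) ce
    ...   | p , t≤p , p< , ad = p , t≤p , subst (λ z → p < t + z) (sym eq) p< , ad

  branched-setReg : ∀ {f c t r k s s₁ v} → Branched f c t r k s s₁ → Branched f c t r k s (setReg s₁ 14 v)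
  branched-setReg Br = record { top = top ; low = low ; lowᵣ = lowᵣ ; new = new ; all = all }
    where open Branched Br

  branch-ok : ∀ {s} f (M D : Fin n → ℕ) t → Bounded B s → Env₂ tr s → (∀ e → arr s 11 (toℕ e) ≡ f e) → reg s 17 ≡ t →
    (∀ y → arr s 6 (toℕ y) ≡ M y) → (∀ y → arr s 8 (toℕ y) ≡ D y) → (∀ y → M y ≤ big) → t + m ≤ μ * m →
    Runs B branch s (branchTime (∑ (ind ∘ cand M D))) (Branched f (cand M D) t (reg s 18) m s)
  branch-ok {s} f M D t b E a11 r17 a6 a8 M≤ t+m≤ =
    runs-mono (≤-reflexive (cong (λ z → 6 + (8 * m + z)) (∑-affine 23 pushTime (ind ∘ c)))) proj₁
      (for-rule (λ k s′ → Branched f c t (reg s 18) k s s′) (λ e → 23 + ind (c e) * pushTime) refl refl refl 1≤B b (Env₂.r1 E)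
        (record { top = trans r17 (sym (trans (cong (t +_) (prefix-zero (ind ∘ c))) (+-identityʳ t)))
                ; low = λ _ _ → refl ; lowᵣ = λ _ _ → refl
                ; new = λ p t≤p p< → contradiction (≤-trans p< (≤-reflexive (trans (cong (t +_) (prefix-zero (ind ∘ c))) (+-identityʳ t)))) (≤⇒≯ t≤p)
                ; all = λ _ () })
        body)
    where
    c = cand M D
    s₀ = setReg s 14 0
    body : ∀ (k : Fin m) {s′} → Bounded B s′ → Agree (cond candidateExp push skip ⨾ 14 ≔ bin plus (var 14) (lit 1)) s₀ s′ →
      reg s′ 14 ≡ toℕ k → Branched f c t (reg s 18) (toℕ k) s s′ →
      Runs B (cond candidateExp push skip) s′ (23 + ind (c k) * pushTime) (λ s″ → Branched f c t (reg s 18) (suc (toℕ k)) s (setReg s″ 14 (suc (toℕ k))))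
    body k {s′} b′ ag ri Br = decide (c k ≟ 0)
      where
      E′ = env₂-keep refl refl refl refl ag (env₂-keep {14 ≔ lit 0} refl refl refl refl (run-agree {B} (assign {x = 14} {lit 0} {s} z≤n)) E)
      v0 : arr s′ 0 (reg s′ 14) ≡ toℕ (src k)
      v0 = trans (cong (arr s′ 0) ri) (Env₂.a0 E′ k)
      v1 : arr s′ 1 (reg s′ 14) ≡ toℕ (tgt k)
      v1 = trans (cong (arr s′ 1) ri) (Env₂.a1 E′ k)
      v2 : arr s′ 2 (reg s′ 14) ≡ ℓ k
      v2 = trans (cong (arr s′ 2) ri) (Env₂.a2 E′ k)
      m6 : ∀ {x y} → x ≡ toℕ y → arr s′ 6 x ≡ M y
      m6 {y = y} eq = trans (cong-at (onArr ag 6 refl) eq) (a6 y)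
      m8 : ∀ {x y} → x ≡ toℕ y → arr s′ 8 x ≡ D y
      m8 {y = y} eq = trans (cong-at (onArr ag 8 refl) eq) (a8 y)
      val : eval candidateExp s′ ≡ c k
      val = cong₂ _+_ (cong₂ _∸_ (cong₂ _∸_ (m6 v1) v2) (m8 v0)) (cong₂ _∸_ (cong₂ _∸_ (m6 v0) v2) (m8 v1))
      c≤ : c k ≤ B
      c≤ = ≤-trans (+-mono-≤ (≤-trans (m∸n≤m _ (D (src k))) (≤-trans (m∸n≤m _ (ℓ k)) (M≤ (tgt k))))
                             (≤-trans (m∸n≤m _ (D (tgt k))) (≤-trans (m∸n≤m _ (ℓ k)) (M≤ (src k))))) big+big≤
      fits : Fits B candidateExp s′
      fits = small-fits candidateExp b′ (((tt , tt) , tt) , ((tt , tt) , tt) , subst (_≤ B) (sym val) c≤)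
      decide : Dec (c k ≡ 0) → Runs B (cond candidateExp push skip) s′ (23 + ind (c k) * pushTime) (λ s″ → Branched f c t (reg s 18) (suc (toℕ k)) s (setReg s″ 14 (suc (toℕ k))))
      decide (yes ck) = runs (else′ fits (trans val ck) skip) (m≤m+n 23 _) (branched-setReg (branched-skip k ck Br))
      decide (no ck) = taken (push-ok f q k b′ E′ (λ e → trans (keptAt ag 11 refl (toℕ e)) (a11 e))
          (Branched.top Br) ri (≤-trans (+-monoʳ-≤ t (≤-trans (prefix≤∑ (ind ∘ c) (toℕ k)) (∑ind≤m c))) t+m≤))
        where
        q = t + prefix (ind ∘ c) (toℕ k)
        taken : Runs B push s′ pushTime (Pushed f q (reg s′ 18) k s′) →
          Runs B (cond candidateExp push skip) s′ (23 + ind (c k) * pushTime) (λ s″ → Branched f c t (reg s 18) (suc (toℕ k)) s (setReg s″ 14 (suc (toℕ k))))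
        taken (runs {final = s″} p l pu) = runs (then′ fits (ck ∘ trans (sym val)) p)
              (then-time l ck)
              (branched-setReg (branched-push k ck Br (subst (λ z → Pushed f q z k s′ s″) (onReg ag 18 refl) pu)))

  Focused : (Fin m → ℕ) → Fin m → ℕ → (Fin n → ℕ) → State → Set
  Focused f e r D s =
      (∀ z → Masked.Distance′ network f (mask f) (mask-positive f) big (mask-on f) (mask-off f) (src e) z (D z))
    × limit e < D (tgt e)
    × Departures.Latest network (λ _ → 1) D (tgt e) (suc (limit e)) (λ y → arr s 6 (toℕ y))
    × (∀ y → arr s 8 (toℕ y) ≡ D y)
    × reg s 18 ≡ r

  focusTime : ℕ
  focusTime = fillTime (var 10) (get 35 (cellExp (get 0 (var 15)) (var 10))) n +
    (fillTime (var 10) (lit 1) m + (3 + (5 + (200 * pass + 4))))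

  focus-ok : ∀ {s} f e r → Bounded B s → Env₂ tr s → Distances-at f s → reg s 15 ≡ toℕ e → limit e < arr s 35 (cell (src e) (tgt e)) →
    reg s 18 ≡ suc r → Runs B focus s focusTime (λ s′ → ∃ λ D → Focused f e r D s′)
  focus-ok {s} f e r b E dist-ok r15 far r18 =
    (fill-rule 0 row refl 1≤B b (Env₂.r0 E) (λ k {s′} b′ ag ri _ →
       let E′ = env₂-keep refl refl refl refl ag (env₂-keep {10 ≔ lit 0} refl refl refl refl (run-agree {B} (assign {x = 10} {lit 0} {s} z≤n)) E)
           c = cell-ok {get 0 (var 15)} {var 10} {s′} (Env₂.r0 E′) tt tt (trans (cong (arr s′ 0) (trans (onReg ag 15 refl) r15)) (Env₂.a0 E′ e)) ri
       in proj₁ b′ 10 , small-fits (get 35 (cellExp (get 0 (var 15)) (var 10))) b′ (proj₁ c) , ri ,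
          cong-at (onArr ag 35 refl) (proj₂ c))
    ⟫ λ { {s₁} _ ag₁ (h₁ , _) b₁ →
      let E₁ = env₂-keep refl refl refl refl ag₁ E in
      (fill-rule 0 (λ _ → 1) refl 1≤B b₁ (Env₂.r1 E₁) (λ k b′ ag ri _ → proj₁ b′ 10 , 1≤B , ri , refl)
    ⟫ λ { {s₂} _ ag₂ (ones , _) b₂ →
      let E₂ = env₂-keep refl refl refl refl ag₂ E₁
          r15₂ = trans (onReg ag₂ 15 refl) (trans (onReg ag₁ 15 refl) r15)
          D : Fin n → ℕ
          D y = arr s₂ 8 (toℕ y)
          D≡ : ∀ y → D y ≡ row y
          D≡ y = trans (keptAt ag₂ 8 refl (toℕ y)) (h₁ y)
          v9 : arr s₂ 9 (reg s₂ 15) + 1 ≡ suc (limit e)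
          v9 = trans (+-comm _ 1) (cong suc (trans (cong (arr s₂ 9) r15₂) (Env₂.a9 E₂ e)))
      in (assign-run (small-fits (get 1 (var 15)) b₂ tt)
    ⟫ λ { {s₃} _ ag₃ refl b₃ →
      (assign-run (small-fits (bin plus (get 9 (var 15)) (lit 1)) b₃
          (tt , 1≤B , subst (_≤ B) (sym v9) (≤-trans (limit<big e) big≤B)))
    ⟫ λ { {s₄} _ ag₄ refl b₄ →
      (Dijkstra.departures-ok (λ _ → 1) (tgt e) (suc (limit e)) (limit<big e) b₄
          (Env₂.env₁ (env₂-keep refl refl refl refl ag₄ (env₂-keep refl refl refl refl ag₃ E₂))) ones
          (trans (cong (arr s₂ 1) r15₂) (Env₂.a1 E₂ e)) v9
    ⟫ λ { {s₅} _ ag₅ L b₅ →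
      runs (assign (small-fits (bin monus (var 18) (lit 1)) b₅ (tt , 1≤B))) ≤-refl
        (D , (λ z → subst (Masked.Distance′ network f (mask f) (mask-positive f) big (mask-on f) (mask-off f) (src e) z) (sym (D≡ z)) (dist-ok (src e) z)) ,
         subst (limit e <_) (sym (D≡ (tgt e))) far , L ,
         (λ y → keptAt ag₅ 8 refl (toℕ y)) ,
         cong (_∸ 1) (trans (onReg ag₅ 18 refl) (trans (onReg ag₂ 18 refl) (trans (onReg ag₁ 18 refl) r18)))) }) b₄ }) b₃ }) b₂ }) b₁ }) b
    where
    row : Fin n → ℕ
    row y = arr s 35 (cell (src e) y)

  -- What the search needs of a branching set: `hits` gives completeness, `fresh` gives progress,
  -- `visited` bounds the degree.
  record Candidates (f : Fin m → ℕ) (e : Fin m) (c : Fin m → ℕ) : Set where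
    field
      fresh   : ∀ {x} → c x ≢ 0 → f x ≡ 0
      hits    : ∀ (p : Walk (src e) (tgt e)) → len ℓ p ≤ limit e → ∃ λ x → x ∈ edges p × c x ≢ 0
      visited : ∀ {x} → c x ≢ 0 → Visited e (src x) × Visited e (tgt x)

  focused-candidates : ∀ {f e r D s} → Focused f e r D s → Candidates f e (cand (λ y → arr s 6 (toℕ y)) D)
  focused-candidates {f} {e} {r} {D} {s} (D-dist , far , L , _ , _) = record { fresh = fresh ; hits = hits ; visited = visited }
    where
    open Branching network f (mask f) (mask-positive f) big (mask-on f) (mask-off f) (src e) (tgt e) (limit e) (limit<big e) D D-dist far
    M : Fin n → ℕ
    M y = arr s 6 (toℕ y)
    c = cand M D
    split : ∀ {a b} → a + b ≢ 0 → a ≢ 0 ⊎ b ≢ 0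
    split {zero}  ne = inj₂ ne
    split {suc a} ne = inj₁ λ ()
    oriented : ∀ {x} → c x ≢ 0 → Candidate L x (src x) (tgt x) ⊎ Candidate L x (tgt x) (src x)
    oriented {x} cx with split {(M (tgt x) ∸ ℓ x) ∸ D (src x)} cx
    ... | inj₁ ne = inj₁ (joined x , <∸⇒+< (M (tgt x)) (ℓ x) (D (src x)) (m∸n≢0⇒n<m ne))
    ... | inj₂ ne = inj₂ (flip (joined x) , <∸⇒+< (M (src x)) (ℓ x) (D (tgt x)) (m∸n≢0⇒n<m ne))
    fresh : ∀ {x} → c x ≢ 0 → f x ≡ 0
    fresh cx with oriented cx
    ... | inj₁ q = candidate-new L q
    ... | inj₂ q = candidate-new L q
    hits : ∀ (p : Walk (src e) (tgt e)) → len ℓ p ≤ limit e → ∃ λ x → x ∈ edges p × c x ≢ 0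
    hits p l with candidate-exists L p l
    ... | x , x∈ , _ , _ , inj₁ (refl , refl) , lt = x , x∈ , λ z →
          m>n⇒m∸n≢0 (+<⇒<∸ (M (tgt x)) (ℓ x) (D (src x)) lt) (m+n≡0⇒m≡0 _ z)
    ... | x , x∈ , _ , _ , inj₂ (refl , refl) , lt = x , x∈ , λ z →
          m>n⇒m∸n≢0 (+<⇒<∸ (M (src x)) (ℓ x) (D (tgt x)) lt) (m+n≡0⇒n≡0 ((M (tgt x) ∸ ℓ x) ∸ D (src x)) z)
    visited : ∀ {x} → c x ≢ 0 → Visited e (src x) × Visited e (tgt x)
    visited cx with oriented cx
    ... | inj₁ q with candidate-path L q
    ...   | P , l , a , b = (P , settling⁺ P l , a) , (P , settling⁺ P l , b)
    visited cx | inj₂ q with candidate-path L q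
    ...   | P , l , a , b = (P , settling⁺ P l , b) , (P , settling⁺ P l , a)

  expand-ok : ∀ {s} f e r t → Bounded B s → Env₂ tr s → (∀ e → arr s 11 (toℕ e) ≡ f e) → Distances-at f s →
    reg s 15 ≡ toℕ e → limit e < arr s 35 (cell (src e) (tgt e)) → reg s 17 ≡ t → reg s 18 ≡ suc r → t + m ≤ μ * m →
    ∃ λ c → Candidates f e c × Runs B expand s (focusTime + branchTime (∑ (ind ∘ c))) (Branched f c t r m s)
  expand-ok {s} f e r t b E a11 dist-ok r15 far r17 r18 t+m≤ = branched (focus-ok f e r b E dist-ok r15 far r18)
    where
    Result : Set
    Result = ∃ λ c → Candidates f e c × Runs B expand s (focusTime + branchTime (∑ (ind ∘ c))) (Branched f c t r m s)
    joined-up : ∀ {s₁ s₂ c k} → Agree focus s s₁ → reg s₁ 18 ≡ r → Branched f c t (reg s₁ 18) k s₁ s₂ → Branched f c t r k s s₂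
    joined-up ag r18₁ Br = record
      { top = top
      ; low = λ x x< → trans (low x x<) (keptAt ag 12 refl x)
      ; lowᵣ = λ x x< → trans (lowᵣ x x<) (keptAt ag 13 refl x)
      ; new = λ p t≤p p< → let eq , rest = new p t≤p p< in trans eq r18₁ , rest
      ; all = all }
      where open Branched Br
    then-branch : ∀ {s₁ t₁ T₂ c} → B ⊢ focus , s ⇓[ t₁ ] s₁ → t₁ ≤ focusTime → reg s₁ 18 ≡ r →
      Runs B branch s₁ T₂ (Branched f c t (reg s₁ 18) m s₁) → Runs B expand s (focusTime + T₂) (Branched f c t r m s)
    then-branch p l r18₁ (runs q l′ Br) = runs (seq p q) (+-mono-≤ l l′) (joined-up (run-agree p) r18₁ Br)
    branched : Runs B focus s focusTime (λ s′ → ∃ λ D → Focused f e r D s′) → Result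
    branched (runs {final = s₁} p l (D , Fo@(_ , _ , L , a8 , r18₁))) = cand M D , focused-candidates {s = s₁} Fo ,
      then-branch p l r18₁ (branch-ok f M D t (run-bounded p b) (env₂-keep refl refl refl refl ag E) (λ e → trans (keptAt ag 11 refl (toℕ e)) (a11 e))
                  (trans (onReg ag 17 refl) r17) (λ _ → refl) a8
                  (λ y → ≤-trans (Departures.latest-≤R network (λ _ → 1) D (tgt e) (suc (limit e)) L y) (limit<big e)) t+m≤)
      where
      ag = run-agree p
      M : Fin n → ℕ
      M y = arr s₁ 6 (toℕ y)

  -- The second part bounds the stack: each edge that remains to be added to the subproblem at
  -- height `p` may raise the stack by at most `m` further rows.
  Task : State → ℕ → Set
  Task s p = Legal trivial (F-at s p) (arr s 13 p) × p + arr s 13 p * m ≤ μ * m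

  record Live (s : State) : Set where
    field
      unfound : reg s 16 ≡ 0
      tasks   : ∀ p → p < reg s 17 → Task s p
      cover   : Solvable → ∃ λ p → p < reg s 17 × Good (F-at s p) (arr s 13 p)

  record Won (s : State) : Set where
    field
      found    : reg s 16 ≡ 1
      empty    : reg s 17 ≡ 0
      solution : Solvable

  -- The potential: what remains to be searched below all stacked subproblems, if no node has more
  -- than `b` children.
  Φ : ℕ → State → ℕ
  Φ b s = sumBelow (reg s 17) (λ p → treeSize b (arr s 13 p))

  record Outcome (s : State) (cnt : ℕ) (s′ : State) : Set where
    field
      env      : Env₂ tr s′
      status   : Live s′ ⊎ Won s′
      decrease : ∀ b → cnt ≤ b → suc (cnt + Φ b s′) ≤ Φ b s
      cnt≤m    : cnt ≤ m
      cnt≤h²   : ∀ h → LocalNeighborhoodSize h → cnt ≤ h * h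

  module _ {s t} (r17 : reg s 17 ≡ suc t) where

    Φ-top : ∀ b → Φ b s ≡ sumBelow t (λ p → treeSize b (arr s 13 p)) + treeSize b (arr s 13 t)
    Φ-top b = cong (λ k → sumBelow k (λ p → treeSize b (arr s 13 p))) r17

    module _ (L : Live s) where
      open Live L

      top-task : Task s t
      top-task = tasks t (≤-reflexive (sym r17))

      drop-live : ∀ {s′} → arr s′ 12 ≡ arr s 12 → arr s′ 13 ≡ arr s 13 → reg s′ 16 ≡ 0 → reg s′ 17 ≡ t →
        ¬ Good (F-at s t) (arr s 13 t) → Live s′
      drop-live {s′} a12 a13 r16 r17′ bad = record { unfound = r16 ; tasks = tasks′ ; cover = cover′ }
        where
        tasks′ : ∀ p → p < reg s′ 17 → Task s′ p
        tasks′ p p< rewrite a12 | a13 = tasks p (≤-trans p< (≤-trans (≤-reflexive r17′) (≤-trans (n≤1+n t) (≤-reflexive (sym r17)))))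
        cover′ : Solvable → ∃ λ p → p < reg s′ 17 × Good (F-at s′ p) (arr s′ 13 p)
        cover′ sol rewrite a12 | a13 with cover sol
        ... | p , p< , g with p ≟ t
        ...   | yes refl = contradiction g bad
        ...   | no p≢t = p , ≤-trans (≤∧≢⇒< (≤-pred (≤-trans p< (≤-reflexive r17))) p≢t) (≤-reflexive (sym r17′)) , g

      drop-decrease : ∀ {s′} → arr s′ 13 ≡ arr s 13 → reg s′ 17 ≡ t → ∀ b → suc (0 + Φ b s′) ≤ Φ b s
      drop-decrease {s′} a13 r17′ b = ≤-trans (≤-reflexive (+-comm 1 (Φ b s′)))
        (≤-trans (+-mono-≤ (≤-reflexive (trans (cong (λ k → sumBelow k (λ p → treeSize b (arr s′ 13 p))) r17′)
                    (cong (λ a → sumBelow t (λ p → treeSize b (a p))) a13))) (1≤treeSize b (arr s 13 t)))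
                 (≤-reflexive (sym (Φ-top b))))

      module _ {r c e s′} (rt : arr s 13 t ≡ suc r) (C : Candidates (F-at s t) e c)
               (Br : Branched (F-at s t) c t r m s s′) where
        private
          module Br = Branched Br
          module C = Candidates C
          total : prefix (ind ∘ c) m ≡ ∑ (ind ∘ c)
          total = prefix-all (ind ∘ c)
          old : ∀ {p} → p < t → ∀ e → F-at s′ p e ≡ F-at s p e
          old {p} p<t e = Br.low _ (≤-trans (+-monoʳ-< (p * m) (toℕ<n e)) (≤-trans (≤-reflexive (+-comm (p * m) m)) (*-monoˡ-≤ m p<t)))
          below-top : ∀ {p} → p < t → p < reg s 17
          below-top p<t = ≤-trans p<t (≤-trans (n≤1+n t) (≤-reflexive (sym r17)))

        branch-live : reg s′ 16 ≡ 0 → Live s′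
        branch-live r16 = record { unfound = r16 ; tasks = tasks′ ; cover = cover′ }
          where
          tasks′ : ∀ p → p < reg s′ 17 → Task s′ p
          tasks′ p p< with p <? t
          ... | yes p<t with tasks p (below-top p<t)
          ...   | legal , room′ = legal-resp trivial (λ x → sym (old p<t x)) (subst (Legal trivial (F-at s p)) (sym (Br.lowᵣ p p<t)) legal) ,
                  subst (λ z → p + z * m ≤ μ * m) (sym (Br.lowᵣ p p<t)) room′
          tasks′ p p< | no p≮t with Br.new p (≮⇒≥ p≮t) (≤-trans p< (≤-reflexive Br.top)) | top-task
          ... | eq , x , cx , adds | legal , room′ =
            subst (Legal trivial (F-at s′ p)) (sym eq) (legal-add trivial (subst (Legal trivial (F-at s t)) rt legal) adds) ,
            subst (λ z → p + z * m ≤ μ * m) (sym eq) (≤-trans (+-monoˡ-≤ (r * m) p≤)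
              (≤-trans (≤-reflexive (+-assoc t m (r * m))) (subst (λ z → t + z * m ≤ μ * m) rt room′)))
            where
            p≤ : p ≤ t + m
            p≤ = <⇒≤ (≤-trans p< (≤-trans (≤-reflexive Br.top) (+-monoʳ-≤ t (≤-trans (≤-reflexive total) (∑ind≤m c)))))
          cover′ : Solvable → ∃ λ p → p < reg s′ 17 × Good (F-at s′ p) (arr s′ 13 p)
          cover′ sol with cover sol
          ... | p , p< , g with p <? t
          ...   | yes p<t = p , ≤-trans p<t (≤-trans (m≤m+n t _) (≤-reflexive (sym Br.top))) ,
                  subst (Good (F-at s′ p)) (sym (Br.lowᵣ p p<t)) (good-resp (λ x → sym (old p<t x)) g)
          ...   | no p≮t with ≤-antisym (≤-pred (≤-trans p< (≤-reflexive r17))) (≮⇒≥ p≮t)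
          ...     | refl with good-branch (subst (Good (F-at s t)) rt g) C.fresh C.hits
          ...       | x , cx , extend with Br.all x (toℕ<n x) cx
          ...         | q , t≤q , q< , adds = q , ≤-trans q< (≤-reflexive (sym Br.top)) ,
                        subst (Good (F-at s′ q)) (sym (proj₁ (Br.new q t≤q q<))) (extend adds)

        -- The size `1 + b * (1 + N)` of the popped tree pays for the node, for at most `b` pushes
        -- and for the subtrees pushed.
        branch-decrease : ∀ b → ∑ (ind ∘ c) ≤ b → suc (∑ (ind ∘ c) + Φ b s′) ≤ Φ b s
        branch-decrease b cnt≤b = begin
          suc (k + Φ b s′)               ≡⟨ cong (λ z → suc (k + z)) Φ′ ⟩
          suc (k + (rest + k * N))       ≡⟨ solve 3 (λ k r n → con 1 :+ (k :+ (r :+ k :* n)) := r :+ (con 1 :+ k :* (con 1 :+ n))) refl k rest N ⟩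
          rest + suc (k * suc N)         ≤⟨ +-monoʳ-≤ rest (s≤s (*-monoˡ-≤ (suc N) cnt≤b)) ⟩
          rest + treeSize b (suc r)      ≡⟨ cong (λ z → rest + treeSize b z) rt ⟨
          rest + treeSize b (arr s 13 t) ≡⟨ Φ-top b ⟨
          Φ b s                          ∎
          where
          open ≤-Reasoning
          k = ∑ (ind ∘ c)
          N = treeSize b r
          rest = sumBelow t (λ p → treeSize b (arr s 13 p))
          top′ : reg s′ 17 ≡ t + k
          top′ = trans Br.top (cong (t +_) total)
          Φ′ : Φ b s′ ≡ rest + k * N
          Φ′ = trans (cong (λ z → sumBelow z (λ p → treeSize b (arr s′ 13 p))) top′)
            (trans (sumBelow-block t k (λ p t≤p p< → cong (treeSize b) (proj₁ (Br.new p t≤p (subst (λ z → p < t + z) (sym total) p<)))))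
              (cong (_+ k * N) (sumBelow-cong t (λ p p<t → cong (treeSize b) (Br.lowᵣ p p<t)))))

  -- Sequencing for a time bound that depends on the number of candidates, which is known only once
  -- the last command has run.
  _⟫∃_ : ∀ {X : Set} {c d s T₁} {T₂ : X → ℕ} {P} {Q : X → State → Set} → Runs B c s T₁ P →
    (∀ {s′} → Bounded B s → Agree c s s′ → P s′ → Bounded B s′ → ∃ λ x → Runs B d s′ (T₂ x) (Q x)) →
    Bounded B s → ∃ λ x → Runs B (c ⨾ d) s (T₁ + T₂ x) (Q x)
  (runs p l x ⟫∃ k) b with k b (run-agree p) x (run-bounded p b)
  ... | y , runs q l′ z = y , runs (seq p q) (+-mono-≤ l l′) z

  infixr 4 _⟫∃_

  finishTime : ℕ
  finishTime = 100 * pass + 9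

  record Popped (s : State) (t : ℕ) (s′ : State) : Set where
    field
      env : Env₂ tr s′
      a11 : ∀ e → arr s′ 11 (toℕ e) ≡ F-at s t e
      a12 : arr s′ 12 ≡ arr s 12
      a13 : arr s′ 13 ≡ arr s 13
      r16 : reg s′ 16 ≡ 0
      r17 : reg s′ 17 ≡ t
      r18 : reg s′ 18 ≡ arr s 13 t

  popped-keep : ∀ {c s t s′ s″} → anyBelow 8 (writesReg c) ≡ false → anyBelow 4 (writesArr c) ≡ false →
    writesArr c 9 ≡ false → writesArr c 10 ≡ false → writesArr c 11 ≡ false → writesArr c 12 ≡ false → writesArr c 13 ≡ false →
    writesReg c 16 ≡ false → writesReg c 17 ≡ false → writesReg c 18 ≡ false → Agree c s′ s″ → Popped s t s′ → Popped s t s″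
  popped-keep kr ka k9 k10 k11 k12 k13 k16 k17 k18 ag P = record
    { env = env₂-keep kr ka k9 k10 ag env
    ; a11 = λ e → trans (keptAt ag 11 k11 (toℕ e)) (a11 e)
    ; a12 = trans (onArr ag 12 k12) a12 ; a13 = trans (onArr ag 13 k13) a13
    ; r16 = trans (onReg ag 16 k16) r16 ; r17 = trans (onReg ag 17 k17) r17 ; r18 = trans (onReg ag 18 k18) r18 }
    where open Popped P

  module _ {s t} (r17 : reg s 17 ≡ suc t) (L : Live s) where

    drop-outcome : ∀ {s′} → Popped s t s′ → ¬ Good (F-at s t) (arr s 13 t) → Outcome s 0 s′
    drop-outcome {s′} P bad = record
      { env = env ; status = inj₁ (drop-live r17 L a12 a13 r16 r17′ bad)
      ; decrease = λ b _ → drop-decrease r17 L {s′} a13 r17′ b ; cnt≤m = z≤n ; cnt≤h² = λ _ _ → z≤n }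
      where open Popped P renaming (r17 to r17′)

    finish-ok : ∀ {s′} → Bounded B s′ → Popped s t s′ → (∀ e → Settles (On (F-at s t)) e) → Runs B finish s′ finishTime (Outcome s 0)
    finish-ok {s′} b P settled =
      (weigh-ok b (Env₂.env (Popped.env P)) (F-at s t) (Popped.a11 P)
      ⟫ λ { {s₁} _ ag r19 b₁ →
        let P₁ = popped-keep refl refl refl refl refl refl refl refl refl refl ag P
            guard = bin monus (var 19) (var 4)
            val : eval guard s₁ ≡ wt (F-at s t) ∸ W
            val = cong₂ _∸_ r19 (Env₂.r4 (Popped.env P₁))
        in runs-cond {T₁ = 1} {T₂ = 4} (small-fits guard b₁ (tt , tt))
          (λ ne → runs skip ≤-refl (drop-outcome P₁ (λ g → ne (trans val (m≤n⇒m∸n≡0 (good-weight g))))))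
          (λ eq → let p = seq {B} (assign {x = 16} {lit 1} {s₁} 1≤B) (assign {x = 17} {lit 0} z≤n) in
             runs p ≤-refl (record
             { env = env₂-keep refl refl refl refl (run-agree p) (Popped.env P₁)
             ; status = inj₂ (record { found = refl ; empty = refl
                 ; solution = legal-solution trivial (proj₁ (top-task r17 L)) settled (m∸n≡0⇒m≤n (trans (sym val) eq)) })
             ; decrease = λ b _ → ≤-trans (1≤treeSize b (arr s 13 t)) (≤-trans (m≤n+m _ _) (≤-reflexive (sym (Φ-top {s} r17 b))))
             ; cnt≤m = z≤n ; cnt≤h² = λ _ _ → z≤n })) }) b

    unsettled-ok : ∀ {s′} e → Bounded B s′ → Popped s t s′ → Distances-at (F-at s t) s′ → reg s′ 15 ≡ toℕ e →
      ¬ Settles (On (F-at s t)) e → limit e < arr s′ 35 (cell (src e) (tgt e)) →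
      ∃ λ cnt → Runs B (cond (var 18) expand skip) s′ (3 + (focusTime + branchTime cnt)) (Outcome s cnt)
    unsettled-ok {s′} e b P dist-ok r15 uns far = by (arr s 13 t) refl
      where
      open Popped P renaming (r17 to r17′)
      Result : Set
      Result = ∃ λ cnt → Runs B (cond (var 18) expand skip) s′ (3 + (focusTime + branchTime cnt)) (Outcome s cnt)
      legal = proj₁ (top-task r17 L)
      by : ∀ r → arr s 13 t ≡ r → Result
      -- With no edge left to add, the current set itself would have to settle every pair.
      by zero rt = 0 , runs (else′ (proj₁ b 18) (trans r18 rt) skip) (s≤s (s≤s (s≤s z≤n)))
        (drop-outcome P (λ g → uns (good-zero (subst (Good (F-at s t)) rt g) e)))
      by (suc r) rt = expanded (expand-ok (F-at s t) e r t b env a11 dist-ok r15 far r17′ (trans r18 rt)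
            (≤-trans (+-monoʳ-≤ t (m≤m+n m (r * m))) (subst (λ z → t + z * m ≤ μ * m) rt (proj₂ (top-task r17 L)))))
        where
        back : ∀ {c s″} → Branched (F-at s t) c t r m s′ s″ → Branched (F-at s t) c t r m s s″
        back Br = record
          { top = top
          ; low = λ x x< → trans (low x x<) (cong (λ f → f x) a12)
          ; lowᵣ = λ p p< → trans (lowᵣ p p<) (cong (λ f → f p) a13)
          ; new = new ; all = all }
          where open Branched Br
        outcome : ∀ {c s″} → Agree expand s′ s″ → Candidates (F-at s t) e c → Branched (F-at s t) c t r m s s″ → Outcome s (∑ (ind ∘ c)) s″
        outcome {c} ag C Br = record
          { env = env₂-keep refl refl refl refl ag env
          ; status = inj₁ (branch-live r17 L rt C Br (trans (onReg ag 16 refl) r16))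
          ; decrease = branch-decrease r17 L rt C Br
          ; cnt≤m = ∑ind≤m c
          ; cnt≤h² = λ h lns → candidates-≤ c lns (unsettled-critical trivial (proj₁ legal) uns) (Candidates.visited C) }
        wrap : ∀ {c T} → Candidates (F-at s t) e c → Runs B expand s′ T (Branched (F-at s t) c t r m s′) →
          Runs B (cond (var 18) expand skip) s′ (2 + T) (Outcome s (∑ (ind ∘ c)))
        wrap C (runs p l Br) = runs (then′ (proj₁ b 18) (λ z → contradiction (trans (sym (trans r18 rt)) z) λ ()) p)
          (s≤s (s≤s l)) (outcome (run-agree p) C (back Br))
        expanded : (∃ λ c → Candidates (F-at s t) e c × Runs B expand s′ (focusTime + branchTime (∑ (ind ∘ c))) (Branched (F-at s t) c t r m s′)) → Result
        expanded (c , C , R) = ∑ (ind ∘ c) , runs-mono (n≤1+n _) id (wrap C R)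

    judge : Cmd
    judge = cond (bin monus (var 1) (var 15)) (cond (var 18) expand skip) finish

    judgeTime : ℕ → ℕ
    judgeTime cnt = 4 + ((3 + (focusTime + branchTime cnt)) + finishTime)

    judge-ok : ∀ {s′} → Bounded B s′ → Popped s t s′ → Distances-at (F-at s t) s′ → Scanned (F-at s t) s′ →
      ∃ λ cnt → Runs B judge s′ (judgeTime cnt) (Outcome s cnt)
    judge-ok {s′} b P dist-ok (inj₁ (r15 , settled)) = 0 , else-judge (finish-ok b P settled)
      where
      else-judge : Runs B finish s′ finishTime (Outcome s 0) → Runs B judge s′ (judgeTime 0) (Outcome s 0)
      else-judge (runs p l o) = runs (else′ (small-fits (bin monus (var 1) (var 15)) b (tt , tt))
        (trans (cong₂ _∸_ (Env₂.r1 (Popped.env P)) r15) (n∸n≡0 m)) p) (+-monoʳ-≤ 4 (≤-trans l (m≤n+m finishTime (3 + (focusTime + branchTime 0))))) o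
    judge-ok {s′} b P dist-ok (inj₂ (e , r15 , uns , far)) = then-judge (unsettled-ok e b P dist-ok r15 uns far)
      where
      then-judge : (∃ λ cnt → Runs B (cond (var 18) expand skip) s′ (3 + (focusTime + branchTime cnt)) (Outcome s cnt)) →
        ∃ λ cnt → Runs B judge s′ (judgeTime cnt) (Outcome s cnt)
      then-judge (cnt , runs p l o) = cnt , runs (then′ (small-fits (bin monus (var 1) (var 15)) b (tt , tt))
        (λ z → m>n⇒m∸n≢0 (toℕ<n e) (trans (sym (cong₂ _∸_ (Env₂.r1 (Popped.env P)) r15)) z)) p) (+-monoʳ-≤ 4 (≤-trans l (m≤m+n _ finishTime))) o

    popTime scanTime : ℕ
    popTime = 4 + (3 + (4 + fillTime (var 10) (get 12 offset) m))
    scanTime = 2 + (6 + (8 * m + m * 17))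

    node-ok : Bounded B s → Env₂ tr s →
      ∃ λ cnt → Runs B (node (APSPAlgorithm.program A)) s (popTime + (prepareTime + (APSPAlgorithm.time A n m + (scanTime + judgeTime cnt)))) (Outcome s cnt)
    node-ok b E =
      (pop-ok b E r17 room′ ⟫∃ λ { {s₁} _ ag₁ (r17₁ , r18₁ , a11₁) b₁ →
        let P₁ = record { env = env₂-keep refl refl refl refl ag₁ E ; a11 = a11₁ ; a12 = onArr ag₁ 12 refl ; a13 = onArr ag₁ 13 refl
                        ; r16 = trans (onReg ag₁ 16 refl) (Live.unfound L) ; r17 = r17₁ ; r18 = r18₁ }
        in (prepare-ok (F-at s t) b₁ (Popped.env P₁) a11₁ ⟫∃ λ { {s₂} _ ag₂ (r32 , r33 , a32 , a33 , a34) b₂ →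
          let P₂ = popped-keep refl refl refl refl refl refl refl refl refl refl ag₂ P₁
          in (oracle-ok (F-at s t) b₂ r32 r33 a32 a33 a34 ⟫∃ λ { {s₃} _ ag₃ dist-ok b₃ →
            let P₃ = oracle-popped ag₃ P₂
            in (scan-ok (F-at s t) b₃ (Popped.env P₃) dist-ok ⟫∃ λ { {s₄} _ ag₄ scanned b₄ →
              judge-ok b₄ (popped-keep refl refl refl refl refl refl refl refl refl refl ag₄ P₃)
                (λ z y → subst (λ a → Masked.Distance′ network (F-at s t) (mask (F-at s t)) (mask-positive (F-at s t)) big (mask-on (F-at s t)) (mask-off (F-at s t)) z y (a (cell z y)))
                   (sym (onArr ag₄ 35 refl)) (dist-ok z y)) scanned }) b₃ }) b₂ }) b₁ }) b
      where
      room′ : t * m + m ≤ B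
      room′ = ≤-trans (+-monoˡ-≤ m (*-monoˡ-≤ m (≤-trans (m+n≤o⇒m≤o t (proj₂ (top-task r17 L))) (n≤1+n _)))) stack≤
      oracle-popped : ∀ {c s′ s″} → Agree (shift 32 c) s′ s″ → Popped s t s′ → Popped s t s″
      oracle-popped {c} = popped-keep {shift 32 c}
        (anyBelow-false 8 _ (λ x l → shift-writesReg 32 c (≤-trans l (≤ᵇ⇒≤ 8 32 tt))))
        (anyBelow-false 4 _ (λ x l → shift-writesArr 32 c (≤-trans l (≤ᵇ⇒≤ 4 32 tt))))
        (shift-writesArr 32 c (≤ᵇ⇒≤ 10 32 tt)) (shift-writesArr 32 c (≤ᵇ⇒≤ 11 32 tt))
        (shift-writesArr 32 c (≤ᵇ⇒≤ 12 32 tt)) (shift-writesArr 32 c (≤ᵇ⇒≤ 13 32 tt)) (shift-writesArr 32 c (≤ᵇ⇒≤ 14 32 tt))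
        (shift-writesReg 32 c (≤ᵇ⇒≤ 17 32 tt)) (shift-writesReg 32 c (≤ᵇ⇒≤ 18 32 tt)) (shift-writesReg 32 c (≤ᵇ⇒≤ 19 32 tt))

-- Running time

-- Every program for APSP takes n² steps: started on an output array full of a number
-- exceeding all distances, it has to write each of the n² cells.
module LowerBound (A : APSPAlgorithm) (N : Network) where
  open Network N
  open Distances N

  private
    spread : ∀ {k} → (Fin k → ℕ) → ℕ → ℕ
    spread {k} f i with i <? k
    ... | yes i<k = f (fromℕ< i<k)
    ... | no _    = 0

    spread-toℕ : ∀ {k} (f : Fin k → ℕ) e → spread f (toℕ e) ≡ f e
    spread-toℕ {k} f e with toℕ e <? k
    ... | yes p = cong f (fromℕ<-toℕ e p)
    ... | no ¬p = contradiction (toℕ<n e) ¬p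

    spread-≤ : ∀ {k c} (f : Fin k → ℕ) → (∀ e → f e ≤ c) → ∀ i → spread f i ≤ c
    spread-≤ {k} f h i with i <? k
    ... | yes p = h _
    ... | no _  = z≤n

    input : ℕ → State
    input z = state (λ { 0 → n ; 1 → m ; _ → 0 })
      (λ { 0 → spread (toℕ ∘ src) ; 1 → spread (toℕ ∘ tgt) ; 2 → spread ℓ ; _ → λ _ → z })

    enough : ℕ
    enough = (2 + networkMagnitude N) ^ proj₁ (APSPAlgorithm.solves A) + networkMagnitude N

    magnitude≤enough : networkMagnitude N ≤ enough
    magnitude≤enough = m≤n+m (networkMagnitude N) ((2 + networkMagnitude N) ^ proj₁ (APSPAlgorithm.solves A))

    bounded : ∀ {B} → networkMagnitude N ≤ B → Bounded B (input B)
    bounded {B} le = regs , arrs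
      where
      n≤ : n ≤ B
      n≤ = ≤-trans (≤-trans (m≤m+n n m) (m≤m+n (n + m) _)) le
      regs : ∀ x → reg (input B) x ≤ B
      regs 0 = n≤
      regs 1 = ≤-trans (≤-trans (m≤n+m m n) (m≤m+n (n + m) _)) le
      regs (suc (suc _)) = z≤n
      arrs : ∀ a i → arr (input B) a i ≤ B
      arrs 0 = spread-≤ (toℕ ∘ src) (λ e → ≤-trans (<⇒≤ (toℕ<n (src e))) n≤)
      arrs 1 = spread-≤ (toℕ ∘ tgt) (λ e → ≤-trans (<⇒≤ (toℕ<n (tgt e))) n≤)
      arrs 2 = spread-≤ ℓ (λ e → ≤-trans (∑-≤ ℓ e) (≤-trans (m≤n+m _ (n + m)) le))
      arrs (suc (suc (suc _))) _ = ≤-refl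

    Solved : ℕ → Set
    Solved B = ∃₂ λ t s′ → B ⊢ APSPAlgorithm.program A , input B ⇓[ t ] s′ × DistanceMatrix N s′ × t ≤ APSPAlgorithm.time A n m

    outcome : ∀ B → enough ≤ B → Solved B
    outcome B le = proj₂ (APSPAlgorithm.solves A) N B (input B) (≤-trans (m≤m+n _ _) le) (bounded (≤-trans magnitude≤enough le))
      (refl , refl , spread-toℕ (toℕ ∘ src) , spread-toℕ (toℕ ∘ tgt) , spread-toℕ ℓ)

  n²≤time : n * n ≤ APSPAlgorithm.time A n m
  -- The run with words up to `enough` shows that no distance exceeds `enough`. The other one starts
  -- with `suc enough` in every cell of the output array, so no such cell can keep its initial
  -- content.
  n²≤time = both-runs (outcome enough ≤-refl) (outcome (suc enough) (n≤1+n _))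
    where
    both-runs : Solved enough → Solved (suc enough) → n * n ≤ APSPAlgorithm.time A n m
    both-runs (_ , s₁ , run₁ , D₁ , _) (t , s₂ , run₂ , D₂ , t≤) with run-changes run₂ 3
    ... | cells , cells≤ , touched = begin
      n * n                    ≡⟨ cong (λ z → z * z) (length-allFin n) ⟨
      List.length (List.allFin n) * List.length (List.allFin n) ≡⟨ length-cartesianProduct (List.allFin n) (List.allFin n) ⟨
      List.length pairs        ≡⟨ length-map cell′ pairs ⟨
      List.length (List.map cell′ pairs) ≤⟨ unique-⊆-length (Unique.map⁺ cell′-injective (Unique.cartesianProduct⁺ (Unique.allFin⁺ n) (Unique.allFin⁺ n))) written ⟩
      List.length cells        ≤⟨ cells≤ ⟩
      t                        ≤⟨ t≤ ⟩
      APSPAlgorithm.time A n m ∎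
      where
      open ≤-Reasoning
      pairs = List.cartesianProduct (List.allFin n) (List.allFin n)
      cell′ : Fin n × Fin n → ℕ
      cell′ (u , v) = cell u v
      cell′-injective : ∀ {p q} → cell′ p ≡ cell′ q → p ≡ q
      cell′-injective {u , v} {u′ , v′} eq with cell-injective u v u′ v′ eq
      ... | refl , refl = refl
      same : ∀ u v → arr s₂ 3 (cell u v) ≤ enough
      same u v = ≤-trans (≤-reflexive (distance-unique (D₂ u v) (D₁ u v))) (proj₂ (run-bounded run₁ (bounded magnitude≤enough)) 3 (cell u v))
      written : ∀ {x} → x ∈ List.map cell′ pairs → x ∈ cells
      written x∈ with ∈-map⁻ cell′ x∈
      ... | (u , v) , _ , refl with touched (cell u v)
      ...   | inj₁ p  = p
      ...   | inj₂ eq = contradiction (≤-trans (≤-reflexive (sym eq)) (same u v)) (<⇒≱ ≤-refl)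

-- The complete program

direct : Cmd
direct = weigh ⨾ 16 ≔ bin monus (lit 1) (bin monus (var 19) (var 4))

search : Cmd → Cmd
search c = 16 ≔ lit 0 ⨾ fill 12 10 1 (var 10) (get 10 (var 10)) ⨾ put 13 (lit 0) (var 5) ⨾ 17 ≔ lit 1 ⨾
  while (var 17) (node c)

solver : Cmd → Cmd
solver c = setup ⨾ for 14 1 classify ⨾ check ⨾ fill 11 10 1 (var 10) (get 10 (var 10)) ⨾
  cond (var 15) (search c) direct ⨾ 0 ≔ var 16

module Solving (A : APSPAlgorithm) (I : SpannerInstance) (B : ℕ) (room : Machine.Room I B)
  (oracle-room : (2 + (SpannerInstance.n I + SpannerInstance.m I + SpannerInstance.m I * Machine.big I B))
                 ^ proj₁ (APSPAlgorithm.solves A) ≤ B) where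
  open SpannerInstance I
  open SpannerTheory I
  open Distances network
  open Machine I B
  open Room room
  open Routines room
  open Preprocessing I B room

  apspTime : ℕ
  apspTime = APSPAlgorithm.time A n m

  Decided : State → Set
  Decided s = (reg s 16 ≡ 1 × Solvable) ⊎ (reg s 16 ≡ 0 × ¬ Solvable)

  opaque
    nodeCost : ℕ
    nodeCost = 700 * pass + apspTime

    nodeCost≡ : nodeCost ≡ 700 * pass + apspTime
    nodeCost≡ = refl

  module _ (tr : Fin m → ℕ) (trivial : TrivialFlags tr) where
    open Searching A I B room oracle-room tr trivial

    nodeTime : ℕ → ℕ
    nodeTime cnt = (4 + (3 + (4 + fillTime (var 10) (get 12 offset) m))) +
      (prepareTime + (apspTime + ((2 + (6 + (8 * m + m * 17))) + (4 + ((3 + (focusTime + branchTime cnt)) + finishTime)))))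

    -- One `nodeCost` is charged for the node and one for each push. The 2 is the guard of the
    -- surrounding loop.
    nodeTime-≤ : ∀ cnt → 2 + nodeTime cnt ≤ nodeCost * suc cnt
    nodeTime-≤ cnt = begin
      2 + nodeTime cnt                              ≡⟨ solve 9 (λ a p o s f e m₈ m₂₃ q →
          con 2 :+ (a :+ (p :+ (o :+ (s :+ (con 4 :+ ((con 3 :+ (f :+ (con 6 :+ (m₈ :+ (m₂₃ :+ q))))) :+ e))))))
          := (con 2 :+ (a :+ (p :+ (s :+ (con 4 :+ ((con 3 :+ (f :+ (con 6 :+ (m₈ :+ m₂₃)))) :+ e)))))) :+ o :+ q)
          refl (4 + (3 + (4 + fillTime (var 10) (get 12 offset) m))) prepareTime apspTime (2 + (6 + (8 * m + m * 17))) focusTime finishTime (8 * m) (m * 23) (cnt * pushTime) ⟩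
      (2 + fixed) + apspTime + cnt * pushTime       ≤⟨ +-mono-≤ (+-monoˡ-≤ apspTime (bound (≲-mono {d = 700} (≤ᵇ⇒≤ _ 700 tt) fixed≲))) (*-monoʳ-≤ cnt push≤) ⟩
      700 * pass + apspTime + cnt * nodeCost        ≡⟨ cong (_+ cnt * nodeCost) nodeCost≡ ⟨
      nodeCost + cnt * nodeCost                     ≡⟨ *-comm nodeCost (suc cnt) ⟨
      nodeCost * suc cnt                            ∎
      where
      open ≤-Reasoning
      fixed : ℕ
      fixed = (4 + (3 + (4 + fillTime (var 10) (get 12 offset) m))) +
        (prepareTime + ((2 + (6 + (8 * m + m * 17))) + (4 + ((3 + (focusTime + (6 + (8 * m + m * 23)))) + finishTime))))
      fl : ∀ {c} → (6 + (8 * m + m * c)) ≲ 14 + c · pass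
      fl = flat-loop-≲ 1≤pass m≤pass
      fixed≲ = const-≲ {2} 1≤pass ⊞ (const-≲ {4} 1≤pass ⊞ const-≲ {3} 1≤pass ⊞ const-≲ {4} 1≤pass ⊞ fl)
        ⊞ (const-≲ {2} 1≤pass ⊞ const-≲ {2} 1≤pass ⊞ fl ⊞ fl ⊞ fl)
        ⊞ (const-≲ {2} 1≤pass ⊞ fl)
        ⊞ const-≲ {4} 1≤pass
        ⊞ (const-≲ {3} 1≤pass ⊞
            (flat-loop-≲ 1≤pass n≤pass ⊞ fl ⊞ const-≲ {3} 1≤pass ⊞ const-≲ {5} 1≤pass ⊞ bounded-by {c = 200} {pass} ≤-refl ⊞ const-≲ {4} 1≤pass)
            ⊞ fl {23})
        ⊞ bounded-by {c = 100} {pass} ≤-refl ⊞ const-≲ {9} 1≤pass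
      push≲ : (4 + (fillTime offset (get 11 (var 10)) m + (5 + (3 + 4)))) ≲ 36 · pass
      push≲ = const-≲ {4} 1≤pass ⊞ fl ⊞ const-≲ {5} 1≤pass ⊞ const-≲ {3} 1≤pass ⊞ const-≲ {4} 1≤pass
      push≤ : pushTime ≤ nodeCost
      push≤ = ≤-trans (≤-reflexive (sym pushTime≡)) (≤-trans (bound (≲-mono {d = 700} (≤ᵇ⇒≤ _ 700 tt) push≲))
        (≤-trans (m≤m+n (700 * pass) apspTime) (≤-reflexive (sym nodeCost≡))))

    loop-ok : ∀ fuel {s} → Φ m s ≤ fuel → Bounded B s → Env₂ tr s → Live s ⊎ Won s →
      ∃₂ λ t s′ → B ⊢ while (var 17) (node (APSPAlgorithm.program A)) , s ⇓[ t ] s′ × Decided s′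
        × (∀ h → LocalNeighborhoodSize h → t ≤ 2 + nodeCost * Φ (h * h) s)
    loop-ok fuel {s} Φ≤ b E (inj₂ W) = _ , s , done (proj₁ b 17) (Won.empty W) , inj₁ (Won.found W , Won.solution W) , λ h _ → m≤m+n 2 _
    loop-ok fuel {s} Φ≤ b E (inj₁ L) = by (reg s 17) refl fuel Φ≤
      where
      Result : Set
      Result = ∃₂ λ t s′ → B ⊢ while (var 17) (node (APSPAlgorithm.program A)) , s ⇓[ t ] s′ × Decided s′
        × (∀ h → LocalNeighborhoodSize h → t ≤ 2 + nodeCost * Φ (h * h) s)
      by : ∀ k → reg s 17 ≡ k → ∀ fuel → Φ m s ≤ fuel → Result
      by zero r17 _ _ = _ , s , done (proj₁ b 17) r17 , inj₂ (Live.unfound L , unsolvable) , λ h _ → m≤m+n 2 _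
        where
        unsolvable : ¬ Solvable
        unsolvable sol with Live.cover L sol
        ... | p , p< , _ = contradiction (≤-trans p< (≤-reflexive r17)) λ ()
      by (suc t) r17 zero Φ≤0 = contradiction (≤-trans (1≤treeSize m (arr s 13 t)) (≤-trans (m≤n+m _ _) (≤-trans (≤-reflexive (sym (Φ-top {s} r17 m))) Φ≤0))) λ ()
      by (suc t) r17 (suc fuel) Φ≤ = continue (node-ok r17 L b E)
        where
        further : ∀ {cnt t₁ s₁} → B ⊢ node (APSPAlgorithm.program A) , s ⇓[ t₁ ] s₁ → t₁ ≤ nodeTime cnt → Outcome s cnt s₁ →
          (∃₂ λ t s′ → B ⊢ while (var 17) (node (APSPAlgorithm.program A)) , s₁ ⇓[ t ] s′ × Decided s′
            × (∀ h → LocalNeighborhoodSize h → t ≤ 2 + nodeCost * Φ (h * h) s₁)) → Result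
        further {cnt} {t₁} {s₁} p l O (t₂ , s₂ , q , dec , t₂≤) = _ , s₂ ,
          loop (proj₁ b 17) (λ z → contradiction (trans (sym r17) z) λ ()) p q , dec , λ h lns → begin
            2 + (t₁ + t₂)                          ≤⟨ +-monoʳ-≤ 2 (+-mono-≤ l (t₂≤ h lns)) ⟩
            2 + (nodeTime cnt + (2 + nodeCost * Φ (h * h) s₁)) ≡⟨ solve 2 (λ a x → con 2 :+ (a :+ (con 2 :+ x)) := con 2 :+ ((con 2 :+ a) :+ x)) refl (nodeTime cnt) (nodeCost * Φ (h * h) s₁) ⟩
            2 + ((2 + nodeTime cnt) + nodeCost * Φ (h * h) s₁) ≤⟨ +-monoʳ-≤ 2 (+-monoˡ-≤ _ (nodeTime-≤ cnt)) ⟩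
            2 + (nodeCost * suc cnt + nodeCost * Φ (h * h) s₁) ≡⟨ cong (2 +_) (*-distribˡ-+ nodeCost (suc cnt) (Φ (h * h) s₁)) ⟨
            2 + nodeCost * (suc cnt + Φ (h * h) s₁) ≤⟨ +-monoʳ-≤ 2 (*-monoʳ-≤ nodeCost (Outcome.decrease O (h * h) (Outcome.cnt≤h² O h lns))) ⟩
            2 + nodeCost * Φ (h * h) s             ∎
          where
          open ≤-Reasoning
        continue : (∃ λ cnt → Runs B (node (APSPAlgorithm.program A)) s (nodeTime cnt) (Outcome s cnt)) → Result
        continue (cnt , runs {final = s₁} p l O) = further {cnt} p l O
          -- Termination is measured with degree `m`, which bounds the number of candidates without
          -- reference to `h`.
          (loop-ok fuel (≤-pred (≤-trans (s≤s (m≤n+m (Φ m s₁) cnt)) (≤-trans (Outcome.decrease O m (Outcome.cnt≤m O)) Φ≤)))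
            (run-bounded p b) (Outcome.env O) (Outcome.status O))

    search-setup-ok : ∀ {s} → Bounded B s → Env₂ tr s →
      Runs B (16 ≔ lit 0 ⨾ fill 12 10 1 (var 10) (get 10 (var 10)) ⨾ put 13 (lit 0) (var 5) ⨾ 17 ≔ lit 1) s
        (2 + (fillTime (var 10) (get 10 (var 10)) m + (3 + 2))) (λ s′ → Env₂ tr s′ × Live s′ × ∀ b → Φ b s′ ≡ treeSize b μ)
    search-setup-ok {s} b E =
      (assign-run z≤n ⟫ λ { {s₁} _ ag₁ refl b₁ →
        let E₁ = env₂-keep refl refl refl refl ag₁ E in
        (fill-rule 0 tr refl 1≤B b₁ (Env₂.r1 E₁) (λ k b′ ag ri _ → proj₁ b′ 10 , small-fits (get 10 (var 10)) b′ tt , ri ,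
            trans (cong-at (onArr ag 10 refl) ri) (Env₂.a10 E₁ k))
        ⟫ λ { {s₂} _ ag₂ (a12 , _) b₂ →
          let E₂ = env₂-keep refl refl refl refl ag₂ E₁
              r16 : reg s₂ 16 ≡ 0
              r16 = onReg ag₂ 16 refl
              p = seq {B} (put {a = 13} {lit 0} {var 5} {s₂} z≤n (proj₁ b₂ 5)) (assign {x = 17} {lit 1} 1≤B)
          in runs p ≤-refl (env₂-keep refl refl refl refl (run-agree p) E₂ ,
             rooted r16 (λ x → sym (a12 x)) (Env₂.r5 E₂) ,
             λ b → cong (treeSize b) (Env₂.r5 E₂)) }) b₁ }) b
      where
      rooted : ∀ {s₂} → reg s₂ 16 ≡ 0 → (∀ x → tr x ≡ arr s₂ 12 (toℕ x)) → reg s₂ 5 ≡ μ → Live (setReg (setArr s₂ 13 0 (reg s₂ 5)) 17 1)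
      rooted {s₂} r16 tr≡ r5 = record
        { unfound = r16
        ; tasks = λ { zero _ → subst (λ r → Legal trivial (λ x → arr s₂ 12 (toℕ x)) r × r * m ≤ μ * m) (sym r5)
                        (legal-resp trivial tr≡ (legal-root trivial) , ≤-refl)
                    ; (suc p) (s≤s ()) }
        ; cover = λ sol → 0 , ≤-refl , subst (Good (λ x → arr s₂ 12 (toℕ x))) (sym r5) (good-resp tr≡ (good-root trivial sol)) }

    seq-assoc : ∀ {c₁ c₂ c₃ c₄ c₅ s s′ s″ t t′} → B ⊢ c₁ ⨾ c₂ ⨾ c₃ ⨾ c₄ , s ⇓[ t ] s′ → B ⊢ c₅ , s′ ⇓[ t′ ] s″ →
      ∃ λ t″ → B ⊢ c₁ ⨾ c₂ ⨾ c₃ ⨾ c₄ ⨾ c₅ , s ⇓[ t″ ] s″ × t″ ≡ t + t′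
    seq-assoc {t′ = t′} (seq {t = a} p (seq {t = b} q (seq {t = c} {t′ = d} r u))) v = _ , seq p (seq q (seq r (seq u v))) ,
      solve 5 (λ a b c d e → a :+ (b :+ (c :+ (d :+ e))) := (a :+ (b :+ (c :+ d))) :+ e) refl a b c d t′

    search-ok : ∀ {s} → Bounded B s → Env₂ tr s → (∃ λ e → ¬ Settles (On tr) e) →
      ∃₂ λ t s′ → B ⊢ search (APSPAlgorithm.program A) , s ⇓[ t ] s′ × Decided s′
        × (∀ h → LocalNeighborhoodSize h → t ≤ 100 * pass + h ^ (2 * μ) * (4 * nodeCost))
    search-ok {s} b E (e , uns) = go (search-setup-ok b E)
      where
      Result : Set
      Result = ∃₂ λ t s′ → B ⊢ search (APSPAlgorithm.program A) , s ⇓[ t ] s′ × Decided s′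
        × (∀ h → LocalNeighborhoodSize h → t ≤ 100 * pass + h ^ (2 * μ) * (4 * nodeCost))
      cost : ℕ
      cost = 2 + (fillTime (var 10) (get 10 (var 10)) m + (3 + 2))
      cost≤ : cost + 2 ≤ 100 * pass
      cost≤ = bound (≲-mono {d = 100} (≤ᵇ⇒≤ _ 100 tt) ((const-≲ {2} 1≤pass ⊞ flat-loop-≲ 1≤pass m≤pass ⊞ const-≲ {3} 1≤pass ⊞ const-≲ {2} 1≤pass) ⊞ const-≲ {2} 1≤pass))
      tree≤ : ∀ h → LocalNeighborhoodSize h → nodeCost * treeSize (h * h) μ ≤ h ^ (2 * μ) * (4 * nodeCost)
      tree≤ h lns = begin
        nodeCost * treeSize (h * h) μ    ≤⟨ *-monoʳ-≤ nodeCost (≤-trans (m≤n+m _ 3) (treeSize-≤ 2≤h² μ)) ⟩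
        nodeCost * (4 * (h * h) ^ μ)     ≡⟨ cong (λ z → nodeCost * (4 * z)) (trans (cong (_^ μ) (cong (h *_) (sym (*-identityʳ h)))) (^-*-assoc h 2 μ)) ⟩
        nodeCost * (4 * h ^ (2 * μ))     ≡⟨ solve 2 (λ c x → c :* (con 4 :* x) := x :* (con 4 :* c)) refl nodeCost (h ^ (2 * μ)) ⟩
        h ^ (2 * μ) * (4 * nodeCost)     ∎
        where
        open ≤-Reasoning
        2≤h = critical-h≥2 lns (unsettled-critical trivial id uns)
        2≤h² : 2 ≤ h * h
        2≤h² = ≤-trans 2≤h (≤-trans (≤-reflexive (sym (*-identityʳ h))) (*-monoʳ-≤ h (≤-trans (s≤s z≤n) 2≤h)))
      join : ∀ {s₁ t₁} → B ⊢ 16 ≔ lit 0 ⨾ fill 12 10 1 (var 10) (get 10 (var 10)) ⨾ put 13 (lit 0) (var 5) ⨾ 17 ≔ lit 1 , s ⇓[ t₁ ] s₁ → t₁ ≤ cost →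
        (∀ b → Φ b s₁ ≡ treeSize b μ) →
        (∃₂ λ t s′ → B ⊢ while (var 17) (node (APSPAlgorithm.program A)) , s₁ ⇓[ t ] s′ × Decided s′
          × (∀ h → LocalNeighborhoodSize h → t ≤ 2 + nodeCost * Φ (h * h) s₁)) → Result
      join {s₁} {t₁} p l Φ≡ (t₂ , s₂ , q , dec , t₂≤) with seq-assoc p q
      ... | t , pq , refl = t , s₂ , pq , dec , λ h lns →
        ≤-trans (+-mono-≤ l (t₂≤ h lns)) (≤-trans (≤-reflexive (sym (+-assoc cost 2 _)))
          (+-mono-≤ cost≤ (≤-trans (≤-reflexive (cong (nodeCost *_) (Φ≡ (h * h)))) (tree≤ h lns))))
      go : Runs B _ s cost (λ s′ → Env₂ tr s′ × Live s′ × ∀ b → Φ b s′ ≡ treeSize b μ) → Result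
      go (runs {final = s₁} p l (E₁ , L , Φ≡)) = join p l Φ≡ (loop-ok (Φ m s₁) ≤-refl (run-bounded p b) E₁ (inj₁ L))

    direct-ok : ∀ {s} → Bounded B s → Env₂ tr s → (∀ e → arr s 11 (toℕ e) ≡ tr e) → (∀ e → Settles (On tr) e) →
      Runs B direct s (100 * pass + 6) Decided
    direct-ok {s} b E a11 settled =
      (weigh-ok b (Env₂.env E) tr a11 ⟫ λ { {s₁} _ ag r19 b₁ →
        let E₁ = env₂-keep refl refl refl refl ag E
            e₀ = bin monus (lit 1) (bin monus (var 19) (var 4))
            val : eval e₀ s₁ ≡ 1 ∸ (wt tr ∸ W)
            val = cong (1 ∸_) (cong₂ _∸_ r19 (Env₂.r4 E₁))
        in runs (assign (small-fits e₀ b₁ (1≤B , tt , tt))) ≤-refl (decide val) }) b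
      where
      decide : ∀ {x} → x ≡ 1 ∸ (wt tr ∸ W) → (x ≡ 1 × Solvable) ⊎ (x ≡ 0 × ¬ Solvable)
      decide eq with wt tr ≤? W
      ... | yes l = inj₁ (trans eq (cong (1 ∸_) (m≤n⇒m∸n≡0 l)) , legal-solution trivial (legal-root trivial) settled l)
      ... | no ¬l = inj₂ (trans eq (m≤n⇒m∸n≡0 (m<n⇒0<n∸m (≰⇒> ¬l))) , λ sol → ¬l (good-weight (good-root trivial sol)))

  -- If the trivial edges form a spanner, no power of `h` may be charged, as it can vanish.
  -- Otherwise there is an edge, recorded by `Fin m`; it ensures that `n` is positive, so that a
  -- pass is dominated by APSP.
  solver-ok : ∀ {s} → Bounded B s → Env s →
    ∃₂ λ t s′ → B ⊢ solver (APSPAlgorithm.program A) , s ⇓[ t ] s′ × SpannerAnswer I s′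
      × (∀ h → LocalNeighborhoodSize h → (t ≤ 1500 * passes) ⊎ (Fin m × t ≤ 1500 * passes + h ^ (2 * μ) * (4 * nodeCost)))
  solver-ok {s} b E = first (setup-ok b E)
    where
    TimeOK : ℕ → Set
    TimeOK t = ∀ h → LocalNeighborhoodSize h → (t ≤ 1500 * passes) ⊎ (Fin m × t ≤ 1500 * passes + h ^ (2 * μ) * (4 * nodeCost))
    Result : Set
    Result = ∃₂ λ t s′ → B ⊢ solver (APSPAlgorithm.program A) , s ⇓[ t ] s′ × SpannerAnswer I s′ × TimeOK t
    c = APSPAlgorithm.program A
    Post : ℕ → State → Set
    Post t s′ = Decided s′ × (∀ h → LocalNeighborhoodSize h → (t ≤ 110 * pass) ⊎ (Fin m × t ≤ 100 * pass + h ^ (2 * μ) * (4 * nodeCost)))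
    answer : ∀ {s′} → Decided s′ → SpannerAnswer I (setReg s′ 0 (reg s′ 16))
    answer d = d
    module _ {s₁} (b₁ : Bounded B s₁) (tr : Fin m → ℕ) (trivial : TrivialFlags tr) (E₁ : Env₂ tr s₁)
             (a11 : ∀ e → arr s₁ 11 (toℕ e) ≡ tr e) where
      core : Checked tr s₁ → ∃₂ λ t s′ → B ⊢ cond (var 15) (search c) direct , s₁ ⇓[ 2 + t ] s′ × Post t s′
      core (inj₁ (r15 , u)) = searched (search-ok tr trivial b₁ E₁ u)
        where
        searched : (∃₂ λ t s′ → B ⊢ search c , s₁ ⇓[ t ] s′ × Decided s′
          × (∀ h → LocalNeighborhoodSize h → t ≤ 100 * pass + h ^ (2 * μ) * (4 * nodeCost))) → _
        searched (t , s′ , p , d , l) = t , s′ , then′ (proj₁ b₁ 15) r15 p , d , λ h lns → inj₂ (proj₁ u , l h lns)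
      core (inj₂ (r15 , settled)) = directly (direct-ok tr trivial b₁ E₁ a11 settled)
        where
        directly : Runs B direct s₁ (100 * pass + 6) Decided → _
        directly (runs {t} {s′} p l d) = t , s′ , else′ (proj₁ b₁ 15) r15 p , d , λ h lns → inj₁
          (≤-trans l (bound (≲-mono {d = 110} (≤ᵇ⇒≤ _ 110 tt) (bounded-by {c = 100} {pass} ≤-refl ⊞ const-≲ {6} 1≤pass))))
    assemble : ∀ {s₁ s₂ s₃ s₄ t₁ t₂ t₃ t₄} →
      B ⊢ setup , s ⇓[ t₁ ] s₁ → t₁ ≤ 100 * pass → B ⊢ for 14 1 classify , s₁ ⇓[ t₂ ] s₂ → t₂ ≤ 500 * passes →
      B ⊢ check , s₂ ⇓[ t₃ ] s₃ → t₃ ≤ 500 * passes → B ⊢ fill 11 10 1 (var 10) (get 10 (var 10)) , s₃ ⇓[ t₄ ] s₄ → t₄ ≤ fillTime (var 10) (get 10 (var 10)) m →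
      Bounded B s₄ →
      (∃₂ λ t s′ → B ⊢ cond (var 15) (search c) direct , s₄ ⇓[ 2 + t ] s′ × Post t s′) → Result
    assemble {t₁ = t₁} {t₂} {t₃} {t₄} p₁ l₁ p₂ l₂ p₃ l₃ p₄ l₄ b₄ (t , s′ , p , d , l) =
      _ , setReg s′ 0 (reg s′ 16) , seq p₁ (seq p₂ (seq p₃ (seq p₄ (seq p (assign (proj₁ (run-bounded p b₄) 16)))))) , answer {s′} d ,
      λ h lns → Sum.map
        (λ q → ≤-trans (total q) (≤-reflexive (+-identityʳ _)))
        (λ { (e , q) → e , total q }) (Sum.map₁ (λ q → ≤-trans q (≤-reflexive (sym (+-identityʳ _)))) (Sum.map₂ (λ { (e , q) → e , ≤-trans q (+-monoˡ-≤ _ (*-monoˡ-≤ pass {100} {110} (≤ᵇ⇒≤ 100 110 tt))) }) (l h lns)))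
      where
      up : ∀ {x c} → x ≲ c · pass → x ≲ c · passes
      up = ≲-scale pass≤passes
      total : ∀ {r} → t ≤ 110 * pass + r → t₁ + (t₂ + (t₃ + (t₄ + (2 + t + 2)))) ≤ 1500 * passes + r
      total {r} q = begin
        t₁ + (t₂ + (t₃ + (t₄ + (2 + t + 2))))       ≤⟨ +-mono-≤ l₁ (+-mono-≤ l₂ (+-mono-≤ l₃ (+-mono-≤ l₄ (+-monoˡ-≤ 2 (+-monoʳ-≤ 2 q))))) ⟩
        100 * pass + (500 * passes + (500 * passes + (F + (2 + (110 * pass + r) + 2))))
          ≡⟨ solve 5 (λ a b f k r → a :+ (b :+ (b :+ (f :+ (con 2 :+ (k :+ r) :+ con 2)))) := (a :+ (b :+ (b :+ (f :+ (con 2 :+ (k :+ con 2)))))) :+ r)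
               refl (100 * pass) (500 * passes) F (110 * pass) r ⟩
        (100 * pass + (500 * passes + (500 * passes + (F + (2 + (110 * pass + 2)))))) + r
          ≤⟨ +-monoˡ-≤ r (bound (≲-mono {d = 1500} (≤ᵇ⇒≤ _ 1500 tt)
              (up (bounded-by {c = 100} {pass} ≤-refl) ⊞ bounded-by {c = 500} {passes} ≤-refl ⊞ bounded-by {c = 500} {passes} ≤-refl
               ⊞ up (flat-loop-≲ 1≤pass m≤pass) ⊞ up (const-≲ {2} 1≤pass) ⊞ up (bounded-by {c = 110} {pass} ≤-refl) ⊞ up (const-≲ {2} 1≤pass)))) ⟩
        1500 * passes + r                           ∎
        where
        open ≤-Reasoning
        F = fillTime (var 10) (get 10 (var 10)) m
    fourth : ∀ {s₁ s₂ s₃ t₁ t₂ t₃} (tr : Fin m → ℕ) → TrivialFlags tr →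
      B ⊢ setup , s ⇓[ t₁ ] s₁ → t₁ ≤ 100 * pass → B ⊢ for 14 1 classify , s₁ ⇓[ t₂ ] s₂ → t₂ ≤ 500 * passes →
      B ⊢ check , s₂ ⇓[ t₃ ] s₃ → t₃ ≤ 500 * passes → Bounded B s₃ → Env₂ tr s₃ → Checked tr s₃ →
      Runs B (fill 11 10 1 (var 10) (get 10 (var 10))) s₃ (fillTime (var 10) (get 10 (var 10)) m) (λ s′ → (∀ e → arr s′ 11 (toℕ e) ≡ tr e) × _) → Result
    fourth {s₃ = s₃} tr trivial p₁ l₁ p₂ l₂ p₃ l₃ b₃ E₃ ch (runs {final = s₄} p₄ l₄ (a11 , _)) = assemble p₁ l₁ p₂ l₂ p₃ l₃ p₄ l₄ b₄
      (core b₄ tr trivial (env₂-keep refl refl refl refl ag E₃) a11 (subst (λ x → (x ≢ 0 × ∃ λ e → ¬ Settles (On tr) e) ⊎ (x ≡ 0 × ∀ e → Settles (On tr) e)) (sym (onReg ag 15 refl)) ch))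
      where
      b₄ = run-bounded p₄ b₃
      ag = run-agree p₄
    third : ∀ {s₁ s₂ t₁ t₂} (tr : Fin m → ℕ) → TrivialFlags tr →
      B ⊢ setup , s ⇓[ t₁ ] s₁ → t₁ ≤ 100 * pass → B ⊢ for 14 1 classify , s₁ ⇓[ t₂ ] s₂ → t₂ ≤ 500 * passes →
      Bounded B s₂ → Env₂ tr s₂ → Runs B check s₂ (500 * passes) (Checked tr) → Result
    third tr trivial p₁ l₁ p₂ l₂ b₂ E₂ (runs p₃ l₃ ch) = fourth tr trivial p₁ l₁ p₂ l₂ p₃ l₃ b₃ E₃ ch
      (fill-rule 0 tr refl 1≤B b₃ (Env₂.r1 E₃) (λ k b′ ag ri _ → proj₁ b′ 10 , small-fits (get 10 (var 10)) b′ tt , ri ,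
            trans (cong-at (onArr ag 10 refl) ri) (Env₂.a10 E₃ k)))
      where
      b₃ = run-bounded p₃ b₂
      E₃ = env₂-keep refl refl refl refl (run-agree p₃) E₂
    second : ∀ {s₁ t₁} → B ⊢ setup , s ⇓[ t₁ ] s₁ → t₁ ≤ 100 * pass →
      Runs B (for 14 1 classify) s₁ (500 * passes) (λ s′ → Env₁ s′ × Caps s′ × Classified m s′) → Bounded B s₁ → Result
    second p₁ l₁ (runs {final = s₂} p₂ l₂ (E₂ , caps , cl)) b₁ = third tr (λ e → proj₂ (cl e (toℕ<n e))) p₁ l₁ p₂ l₂ b₂ E₂′ (check-ok b₂ E₂′ caps)
      where
      b₂ = run-bounded p₂ b₁
      tr : Fin m → ℕ
      tr e = arr s₂ 10 (toℕ e)
      E₂′ : Env₂ tr s₂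
      E₂′ = record { env₁ = E₂ ; a9 = λ e → proj₁ (cl e (toℕ<n e)) ; a10 = λ _ → refl }
    first : Runs B setup s (100 * pass) (λ s′ → Env₁ s′ × Caps s′) → Result
    first (runs p₁ l₁ (E₁ , caps)) = second p₁ l₁ (classify-all-ok b₁ E₁ caps) b₁
      where b₁ = run-bounded p₁ b

-- Polynomials and the parameter function

⟦⟧-mono : ∀ p {x y} → x ≤ y → ⟦ p ⟧ x ≤ ⟦ p ⟧ y
⟦⟧-mono []      l = z≤n
⟦⟧-mono (a ∷ p) l = +-monoʳ-≤ a (*-mono-≤ l (⟦⟧-mono p l))

times-all : ℕ → Polynomial → Polynomial
times-all k = List.map (k *_)

times-all-⟦⟧ : ∀ k p x → ⟦ times-all k p ⟧ x ≡ k * ⟦ p ⟧ x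
times-all-⟦⟧ k []      x = sym (*-zeroʳ k)
times-all-⟦⟧ k (a ∷ p) x = trans (cong (λ z → k * a + x * z) (times-all-⟦⟧ k p x))
  (solve 4 (λ k a x r → k :* a :+ x :* (k :* r) := k :* (a :+ x :* r)) refl k a x (⟦ p ⟧ x))

dilate : ℕ → Polynomial → Polynomial
dilate k []      = []
dilate k (a ∷ p) = a ∷ times-all k (dilate k p)

dilate-⟦⟧ : ∀ k p x → ⟦ dilate k p ⟧ x ≡ ⟦ p ⟧ (k * x)
dilate-⟦⟧ k []      x = refl
dilate-⟦⟧ k (a ∷ p) x = cong (a +_) (trans (cong (x *_) (trans (times-all-⟦⟧ k (dilate k p) x) (cong (k *_) (dilate-⟦⟧ k p x))))
  (solve 3 (λ x k r → x :* (k :* r) := k :* x :* r) refl x k (⟦ p ⟧ (k * x))))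

_⊕ₚ_ : Polynomial → Polynomial → Polynomial
[]      ⊕ₚ q       = q
(a ∷ p) ⊕ₚ []      = a ∷ p
(a ∷ p) ⊕ₚ (b ∷ q) = (a + b) ∷ (p ⊕ₚ q)

⊕ₚ-⟦⟧ : ∀ p q x → ⟦ p ⊕ₚ q ⟧ x ≡ ⟦ p ⟧ x + ⟦ q ⟧ x
⊕ₚ-⟦⟧ []      q       x = refl
⊕ₚ-⟦⟧ (a ∷ p) []      x = sym (+-identityʳ _)
⊕ₚ-⟦⟧ (a ∷ p) (b ∷ q) x = trans (cong (λ z → a + b + x * z) (⊕ₚ-⟦⟧ p q x))
  (solve 5 (λ a b x r s → a :+ b :+ x :* (r :+ s) := (a :+ x :* r) :+ (b :+ x :* s)) refl a b x (⟦ p ⟧ x) (⟦ q ⟧ x))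

-- `suc h` takes the place of `h` to keep the factor positive: it also multiplies the cost of the
-- preprocessing, which is incurred even if `h` is 0.
paramCost : ℕ → ℕ → ℕ
paramCost μ h = (suc h * suc h) ^ μ

paramCost-computable : Computable₂ paramCost
paramCost-computable = program , λ a b → room a b , correct a b
  where
  program : Cmd
  program = 1 ≔ bin plus (var 1) (lit 1) ⨾ 1 ≔ bin times (var 1) (var 1) ⨾ 2 ≔ lit 1 ⨾
    for 3 0 (2 ≔ bin times (var 2) (var 1)) ⨾ 0 ≔ var 2
  room : ℕ → ℕ → ℕ
  room a b = suc b * suc b + (suc b * suc b) ^ a
  correct : ∀ a b B s → room a b ≤ B → Bounded B s → reg s 0 ≡ a → reg s 1 ≡ b →
            ∃₂ λ t s′ → B ⊢ program , s ⇓[ t ] s′ × reg s′ 0 ≡ paramCost a b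
  correct a b B s B≥ bd r0 r1 = extract (
    (assign-run (small-fits (bin plus (var 1) (lit 1)) bd
        (tt , 1≤B , subst (_≤ B) (sym v₁) (≤-trans (m≤m*n (suc b) (suc b)) sq≤)))
    ⟫ λ { {s₁} _ _ refl b₁ → (assign-run (small-fits (bin times (var 1) (var 1)) b₁
        (tt , tt , subst (_≤ B) (sym v₂) sq≤))
    ⟫ λ { {s₂} _ _ refl b₂ → (assign-run 1≤B
    ⟫ λ { {s₃} _ _ refl b₃ → (for-uniform (λ k s′ → reg s′ 2 ≡ x ^ k) 4 refl refl refl 1≤B b₃ r0 refl
          (λ k {s′} b′ ag ri inv →
            let v : reg s′ 2 * reg s′ 1 ≡ x ^ suc (toℕ k)
                v = trans (cong₂ _*_ inv (trans (onReg ag 1 refl) v₂)) (*-comm (x ^ toℕ k) x)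
            in runs (assign (small-fits (bin times (var 2) (var 1)) b′ (tt , tt ,
                 subst (_≤ B) (sym v) (≤-trans (^-monoʳ-≤ x (toℕ<n k)) pow≤)))) ≤-refl v)
    ⟫ λ { {s₄} _ _ r2 b₄ → runs-exact {Q = λ s′ → reg s′ 0 ≡ paramCost a b} (assign (proj₁ b₄ 2)) r2 }) b₃ }) b₂ }) b₁ }) bd)
    where
    x = suc b * suc b
    sq≤ : x ≤ B
    sq≤ = ≤-trans (m≤m+n x _) B≥
    pow≤ : x ^ a ≤ B
    pow≤ = ≤-trans (m≤n+m (x ^ a) x) B≥
    1≤B : 1 ≤ B
    1≤B = ≤-trans (s≤s z≤n) sq≤
    v₁ : reg s 1 + 1 ≡ suc b
    v₁ = trans (+-comm _ 1) (cong suc r1)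
    v₂ : (reg s 1 + 1) * (reg s 1 + 1) ≡ x
    v₂ = cong₂ _*_ v₁ v₁
    extract : ∀ {T} → Runs B program s T (λ s′ → reg s′ 0 ≡ paramCost a b) → ∃₂ λ t s′ → B ⊢ program , s ⇓[ t ] s′ × reg s′ 0 ≡ paramCost a b
    extract (runs p _ q) = _ , _ , p , q

suc-cube-≤ : ∀ m → suc m ^ 3 ≤ 8 * (1 + m ^ 3)
suc-cube-≤ zero    = s≤s z≤n
suc-cube-≤ m@(suc m-1) = begin
  suc m ^ 3          ≤⟨ ^-monoˡ-≤ 3 (s≤s (m≤n+m m m-1)) ⟩
  (m + m) ^ 3        ≡⟨ solve 1 (λ m → (m :+ m) :^ 3 := con 8 :* m :^ 3) refl m ⟩
  8 * m ^ 3          ≤⟨ *-monoʳ-≤ 8 (n≤1+n (m ^ 3)) ⟩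
  8 * (1 + m ^ 3)    ∎
  where
  open ≤-Reasoning

-- The fourth power of `2 + spannerMagnitude I` bounds every number that the solver forms and also 2
-- plus the magnitude of each masked network. The latter is raised to the degree `dA` that the APSP
-- program demands, whence `4 * dA`; the other 4 is for the solver itself.
module WordSize (I : SpannerInstance) (dA : ℕ) (B : ℕ) (fits : (2 + spannerMagnitude I) ^ (4 * dA + 4) ≤ B) where
  open SpannerInstance I
  open SpannerTheory I
  open Machine I B

  private
    mag Q : ℕ
    mag = spannerMagnitude I
    Q = 2 + mag


    ∑ℓ ∑w : ℕ
    ∑ℓ = ∑ ℓ
    ∑w = ∑ w

    bigger : ∀ x y → mag ≡ x + y → x ≤ mag
    bigger x y eq = ≤-trans (m≤m+n x y) (≤-reflexive (sym eq))

    n+m≤ : n + m ≤ mag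
    n+m≤ = bigger (n + m) (∑ℓ + ∑w + num + den + W + μ)
      (solve 7 (λ a l w p q W μ → a :+ l :+ w :+ p :+ q :+ W :+ μ := a :+ (l :+ w :+ p :+ q :+ W :+ μ)) refl (n + m) ∑ℓ ∑w num den W μ)
    ∑ℓ≤ : ∑ℓ ≤ mag
    ∑ℓ≤ = bigger ∑ℓ (n + m + ∑w + num + den + W + μ)
      (solve 7 (λ a l w p q W μ → a :+ l :+ w :+ p :+ q :+ W :+ μ := l :+ (a :+ w :+ p :+ q :+ W :+ μ)) refl (n + m) ∑ℓ ∑w num den W μ)
    ∑w≤mag : ∑w ≤ mag
    ∑w≤mag = bigger ∑w (n + m + ∑ℓ + num + den + W + μ)
      (solve 7 (λ a l w p q W μ → a :+ l :+ w :+ p :+ q :+ W :+ μ := w :+ (a :+ l :+ p :+ q :+ W :+ μ)) refl (n + m) ∑ℓ ∑w num den W μ)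
    num≤ : num ≤ mag
    num≤ = bigger num (n + m + ∑ℓ + ∑w + den + W + μ)
      (solve 7 (λ a l w p q W μ → a :+ l :+ w :+ p :+ q :+ W :+ μ := p :+ (a :+ l :+ w :+ q :+ W :+ μ)) refl (n + m) ∑ℓ ∑w num den W μ)
    μ≤ : μ ≤ mag
    μ≤ = m≤n+m μ (n + m + ∑ℓ + ∑w + num + den + W)
    n≤ : n ≤ mag
    n≤ = ≤-trans (m≤m+n n m) n+m≤
    m≤ : m ≤ mag
    m≤ = ≤-trans (m≤n+m m n) n+m≤

    mag≤Q : mag ≤ Q
    mag≤Q = m≤n+m mag 2

    product< : ∀ {x y} → x ≤ mag → y ≤ mag → suc (x * y) ≤ Q * Q
    product< p q = ≤-trans (s≤s (*-mono-≤ p (≤-trans q mag≤Q)))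
      (≤-trans (+-monoˡ-≤ (mag * Q) (s≤s z≤n)) (*-monoˡ-≤ Q (n≤1+n (suc mag))))

    big≤ : big ≤ Q * Q
    big≤ = product< num≤ ∑ℓ≤

    Q³ : Q * Q * Q ≡ Q ^ 3
    Q³ = solve 1 (λ q → q :* q :* q := q :^ 3) refl Q

    double-≤ : ∀ {x} k → x ≤ Q ^ k → x + x ≤ Q ^ suc k
    double-≤ {x} k p = ≤-trans (≤-trans (+-mono-≤ p p) (≤-reflexive (solve 1 (λ x → x :+ x := con 2 :* x) refl (Q ^ k))))
      (*-monoˡ-≤ (Q ^ k) {2} {Q} (s≤s (s≤s z≤n)))

    Q²≡ : Q * Q ≡ Q ^ 2
    Q²≡ = cong (Q *_) (sym (*-identityʳ Q))

    power-≤ : ∀ {k} → k ≤ 4 → Q ^ k ≤ B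
    power-≤ {k} k≤4 = ≤-trans (^-monoʳ-≤ Q (≤-trans k≤4 (m≤n+m 4 (4 * dA)))) fits

    Q≤Q³ : Q ≤ Q ^ 3
    Q≤Q³ = ≤-trans (≤-reflexive (sym (*-identityʳ Q))) (*-monoʳ-≤ Q (m^n>0 Q 2))

    sum-≤ : ∀ {x y} → x ≤ Q ^ 3 → y ≤ Q → x + y ≤ Q ^ 4
    sum-≤ p q = ≤-trans (+-mono-≤ p (≤-trans q Q≤Q³)) (double-≤ 3 ≤-refl)

  room : Room
  room = record
    { big+big≤ = ≤-trans (double-≤ 2 (≤-trans big≤ (≤-reflexive Q²≡))) (power-≤ {3} (s≤s (s≤s (s≤s z≤n))))
    ; n²≤ = ≤-trans (≤-trans (n≤1+n _) (≤-trans (product< n≤ n≤) (≤-reflexive Q²≡))) (power-≤ {2} (s≤s (s≤s z≤n)))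
    ; ∑w≤ = ≤-trans (≤-trans ∑w≤mag (≤-trans mag≤Q (≤-reflexive (sym (*-identityʳ Q))))) (power-≤ {1} (s≤s z≤n))
    ; stack≤ = ≤-trans (sum-≤ (≤-trans (*-mono-≤ (product< μ≤ m≤) (≤-trans m≤ mag≤Q)) (≤-reflexive Q³)) (≤-trans m≤ mag≤Q)) (power-≤ {4} ≤-refl)
    }

  oracle-room : (2 + (n + m + m * big)) ^ dA ≤ B
  oracle-room = ≤-trans (^-monoˡ-≤ dA magnitude≤)
    (≤-trans (≤-reflexive (^-*-assoc Q 4 dA)) (≤-trans (^-monoʳ-≤ Q (m≤m+n (4 * dA) 4)) fits))
    where
    magnitude≤ : 2 + (n + m + m * big) ≤ Q ^ 4
    magnitude≤ = ≤-trans (≤-reflexive (solve 2 (λ a b → con 2 :+ (a :+ b) := b :+ (con 2 :+ a)) refl (n + m) (m * big)))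
      (sum-≤ (≤-trans (≤-reflexive (*-comm m big)) (≤-trans (*-mono-≤ big≤ (≤-trans m≤ mag≤Q)) (≤-reflexive Q³))) (s≤s (s≤s n+m≤)))

opaque
  -- A pass is at most 5 APSP runs if there is an edge, and `passes` is at most `5 * suc m ^ 3`. The
  -- 4 in `apspFactor` is that of `treeSize-≤`. `totalFactor` is `cubeFactor * 8`, where 8 is the
  -- price for replacing `suc m ^ 3` by `1 + m ^ 3`.
  nodeFactor cubeFactor apspFactor totalFactor : ℕ
  nodeFactor  = 700 * 5 + 1
  cubeFactor  = 1500 * 5
  apspFactor  = 4 * nodeFactor
  totalFactor = 60000

  nodeFactor≡ : 700 * 5 + 1 ≡ nodeFactor
  nodeFactor≡ = refl

  cubeFactor≡ : 1500 * 5 ≡ cubeFactor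
  cubeFactor≡ = refl

  apspFactor≡ : 4 * nodeFactor ≡ apspFactor
  apspFactor≡ = refl

  cube≤apsp : cubeFactor ≤ apspFactor
  cube≤apsp = ≤ᵇ⇒≤ 7500 14004 tt

  cube≤total : cubeFactor * 8 ≤ totalFactor
  cube≤total = ≤-refl

  apsp≤total : apspFactor ≤ totalFactor
  apsp≤total = ≤ᵇ⇒≤ 14004 60000 tt

module TimeBounds (A : APSPAlgorithm) (I : SpannerInstance) where
  open SpannerInstance I
  open SpannerTheory I

  apspTime : ℕ
  apspTime = APSPAlgorithm.time A n m

  private
    n≤2m+1 : n ≤ suc (m + m)
    n≤2m+1 = connected-n≤ connected

    suc-n≤ : suc n ≤ 2 * suc m
    suc-n≤ = ≤-trans (s≤s n≤2m+1) (≤-reflexive (solve 1 (λ m → con 2 :+ (m :+ m) := con 2 :* (con 1 :+ m)) refl m))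

    -- The 5 is the square of 2, from `suc n ≤ 2 * suc m`, plus 1 for the summand `m`.
    pass-≤ : suc n * suc n + m ≤ 5 * (suc m * suc m)
    pass-≤ = ≤-trans (+-mono-≤ (*-mono-≤ suc-n≤ suc-n≤) (≤-trans (n≤1+n m) (m≤m*n (suc m) (suc m))))
      (≤-reflexive (solve 1 (λ s → (con 2 :* s) :* (con 2 :* s) :+ s :* s := con 5 :* (s :* s)) refl (suc m)))

  passes-≤ : suc m * (suc n * suc n + m) ≤ 5 * suc m ^ 3
  passes-≤ = ≤-trans (*-monoʳ-≤ (suc m) pass-≤) (≤-reflexive (solve 1 (λ s → s :* (con 5 :* (s :* s)) := con 5 :* s :^ 3) refl (suc m)))

  -- An edge forces `1 ≤ n`, so that `suc n ≤ n + n`; with `m ≤ n * n` a pass is at most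
  -- `5 * (n * n)`, and every APSP program takes `n * n` steps.
  nodeCost-≤ : ∀ {c d x} → c * 5 + 1 ≡ d → x ≡ suc n * suc n + m → Fin m → c * x + apspTime ≤ d * apspTime
  nodeCost-≤ {c} refl refl e = ≤-trans (+-monoˡ-≤ apspTime (*-monoʳ-≤ c pass≤))
    (≤-reflexive (solve 2 (λ c t → c :* (con 5 :* t) :+ t := (c :* con 5 :+ con 1) :* t) refl c apspTime))
    where
    1≤n : 1 ≤ n
    1≤n = ≤-trans (s≤s z≤n) (toℕ<n (src e))
    pass≤ : suc n * suc n + m ≤ 5 * apspTime
    pass≤ = ≤-trans (+-mono-≤ (*-mono-≤ (+-monoˡ-≤ n 1≤n) (+-monoˡ-≤ n 1≤n)) m≤n²)
      (≤-trans (≤-reflexive (solve 1 (λ n → (n :+ n) :* (n :+ n) :+ n :* n := con 5 :* (n :* n)) refl n))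
        (*-monoʳ-≤ 5 (LowerBound.n²≤time A network)))

  encoding-≥ : suc m ≤ spannerEncodingLength I
  encoding-≥ = s≤s (≤-trans (≤-trans (≤-reflexive (sym (trans (∑-const {m} 1) (*-identityʳ m)))) (∑-mono {m} (λ e → s≤s z≤n))) (m≤n+m _ _))

  n+m≤encoding : n + m ≤ 3 * spannerEncodingLength I
  n+m≤encoding = ≤-trans (≤-trans (+-monoˡ-≤ m n≤2m+1) (≤-trans (≤-trans (≤-reflexive (cong suc (+-assoc m m m))) (m≤n+m _ 2))
      (≤-reflexive (solve 1 (λ m → con 3 :+ (m :+ (m :+ m)) := con 3 :* (con 1 :+ m)) refl m))))
    (*-monoʳ-≤ 3 encoding-≥)

-- The two running-time statements

module _ (A : APSPAlgorithm) where
  private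
    module A = APSPAlgorithm A

    degree : ℕ
    degree = 4 * proj₁ A.solves + 4

    -- The common source of both time bounds. It is quantified over `h` since the program does not
    -- compute it.
    Raw : (I : SpannerInstance) → ℕ → Set
    Raw I t = ∀ h → SpannerInstance.LocalNeighborhoodSize I h →
      t ≤ cubeFactor * suc (SpannerInstance.m I) ^ 3 + apspFactor * (h ^ (2 * SpannerInstance.μ I) * A.time (SpannerInstance.n I) (SpannerInstance.m I))

  solver-solves : SolvesIn Spanner Raw (solver A.program)
  solver-solves = degree , λ I B s le b inp → run I B s le b inp
    where
    run : ∀ I B s → (2 + spannerMagnitude I) ^ degree ≤ B → Bounded B s → SpannerInput I s →
      ∃₂ λ t s′ → B ⊢ solver A.program , s ⇓[ t ] s′ × SpannerAnswer I s′ × Raw I t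
    run I B s le b ((r0 , r1 , a0 , a1 , a2) , r2 , r3 , r4 , r5 , a3) =
      clean (Solving.solver-ok A I B (WordSize.room I (proj₁ A.solves) B le) (WordSize.oracle-room I (proj₁ A.solves) B le) b
        (record { r0 = r0 ; r1 = r1 ; r2 = r2 ; r3 = r3 ; r4 = r4 ; r5 = r5 ; a0 = a0 ; a1 = a1 ; a2 = a2 ; a3 = a3 }))
      where
      open SpannerInstance I
      open TimeBounds A I
      module M = Machine I B
      module Pre = Preprocessing I B (WordSize.room I (proj₁ A.solves) B le)
      module S = Solving A I B (WordSize.room I (proj₁ A.solves) B le) (WordSize.oracle-room I (proj₁ A.solves) B le)
      linear : 1500 * Pre.passes ≤ cubeFactor * suc m ^ 3
      linear = ≤-trans (*-monoʳ-≤ 1500 (≤-trans (≤-reflexive (trans Pre.passes≡ (cong (suc m *_) M.pass≡))) passes-≤))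
        (≤-reflexive (trans (sym (*-assoc 1500 5 (suc m ^ 3))) (cong (_* suc m ^ 3) {1500 * 5} {cubeFactor} cubeFactor≡)))
      clean : (∃₂ λ t s′ → B ⊢ solver A.program , s ⇓[ t ] s′ × SpannerAnswer I s′
        × (∀ h → LocalNeighborhoodSize h → (t ≤ 1500 * Pre.passes) ⊎ (Fin m × t ≤ 1500 * Pre.passes + h ^ (2 * μ) * (4 * S.nodeCost)))) →
        ∃₂ λ t s′ → B ⊢ solver A.program , s ⇓[ t ] s′ × SpannerAnswer I s′ × Raw I t
      clean (t , s′ , p , ans , bnd) = t , s′ , p , ans , λ h lns → final h (bnd h lns)
        where
        regroup : ∀ H c → H * (4 * (c * A.time n m)) ≡ (4 * c) * (H * A.time n m)
        regroup H c = solve 3 (λ H c t → H :* (con 4 :* (c :* t)) := (con 4 :* c) :* (H :* t)) refl H c (A.time n m)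
        final : ∀ h → _ ⊎ _ → t ≤ cubeFactor * suc m ^ 3 + apspFactor * (h ^ (2 * μ) * A.time n m)
        final h (inj₁ l) = ≤-trans l (≤-trans linear (m≤m+n _ _))
        final h (inj₂ (e , l)) = ≤-trans l (+-mono-≤ linear (≤-trans (*-monoʳ-≤ (h ^ (2 * μ)) (*-monoʳ-≤ 4
            (≤-trans (≤-reflexive S.nodeCost≡) (nodeCost-≤ {700} nodeFactor≡ M.pass≡ e))))
          (≤-reflexive (trans (regroup (h ^ (2 * μ)) nodeFactor) (cong (_* (h ^ (2 * μ) * A.time n m)) apspFactor≡)))))

  solves-mono : ∀ {Time Time′ : SpannerInstance → ℕ → Set} {c} → (∀ I t → Time I t → Time′ I t) → SolvesIn Spanner Time c → SolvesIn Spanner Time′ c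
  solves-mono f (d , h) = d , λ I B s le b inp → let t , s′ , p , o , l = h I B s le b inp in t , s′ , p , o , f I t l

  𝒪-bound : ∀ I t → Raw I t → let open SpannerInstance I in ∀ h → LocalNeighborhoodSize h →
    t ≤𝒪[ totalFactor ] (h ^ (2 * μ) * A.time n m + m ^ 3 + m ^ 2 * n * ⌈log₂ n ⌉)
  𝒪-bound I t raw h lns = begin
    t                                                 ≤⟨ raw h lns ⟩
    cubeFactor * suc m ^ 3 + apspFactor * X           ≤⟨ +-mono-≤ (*-monoʳ-≤ cubeFactor (suc-cube-≤ m)) (*-monoˡ-≤ X apsp≤total) ⟩
    cubeFactor * (8 * (1 + m ^ 3)) + totalFactor * X  ≡⟨ cong (_+ totalFactor * X) (*-assoc cubeFactor 8 (1 + m ^ 3)) ⟨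
    cubeFactor * 8 * (1 + m ^ 3) + totalFactor * X    ≤⟨ +-monoˡ-≤ (totalFactor * X) (*-monoˡ-≤ (1 + m ^ 3) cube≤total) ⟩
    totalFactor * (1 + m ^ 3) + totalFactor * X       ≡⟨ *-distribˡ-+ totalFactor (1 + m ^ 3) X ⟨
    totalFactor * (1 + m ^ 3 + X)                     ≤⟨ *-monoʳ-≤ totalFactor (s≤s (≤-trans (≤-reflexive (+-comm (m ^ 3) X)) (m≤m+n _ Y))) ⟩
    totalFactor * (1 + (X + m ^ 3 + Y))               ∎
    where
    open SpannerInstance I
    open ≤-Reasoning
    X = h ^ (2 * μ) * A.time n m
    Y = m ^ 2 * n * ⌈log₂ n ⌉

  timePoly : Polynomial
  timePoly = (0 ∷ 0 ∷ 0 ∷ 1 ∷ []) ⊕ₚ dilate 3 (proj₁ A.polynomial-time)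

  fpt-bound : ∀ I t → Raw I t → ∀ k h → SpannerParameter I k h →
    t ≤𝒪[ apspFactor ] (paramCost k h * ⟦ timePoly ⟧ (spannerEncodingLength I))
  fpt-bound I t raw k h (refl , lns) = begin
    t                                       ≤⟨ raw h lns ⟩
    cubeFactor * suc m ^ 3 + apspFactor * (h ^ (2 * μ) * A.time n m)
      ≤⟨ +-mono-≤ (*-mono-≤ cube≤apsp cube≤) (*-monoʳ-≤ apspFactor (*-mono-≤ power≤ time≤)) ⟩
    apspFactor * (P * E³) + apspFactor * (P * R) ≡⟨ *-distribˡ-+ apspFactor (P * E³) (P * R) ⟨
    apspFactor * (P * E³ + P * R)           ≡⟨ cong (apspFactor *_) (*-distribˡ-+ P E³ R) ⟨
    apspFactor * (P * (E³ + R))             ≡⟨ cong (λ z → apspFactor * (P * z)) value ⟨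
    apspFactor * (P * ⟦ timePoly ⟧ E)       ≤⟨ *-monoʳ-≤ apspFactor (n≤1+n _) ⟩
    apspFactor * (1 + P * ⟦ timePoly ⟧ E)   ∎
    where
    open SpannerInstance I
    open TimeBounds A I
    open ≤-Reasoning
    E = spannerEncodingLength I
    E³ = E ^ 3
    P = paramCost μ h
    R = ⟦ proj₁ A.polynomial-time ⟧ (3 * E)
    value : ⟦ timePoly ⟧ E ≡ E³ + R
    value = trans (⊕ₚ-⟦⟧ (0 ∷ 0 ∷ 0 ∷ 1 ∷ []) (dilate 3 (proj₁ A.polynomial-time)) E)
      (cong₂ _+_ (solve 1 (λ e → e :* (e :* (e :* (con 1 :+ e :* con 0))) := e :^ 3) refl E) (dilate-⟦⟧ 3 (proj₁ A.polynomial-time) E))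
    1≤P : 1 ≤ P
    1≤P = m^n>0 (suc h * suc h) μ
    cube≤ : suc m ^ 3 ≤ P * E³
    cube≤ = ≤-trans (^-monoˡ-≤ 3 encoding-≥) (≤-trans (≤-reflexive (sym (*-identityˡ E³))) (*-monoˡ-≤ E³ 1≤P))
    power≤ : h ^ (2 * μ) ≤ P
    power≤ = ≤-trans (≤-reflexive (sym (trans (cong (_^ μ) (cong (h *_) (sym (*-identityʳ h)))) (^-*-assoc h 2 μ))))
      (^-monoˡ-≤ μ (*-mono-≤ (n≤1+n h) (n≤1+n h)))
    time≤ : A.time n m ≤ R
    time≤ = ≤-trans (proj₂ A.polynomial-time n m) (⟦⟧-mono (proj₁ A.polynomial-time) n+m≤encoding)

corollary14 : (A : APSPAlgorithm) →
    ∃ λ (c : Cmd) →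
    IsFPT Spanner spannerEncodingLength SpannerParameter c
    × ∃ λ (C : ℕ) →
    SolvesIn Spanner
    (λ I t → let open SpannerInstance I in
    ∀ h → LocalNeighborhoodSize h →
    t ≤𝒪[ C ] (h ^ (2 * μ) * APSPAlgorithm.time A n m + m ^ 3 + m ^ 2 * n * ⌈log₂ n ⌉))
    c
corollary14 A = solver (APSPAlgorithm.program A) ,
  (paramCost , paramCost-computable , timePoly A , apspFactor , solves-mono A (fpt-bound A) (solver-solves A)) ,
  totalFactor , solves-mono A (𝒪-bound A) (solver-solves A)
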